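{- Let $(\mathcal N,\mathcal O,\mathfrak l)$ be a plabic network representing a point $[A]\in\mathcal S^{\mathrm{TNN}}_{\mathcal M}\subset Gr^{\mathrm{TNN}}(k,n)$, with orientation $\mathcal O$ associated to the base $I=\{1\le i_1<i_2<\dots<i_k\le n\}$ in the matroid $\mathcal M$ and with gauge ray direction $\mathfrak l$. Assign vectors $B_j$ to the boundary sinks $b_j$, $j\in\bar I=[n]\setminus I$. Then the edge vector $$E_e=\sum_{j\in\bar I}\Big(\sum_{\mathcal P:\,e\to b_j}(-1)^{\mathrm{wind}(\mathcal P)+\mathrm{int}(\mathcal P)}w(\mathcal P)\Big)B_j$$ at any edge $e$ is a rational expression in the weights of the network with subtraction-free denominator: $$E_e=\sum_{j\in\bar I}\left[\frac{\displaystyle\sum_{F\in\mathcal F_{e,b_j}(\mathcal G)}(-1)^{\mathrm{wind}(F)+\mathrm{int}(F)}\,w(F)}{\displaystyle\sum_{C\in\mathcal C(\mathcal G)}w(C)}\right]B_j .$$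
   Context: $Gr^{\mathrm{TNN}}(k,n)=GL_k^+\backslash Mat^{\mathrm{TNN}}_{k,n}$, where $Mat^{\mathrm{TNN}}_{k,n}$ is the set of real $k\times n$ matrices of rank $k$ with non-negative maximal minors $\Delta_J$. For a matroid $\mathcal M$ (collection of $k$-subsets of $[n]$), $\mathcal S^{\mathrm{TNN}}_{\mathcal M}=\{[A]:\Delta_J(A)>0\text{ if }J\in\mathcal M,\ \Delta_J(A)=0\text{ if }J\notin\mathcal M\}$. Fix positive integers $k<n$. A plabic graph $\mathcal G$ of type $(k,n)$ is a finite directed graph drawn planarly in a disk, with no component isolated from the boundary, such that: it has $n$ boundary vertices $b_1,\dots,b_n$ labelled clockwise, all on a common straight interval of the boundary of the disk, each of degree 1 (a boundary source if its edge is outgoing, a boundary sink if incoming; exactly $k$ are sources); all other (internal) vertices are strictly inside the disk and are bivalent or trivalent; each internal vertex either has exactly one incoming edge (white) or exactly one outgoing edge (black), bivalent vertices being assigned either colour. Edges are straight segments, regarded as vectors directed by the orientation $\mathcal O$. $I$ indexes the boundary sources. A plabic network $\mathcal N$ is a plabic graph with a positive weight $w_e$ on each edge. $\mathcal N$ represents $[A]$ if $[A]$ is the class of the matrix with identity submatrix in the columns $I$ and entries $A^r_j=(-1)^{\sigma(i_r,j)}\sum_{P:b_{i_r}\to b_j}(-1)^{\mathrm{wind}_{top}(P)}w(P)$ for $j\in\bar I$, where $\sigma(i_r,j)$ is the number of elements of $I$ strictly between $i_r$ and $j$, the sum is over directed walks from $b_{i_r}$ to $b_j$, and $\mathrm{wind}_{top}$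 is the topological winding index ($(-1)^{\mathrm{wind}_{top}(P)}=(-1)^{\text{number of loops removed in the loop erasure of }P}$). A gauge ray direction $\mathfrak l$ is an oriented direction such that the ray in direction $\mathfrak l$ from any boundary vertex points inside the disk, no internal edge is parallel to $\mathfrak l$, and the rays starting at boundary vertices contain no internal vertices. $\mathfrak l_i$ is the ray starting at $b_i$. For plane vectors $s(u,v)=+1,0,-1$ if $(u,v)$ is positively (counterclockwise) oriented, parallel, negatively oriented. For consecutive edges, $\mathrm{wind}(e,f)=\pm1$ if $s(e,f)=s(e,\mathfrak l)=s(\mathfrak l,f)=\pm1$, and $0$ otherwise. $\mathrm{int}(e)$ is the number of intersections of $e$ with the rays $\mathfrak l_{i_r}$, $r\in[k]$ (the common starting point of $\mathfrak l_{i_r}$ and the edge at $b_{i_r}$ is not counted). For a directed path $\mathcal P=(e_1,\dots,e_m)$ (edges may repeat): $w(\mathcal P)=\prod w_{e_l}$ with multiplicity, $\mathrm{wind}(\mathcal P)=\sum_{l=1}^{m-1}\mathrm{wind}(e_l,e_{l+1})$, $\mathrm{int}(\mathcal P)=\sum_{l=1}^m\mathrm{int}(e_l)$. $\mathcal P:e\to b_j$ means a directed path with first edge $e$ ending at $b_j$; the (possibly infinite) sum over such paths is a formal power series in the weights, convergent for sufficiently small weights, and an empty sum is $0$. Edge loop-erased walk: a directed path starting with $e$ and ending at $b_j$ with all edges distinct. An edge flow at $e$ is a collection $F$ of distinct edges such that: $e\in F$; at every internal vertex other than the starting vertex $V$ of $e$ the number of edges of $F$ arriving equals the number leaving; at $V$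 the number arriving equals the number leaving minus 1; $F$ contains no edges at boundary sources except possibly $e$. $\mathcal F_{e,b_j}(\mathcal G)$ is the set of edge flows at $e$ containing the edge at the sink $b_j$; each such $F$ is the union of an edge loop-erased walk $P_{e,b_j}$ from $e$ to $b_j$ and a (possibly trivial) conservative flow having no common edges with it. $w(F)$ is the product of the weights of the edges in $F$, $\mathrm{wind}(F)=\mathrm{wind}(P_{e,b_j})$, $\mathrm{int}(F)=\mathrm{int}(P_{e,b_j})$. A conservative flow is a collection $C$ of distinct edges, none incident to the boundary, such that at each internal vertex the numbers of edges of $C$ arriving and leaving coincide; $\mathcal C(\mathcal G)$ is the set of conservative flows, including the empty one with weight 1, and $w(C)$ is the product of the weights of its edges. -}

module Defs where

open import Level using (_⊔_) renaming (suc to lsuc)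
open import Algebra using (CommutativeRing; Semiring)
open import Algebra.Definitions using (Invertible)
open import Algebra.Module using (Module)
import Algebra.Definitions.RawSemiring as RawSemiringDefinitions
import Algebra.Properties.Monoid.Mult as MonoidMult
import Algebra.Properties.Ring as RingProperties
import Algebra.Properties.Semiring.Mult as SemiringMult
import Algebra.Solver.Ring as RingSolver
open import Algebra.Solver.Ring.AlmostCommutativeRing using (fromCommutativeRing; _-Raw-AlmostCommutative⟶_; Induced-equivalence)
open import Data.Bool using (if_then_else_)
open import Data.Fin as Fin using (Fin; toℕ; punchIn)
open import Data.Fin.Properties as Fin using (all?; any?)
open import Data.Fin.Subset as Subset using (Subset; ⊤; ⁅_⁆; ⋃; _∪_; _∩_; _─_; _∈_; _∉_; _⊆_; ∣_∣; inside; outside)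
open import Data.Fin.Subset.Properties using (_∈?_; _⊆?_)
open import Data.Integer as ℤ using (ℤ; +_; -[1+_]; 0ℤ; 1ℤ; -1ℤ)
open import Data.Integer.Properties as ℤ using ()
open import Data.List as List using (List; []; _∷_; _++_; map; filter; concatMap; foldr; allFin; upTo; length; head; last; dropWhile)
open import Data.List.Membership.DecPropositional using () renaming (_∈?_ to member?)
open import Data.List.Relation.Unary.Linked using (Linked; linked?)
open import Data.List.Relation.Unary.Unique.Propositional using (Unique)
open import Data.List.Relation.Unary.Unique.DecPropositional using (unique?)
open import Data.Maybe as Maybe using (Maybe; just; fromMaybe)
open import Data.Maybe.Properties as Maybe using ()
open import Data.Nat as ℕ using (ℕ; zero; suc)
import Data.Nat.ListAction as ℕ using (sum)
open import Data.Nat.Properties as ℕ using ()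
open import Data.Product using (∃; ∃₂; _×_; _,_; proj₁; proj₂)
import Data.Sign as Sign
open import Data.Sum using (_⊎_; inj₁; inj₂)
open import Data.Sum.Properties as Sum using ()
open import Data.Vec as Vec using (Vec; []; _∷_; lookup; tabulate; zipWith)
open import Data.Vec.Properties as Vec using ()
open import Function using (_∘_; _⇔_)
open import Relation.Binary using (Rel; DecidableEquality; WeaklyDecidable; IsStrictTotalOrder; tri<; tri≈; tri>)
open import Relation.Binary.Construct.Closure.Equivalence using (EqClosure)
import Relation.Binary.Construct.StrictToNonStrict as StrictToNonStrict
open import Relation.Binary.PropositionalEquality as ≡ using (_≡_; _≢_; _≗_)
import Relation.Binary.Reasoning.Setoid as SetoidReasoning
open import Relation.Nullary using (¬_; Dec; yes; no; does)
open import Relation.Nullary.Decidable using (¬?; _×-dec_; _⊎-dec_; _→-dec_; map′; dec⇒maybe)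
open import Relation.Unary using (Pred; Decidable)

module IntegerMultiples {c ℓ} (𝑹 : CommutativeRing c ℓ) where
  open CommutativeRing 𝑹
  open RawSemiringDefinitions (Semiring.rawSemiring semiring) using () renaming (_×_ to _×ᵣ_)

  fromℤ : ℤ → Carrier
  fromℤ (+ m)    = m ×ᵣ 1#
  fromℤ -[1+ m ] = - (suc m ×ᵣ 1#)

  private
    open RingProperties ring
    open SetoidReasoning setoid
    open MonoidMult +-monoid using (×-homo-+)
    open SemiringMult semiring using (×1-homo-*)

    ι : ℕ → Carrier
    ι m = m ×ᵣ 1#

    telescope : ∀ x y z → (x + y) - (x + z) ≈ y - z
    telescope x y z = begin
      (x + y) - (x + z)     ≈⟨ +-cong (+-comm x y) (-‿cong (+-comm x z)) ⟩
      (y + x) - (z + x)     ≈⟨ +-congˡ (-‿anti-homo-+ z x) ⟩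
      (y + x) + (- x + - z) ≈⟨ +-assoc y x _ ⟩
      y + (x + (- x + - z)) ≈⟨ +-congˡ (+-assoc x (- x) (- z)) ⟨
      y + ((x - x) + - z)   ≈⟨ +-congˡ (+-congʳ (-‿inverseʳ x)) ⟩
      y + (0# + - z)        ≈⟨ +-congˡ (+-identityˡ (- z)) ⟩
      y - z                 ∎

    ⊖-homo : ∀ m n → fromℤ (m ℤ.⊖ n) ≈ ι m - ι n
    ⊖-homo m       zero    = sym (trans (+-congˡ -0#≈0#) (+-identityʳ (ι m)))
    ⊖-homo zero    (suc n) = sym (+-identityˡ (- ι (suc n)))
    ⊖-homo (suc m) (suc n) = begin
      fromℤ (suc m ℤ.⊖ suc n) ≡⟨ ≡.cong fromℤ (ℤ.[1+m]⊖[1+n]≡m⊖n m n) ⟩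
      fromℤ (m ℤ.⊖ n)         ≈⟨ ⊖-homo m n ⟩
      ι m - ι n               ≈⟨ telescope 1# (ι m) (ι n) ⟨
      ι (suc m) - ι (suc n)   ∎

    +-homo : ∀ i j → fromℤ (i ℤ.+ j) ≈ fromℤ i + fromℤ j
    +-homo (+ m)    (+ n)    = ×-homo-+ 1# m n
    +-homo (+ m)    -[1+ n ] = ⊖-homo m (suc n)
    +-homo -[1+ m ] (+ n)    = trans (⊖-homo n (suc m)) (+-comm _ _)
    +-homo -[1+ m ] -[1+ n ] = begin
      - ι (suc (suc m ℕ.+ n))   ≡⟨ ≡.cong (-_ ∘ ι) (ℕ.+-suc (suc m) n) ⟨
      - ι (suc m ℕ.+ suc n)     ≈⟨ -‿cong (×-homo-+ 1# (suc m) (suc n)) ⟩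
      - (ι (suc m) + ι (suc n)) ≈⟨ -‿+-comm _ _ ⟨
      - ι (suc m) - ι (suc n)   ∎

    neg-homo : ∀ i → fromℤ (ℤ.- i) ≈ - fromℤ i
    neg-homo (+ zero)  = sym -0#≈0#
    neg-homo (+ suc m) = refl
    neg-homo -[1+ m ]  = sym (-‿involutive _)

    -◃ : ∀ m → fromℤ (Sign.- ℤ.◃ m) ≈ - ι m
    -◃ zero    = sym -0#≈0#
    -◃ (suc m) = refl

    *-homo : ∀ i j → fromℤ (i ℤ.* j) ≈ fromℤ i * fromℤ j
    *-homo (+ m) (+ n) = trans (reflexive (≡.cong fromℤ (ℤ.+◃n≡+n (m ℕ.* n)))) (×1-homo-* m n)
    *-homo (+ m) -[1+ n ] =
      trans (-◃ (m ℕ.* suc n)) (trans (-‿cong (×1-homo-* m (suc n))) (-‿distribʳ-* _ _))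
    *-homo -[1+ m ] (+ n) =
      trans (-◃ (suc m ℕ.* n)) (trans (-‿cong (×1-homo-* (suc m) n)) (-‿distribˡ-* _ _))
    *-homo -[1+ m ] -[1+ n ] = begin
      ι (suc m ℕ.* suc n)       ≈⟨ ×1-homo-* (suc m) (suc n) ⟩
      ι (suc m) * ι (suc n)     ≈⟨ -‿involutive _ ⟨
      - - (ι (suc m) * ι (suc n)) ≈⟨ -‿cong (-‿distribʳ-* _ _) ⟩
      - (ι (suc m) * - ι (suc n)) ≈⟨ -‿distribˡ-* _ _ ⟩
      - ι (suc m) * - ι (suc n) ∎

    morphism : ℤ.+-*-rawRing -Raw-AlmostCommutative⟶ fromCommutativeRing 𝑹
    morphism = record
      { ⟦_⟧ = fromℤ ; +-homo = +-homo ; *-homo = *-homo ; -‿homo = neg-homo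
      ; 0-homo = refl ; 1-homo = +-identityʳ 1# }

    _coeff≟_ : WeaklyDecidable (Induced-equivalence morphism)
    i coeff≟ j = Maybe.map (reflexive ∘ ≡.cong fromℤ) (dec⇒maybe (i ℤ.≟ j))

  module Solver = RingSolver ℤ.+-*-rawRing (fromCommutativeRing 𝑹) morphism _coeff≟_

-- The real numbers enter only as an ordered field in which the sign of an
-- element can be decided; classically ℝ is such a field.

record OrderedField c ℓ₁ ℓ₂ : Set (lsuc (c ⊔ ℓ₁ ⊔ ℓ₂)) where
  infix 4 _<_
  field
    commutativeRing : CommutativeRing c ℓ₁
  open CommutativeRing commutativeRing public
  field
    _<_                : Rel Carrier ℓ₂
    isStrictTotalOrder : IsStrictTotalOrder _≈_ _<_
    0<1                : 0# < 1#
    +-monoˡ-<          : ∀ z {x y} → x < y → x + z < y + z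
    *-positive         : ∀ {x y} → 0# < x → 0# < y → 0# < x * y
    invertible         : ∀ x → ¬ x ≈ 0# → Invertible _≈_ 1# _*_ x

  open IsStrictTotalOrder isStrictTotalOrder public
    using (compare; _≟_; _<?_; irrefl; asym; <-resp-≈; <-respˡ-≈; <-respʳ-≈)
    renaming (trans to <-trans)
  open StrictToNonStrict _≈_ _<_ public using (_≤_)
  open IntegerMultiples commutativeRing public using (fromℤ)
  open RawSemiringDefinitions (Semiring.rawSemiring semiring) public
    using (sum; product; _^_)

  infix 8 _⁻¹

  -- Total inversion, with 0⁻¹ = 0.
  _⁻¹ : Carrier → Carrier
  x ⁻¹ with x ≟ 0#
  ... | yes _   = 0#
  ... | no  x≉0 = proj₁ (invertible x x≉0)

  sign : Carrier → ℤ
  sign x with compare x 0#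
  ... | tri< _ _ _ = -1ℤ
  ... | tri≈ _ _ _ = 0ℤ
  ... | tri> _ _ _ = 1ℤ

  det : ∀ {m} → (Fin m → Fin m → Carrier) → Carrier
  det {zero}  A = 1#
  det {suc m} A = sum λ j →
    (- 1#) ^ toℕ j * (A Fin.zero j * det (λ r c → A (Fin.suc r) (punchIn j c)))

module Plane {c ℓ₁ ℓ₂} (𝕂 : OrderedField c ℓ₁ ℓ₂) where
  open OrderedField 𝕂

  Point : Set c
  Point = Carrier × Carrier

  infix  4 _≋_
  infixl 6 _⊕_ _⊖_
  infixr 7 _·_

  _≋_ : Rel Point ℓ₁
  (x , y) ≋ (x′ , y′) = (x ≈ x′) × (y ≈ y′)

  _⊕_ _⊖_ : Point → Point → Point
  (x , y) ⊕ (x′ , y′) = x + x′ , y + y′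
  (x , y) ⊖ (x′ , y′) = x - x′ , y - y′

  _·_ : Carrier → Point → Point
  t · (x , y) = t * x , t * y

  -- Positive exactly when (u , v) is counterclockwise.
  cross : Point → Point → Carrier
  cross (a , b) (c , d) = a * d - b * c

  s : Point → Point → ℤ
  s u v = sign (cross u v)

  OnSegment : Point → Point → Point → Set (c ⊔ ℓ₁ ⊔ ℓ₂)
  OnSegment p q x = ∃ λ u → 0# ≤ u × u ≤ 1# × x ≋ p ⊕ u · (q ⊖ p)

  -- The segment from p to q is not parallel to l, and meets the ray from b
  -- in direction l at a point other than b.
  MeetsRay : (b l p q : Point) → Set (c ⊔ ℓ₁ ⊔ ℓ₂)
  MeetsRay b l p q =
    ¬ cross l (q ⊖ p) ≈ 0# × ∃ λ t → 0# < t × OnSegment p q (b ⊕ t · l)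

  meetsRay? : ∀ b l p q → Dec (MeetsRay b l p q)
  meetsRay? b@(b₁ , b₂) l@(l₁ , l₂) p@(p₁ , p₂) q@(q₁ , q₂)
    with cross l (q ⊖ p) ≟ 0#
  ... | yes z≈0 = no λ (z≉0 , _) → z≉0 z≈0
  ... | no  z≉0 = map′ to from (0# <? t ×-dec (0# ≤? u ×-dec u ≤? 1#))
    where
    open IntegerMultiples.Solver commutativeRing
    open SetoidReasoning setoid

    _≤?_ : ∀ x y → Dec (x ≤ y)
    x ≤? y = x <? y ⊎-dec x ≟ y

    ≤-resp : ∀ {x x′ y y′} → x ≈ x′ → y ≈ y′ → x ≤ y → x′ ≤ y′
    ≤-resp x≈x′ y≈y′ (inj₁ x<y) = inj₁ (<-respˡ-≈ x≈x′ (<-respʳ-≈ y≈y′ x<y))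
    ≤-resp x≈x′ y≈y′ (inj₂ x≈y) = inj₂ (trans (sym x≈x′) (trans x≈y y≈y′))

    v₁ = q₁ - p₁
    v₂ = q₂ - p₂
    w₁ = p₁ - b₁
    w₂ = p₂ - b₂

    i = proj₁ (invertible (cross l (q ⊖ p)) z≉0)
    zi≈1 : cross l (q ⊖ p) * i ≈ 1#
    zi≈1 = proj₂ (proj₂ (invertible (cross l (q ⊖ p)) z≉0))

    -- Cramer's rule for b + t l = p + u v.
    t = (w₁ * v₂ - w₂ * v₁) * i
    u = (w₁ * l₂ - w₂ * l₁) * i

    cramer₁ : b₁ + t * l₁ ≈ p₁ + u * v₁
    cramer₁ = begin
      b₁ + t * l₁                                           ≈⟨ solve 8 (λ b p l₁ l₂ v₁ v₂ w₂ i →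
        b :+ ((p :- b) :* v₂ :- w₂ :* v₁) :* i :* l₁ := b :+ (p :- b) :* ((l₁ :* v₂ :- l₂ :* v₁) :* i)
          :+ ((p :- b) :* l₂ :- w₂ :* l₁) :* i :* v₁) refl b₁ p₁ l₁ l₂ v₁ v₂ w₂ i ⟩
      b₁ + w₁ * ((l₁ * v₂ - l₂ * v₁) * i) + u * v₁          ≈⟨ +-congʳ (+-congˡ (*-congˡ zi≈1)) ⟩
      b₁ + w₁ * 1# + u * v₁                                 ≈⟨ +-congʳ (+-congˡ (*-identityʳ w₁)) ⟩
      b₁ + (p₁ - b₁) + u * v₁                               ≈⟨ solve 3 (λ b p x →
        b :+ (p :- b) :+ x := p :+ x) refl b₁ p₁ (u * v₁) ⟩
      p₁ + u * v₁                                           ∎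

    cramer₂ : b₂ + t * l₂ ≈ p₂ + u * v₂
    cramer₂ = begin
      b₂ + t * l₂                                           ≈⟨ solve 8 (λ b p l₁ l₂ v₁ v₂ w₁ i →
        b :+ (w₁ :* v₂ :- (p :- b) :* v₁) :* i :* l₂ := b :+ (p :- b) :* ((l₁ :* v₂ :- l₂ :* v₁) :* i)
          :+ (w₁ :* l₂ :- (p :- b) :* l₁) :* i :* v₂) refl b₂ p₂ l₁ l₂ v₁ v₂ w₁ i ⟩
      b₂ + w₂ * ((l₁ * v₂ - l₂ * v₁) * i) + u * v₂          ≈⟨ +-congʳ (+-congˡ (*-congˡ zi≈1)) ⟩
      b₂ + w₂ * 1# + u * v₂                                 ≈⟨ +-congʳ (+-congˡ (*-identityʳ w₂)) ⟩
      b₂ + (p₂ - b₂) + u * v₂                               ≈⟨ solve 3 (λ b p x →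
        b :+ (p :- b) :+ x := p :+ x) refl b₂ p₂ (u * v₂) ⟩
      p₂ + u * v₂                                           ∎

    difference : ∀ b x p y → b + x ≈ p + y → p - b ≈ x - y
    difference b x p y eq = begin
      p - b             ≈⟨ solve 3 (λ p b y → p :- b := (p :+ y) :- (b :+ y)) refl p b y ⟩
      (p + y) - (b + y) ≈⟨ +-congʳ eq ⟨
      (b + x) - (b + y) ≈⟨ solve 3 (λ b x y → (b :+ x) :- (b :+ y) := x :- y) refl b x y ⟩
      x - y             ∎

    Meets : Carrier → Carrier → Set ℓ₁
    Meets t u = (b₁ + t * l₁ ≈ p₁ + u * v₁) × (b₂ + t * l₂ ≈ p₂ + u * v₂)

    unique-t : ∀ t′ u′ → Meets t′ u′ → t′ ≈ t
    unique-t t′ u′ (eq₁ , eq₂) = begin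
      t′                                                        ≈⟨ *-identityʳ t′ ⟨
      t′ * 1#                                                   ≈⟨ *-congˡ zi≈1 ⟨
      t′ * ((l₁ * v₂ - l₂ * v₁) * i)                            ≈⟨ solve 7 (λ t u l₁ l₂ v₁ v₂ i →
        t :* ((l₁ :* v₂ :- l₂ :* v₁) :* i)
          := ((t :* l₁ :- u :* v₁) :* v₂ :- (t :* l₂ :- u :* v₂) :* v₁) :* i)
        refl t′ u′ l₁ l₂ v₁ v₂ i ⟩
      ((t′ * l₁ - u′ * v₁) * v₂ - (t′ * l₂ - u′ * v₂) * v₁) * i ≈⟨ *-congʳ (+-cong
        (*-congʳ (difference b₁ (t′ * l₁) p₁ (u′ * v₁) eq₁))
        (-‿cong (*-congʳ (difference b₂ (t′ * l₂) p₂ (u′ * v₂) eq₂)))) ⟨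
      t                                                         ∎

    unique-u : ∀ t′ u′ → Meets t′ u′ → u′ ≈ u
    unique-u t′ u′ (eq₁ , eq₂) = begin
      u′                                                        ≈⟨ *-identityʳ u′ ⟨
      u′ * 1#                                                   ≈⟨ *-congˡ zi≈1 ⟨
      u′ * ((l₁ * v₂ - l₂ * v₁) * i)                            ≈⟨ solve 7 (λ t u l₁ l₂ v₁ v₂ i →
        u :* ((l₁ :* v₂ :- l₂ :* v₁) :* i)
          := ((t :* l₁ :- u :* v₁) :* l₂ :- (t :* l₂ :- u :* v₂) :* l₁) :* i)
        refl t′ u′ l₁ l₂ v₁ v₂ i ⟩
      ((t′ * l₁ - u′ * v₁) * l₂ - (t′ * l₂ - u′ * v₂) * l₁) * i ≈⟨ *-congʳ (+-cong
        (*-congʳ (difference b₁ (t′ * l₁) p₁ (u′ * v₁) eq₁))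
        (-‿cong (*-congʳ (difference b₂ (t′ * l₂) p₂ (u′ * v₂) eq₂)))) ⟨
      u                                                         ∎

    to : 0# < t × 0# ≤ u × u ≤ 1# → MeetsRay b l p q
    to (0<t , 0≤u , u≤1) = z≉0 , t , 0<t , u , 0≤u , u≤1 , cramer₁ , cramer₂

    from : MeetsRay b l p q → 0# < t × 0# ≤ u × u ≤ 1#
    from (_ , t′ , 0<t′ , u′ , 0≤u′ , u′≤1 , eqs) =
        <-respʳ-≈ (unique-t t′ u′ eqs) 0<t′
      , ≤-resp refl (unique-u t′ u′ eqs) 0≤u′
      , ≤-resp (unique-u t′ u′ eqs) refl u′≤1

image : ∀ {k n} → (Fin k → Fin n) → Subset n
image {k} J = ⋃ (map (⁅_⁆ ∘ J) (allFin k))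

record Matroid (k n : ℕ) : Set₁ where
  field
    Basis    : Subset n → Set
    size     : ∀ {J} → Basis J → ∣ J ∣ ≡ k
    nonempty : ∃ Basis
    exchange : ∀ {J K} → Basis J → Basis K → ∀ x → x ∈ J → x ∉ K →
      ∃ λ y → y ∈ K × y ∉ J × Basis ((J Subset.- x) ∪ ⁅ y ⁆)

module Grassmannian {c ℓ₁ ℓ₂} (𝕂 : OrderedField c ℓ₁ ℓ₂) where
  open OrderedField 𝕂

  Matrix : ℕ → ℕ → Set c
  Matrix a b = Fin a → Fin b → Carrier

  -- A k-subset of [n] is given by the increasing enumeration of its elements.
  Increasing : ∀ {k n} → (Fin k → Fin n) → Set
  Increasing J = ∀ {r r′} → r Fin.< r′ → J r Fin.< J r′

  Δ : ∀ {k n} → (Fin k → Fin n) → Matrix k n → Carrier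
  Δ J A = det λ r q → A r (J q)

  -- Equality of classes in GL_k^+ \ Mat_{k,n}.
  SameClass : ∀ {k n} → Matrix k n → Matrix k n → Set (c ⊔ ℓ₁ ⊔ ℓ₂)
  SameClass {k} A A′ = ∃ λ (g : Matrix k k) →
    0# < det g × (∀ r j → A r j ≈ sum λ q → g r q * A′ q j)

  record IsTNN {k n} (A : Matrix k n) : Set (c ⊔ ℓ₁ ⊔ ℓ₂) where
    field
      -- Rank k, as linear independence of the k rows.
      independent-rows : ∀ (a : Fin k → Carrier) →
        (∀ j → sum (λ r → a r * A r j) ≈ 0#) → ∀ r → a r ≈ 0#
      minors-nonneg    : ∀ J → Increasing J → 0# ≤ Δ J A

  -- The class of A belongs to the cell of M.
  record InCell {k n} (M : Matroid k n) (A : Matrix k n) : Set (c ⊔ ℓ₁ ⊔ ℓ₂) where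
    open Matroid M
    field
      isTNN     : IsTNN A
      positive  : ∀ J → Increasing J → Basis (image J) → 0# < Δ J A
      vanishing : ∀ J → Increasing J → ¬ Basis (image J) → Δ J A ≈ 0#

-- Power series and polynomials with integer coefficients in E indeterminates.
Exponent : ℕ → Set
Exponent = Vec ℕ

Series : ℕ → Set
Series E = Exponent E → ℤ

Polynomial : ℕ → Set
Polynomial E = List (ℤ × Exponent E)

sumℤ : List ℤ → ℤ
sumℤ = foldr ℤ._+_ 0ℤ

below : ∀ {E} → Exponent E → List (Exponent E)
below []      = [] ∷ []
below (m ∷ μ) = concatMap (λ a → map (a ∷_) (below μ)) (upTo (suc m))

infixl 7 _⊛_

_⊛_ : ∀ {E} → Series E → Series E → Series E
(f ⊛ g) μ = sumℤ (map (λ α → f α ℤ.* g (zipWith ℕ._∸_ μ α)) (below μ))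

toSeries : ∀ {E} → Polynomial E → Series E
toSeries p μ = sumℤ (map proj₁ (filter (λ term → Vec.≡-dec ℕ._≟_ (proj₂ term) μ) p))

module Evaluation {c ℓ₁ ℓ₂} (𝕂 : OrderedField c ℓ₁ ℓ₂) where
  open OrderedField 𝕂

  monomial : ∀ {E} → (Fin E → Carrier) → Exponent E → Carrier
  monomial w μ = product λ e → w e ^ lookup μ e

  evaluate : ∀ {E} → (Fin E → Carrier) → Polynomial E → Carrier
  evaluate w = foldr (λ (a , μ) x → fromℤ a * monomial w μ + x) 0#

  -- The series is the expansion of a quotient of polynomials whose
  -- denominator does not vanish at w, and x is the value of that quotient.
  -- Where the series converges absolutely this is its sum.
  HasValue : ∀ {E} → Series E → (Fin E → Carrier) → Carrier → Set ℓ₁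
  HasValue f w x = ∃₂ λ p q → toSeries q ⊛ f ≗ toSeries p
    × ¬ evaluate w q ≈ 0# × evaluate w q * x ≈ evaluate w p

negOnePow : ℤ → ℤ
negOnePow i = -1ℤ ℤ.^ ℤ.∣ i ∣

subsets : ∀ n → List (Subset n)
subsets zero    = [] ∷ []
subsets (suc n) = map (outside ∷_) (subsets n) ++ map (inside ∷_) (subsets n)

words : (E m : ℕ) → List (List (Fin E))
words E zero    = [] ∷ []
words E (suc m) = concatMap (λ e → map (e ∷_) (words E m)) (allFin E)

indicator : ∀ {E} → Subset E → Exponent E
indicator = Vec.map (λ b → if b then 1 else 0)

support : ∀ {E} → List (Fin E) → Subset E
support = ⋃ ∘ map ⁅_⁆

multiplicity : ∀ {E} → List (Fin E) → Exponent E
multiplicity P = tabulate λ e → length (filter (e Fin.≟_) P)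

-- The sum of sgn P times the product of the indeterminates along P, over the
-- edge words P satisfying the predicate.  A word contributing to the
-- coefficient of μ has length equal to the total degree of μ.
wordSeries : ∀ {E ℓ} {𝒫 : Pred (List (Fin E)) ℓ} →
  Decidable 𝒫 → (List (Fin E) → ℤ) → Series E
wordSeries {E} 𝒫? sgn μ = sumℤ (map sgn (filter
  (λ P → 𝒫? P ×-dec Vec.≡-dec ℕ._≟_ (multiplicity P) μ) (words E (Vec.sum μ))))

record Digraph (n : ℕ) : Set where
  field
    internal edges : ℕ
    src tgt        : Fin edges → Fin n ⊎ Fin internal

  Edge Vertex : Set
  Edge   = Fin edges
  Vertex = Fin n ⊎ Fin internal

  boundary : Fin n → Vertex
  boundary = inj₁

  inner : Fin internal → Vertex
  inner = inj₂

  _≟ⱽ_ : DecidableEquality Vertex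
  _≟ⱽ_ = Sum.≡-dec Fin._≟_ Fin._≟_

  arriving leaving : Subset edges → Vertex → ℕ
  arriving F v = ∣ F ∩ tabulate (λ e → does (tgt e ≟ⱽ v)) ∣
  leaving  F v = ∣ F ∩ tabulate (λ e → does (src e ≟ⱽ v)) ∣

  indegree outdegree degree : Vertex → ℕ
  indegree  = arriving ⊤
  outdegree = leaving ⊤
  degree v  = indegree v ℕ.+ outdegree v

  Incident : Vertex → Edge → Set
  Incident v e = src e ≡ v ⊎ tgt e ≡ v

  Adjacent : Rel Vertex _
  Adjacent u v = ∃ λ e → src e ≡ u × tgt e ≡ v

  Consecutive : Rel Edge _
  Consecutive e f = tgt e ≡ src f

  EndsAt : Vertex → List Edge → Set
  EndsAt v P = Maybe.map tgt (last P) ≡ just v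

  endsAt? : ∀ v → Decidable (EndsAt v)
  endsAt? v P = Maybe.≡-dec _≟ⱽ_ (Maybe.map tgt (last P)) (just v)

  -- Directed paths with first edge e ending at b_j; edges may repeat.
  Path : Edge → Fin n → List Edge → Set
  Path e j P = head P ≡ just e × Linked Consecutive P × EndsAt (boundary j) P

  path? : ∀ e j → Decidable (Path e j)
  path? e j P = Maybe.≡-dec Fin._≟_ (head P) (just e)
    ×-dec (linked? (λ e f → tgt e ≟ⱽ src f) P ×-dec endsAt? (boundary j) P)

  LoopErasedWalk : Edge → Fin n → List Edge → Set
  LoopErasedWalk e j P = Path e j P × Unique P

  Walk : Fin n → Fin n → List Edge → Set
  Walk i j P = Maybe.map src (head P) ≡ just (boundary i)
    × Linked Consecutive P × EndsAt (boundary j) P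

  walk? : ∀ i j → Decidable (Walk i j)
  walk? i j P = Maybe.≡-dec _≟ⱽ_ (Maybe.map src (head P)) (just (boundary i))
    ×-dec (linked? (λ e f → tgt e ≟ⱽ src f) P ×-dec endsAt? (boundary j) P)

  -- Chronological loop erasure: the first argument is the self-avoiding walk
  -- built so far, latest vertex first, the second the vertices still to be
  -- visited.  Returning to a vertex of the former removes one loop.
  loopsRemoved : List Vertex → List Vertex → ℕ
  loopsRemoved visited []       = 0
  loopsRemoved visited (v ∷ vs) with member? _≟ⱽ_ v visited
  ... | yes _ = suc (loopsRemoved (dropWhile (λ u → ¬? (u ≟ⱽ v)) visited) vs)
  ... | no  _ = loopsRemoved (v ∷ visited) vs

  loops : List Edge → ℕ
  loops []      = 0
  loops (e ∷ P) = loopsRemoved [] (src e ∷ tgt e ∷ map tgt P)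

  ConservativeFlow : Subset edges → Set
  ConservativeFlow C =
      (∀ f → f ∈ C → ∀ j → ¬ (src f ≡ boundary j ⊎ tgt f ≡ boundary j))
    × (∀ v → arriving C (inner v) ≡ leaving C (inner v))

  conservativeFlow? : Decidable ConservativeFlow
  conservativeFlow? C =
    all? (λ f → f ∈? C →-dec all? λ j → ¬? (src f ≟ⱽ boundary j ⊎-dec tgt f ≟ⱽ boundary j))
    ×-dec all? (λ v → arriving C (inner v) ℕ.≟ leaving C (inner v))

  IsSource : Fin n → Set
  IsSource j = outdegree (boundary j) ≡ 1

  -- Edge flows at e containing the edge at b_j.
  EdgeFlow : Edge → Fin n → Subset edges → Set
  EdgeFlow e j F =
      e ∈ F
    × (∀ v → inner v ≢ src e → arriving F (inner v) ≡ leaving F (inner v))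
    × suc (arriving F (src e)) ≡ leaving F (src e)
    × (∀ f → f ∈ F → ∀ i → IsSource i → Incident (boundary i) f → f ≡ e)
    × (∃ λ f → f ∈ F × tgt f ≡ boundary j)

  edgeFlow? : ∀ e j → Decidable (EdgeFlow e j)
  edgeFlow? e j F =
    e ∈? F
    ×-dec all? (λ v → ¬? (inner v ≟ⱽ src e) →-dec arriving F (inner v) ℕ.≟ leaving F (inner v))
    ×-dec suc (arriving F (src e)) ℕ.≟ leaving F (src e)
    ×-dec all? (λ f → f ∈? F →-dec all? λ i → outdegree (boundary i) ℕ.≟ 1
      →-dec (src f ≟ⱽ boundary i ⊎-dec tgt f ≟ⱽ boundary i) →-dec f Fin.≟ e)
    ×-dec any? (λ f → f ∈? F ×-dec tgt f ≟ⱽ boundary j)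

  -- F is the union of the edge loop-erased walk P and a conservative flow
  -- without edges of P.
  Decomposes : Edge → Fin n → Subset edges → List Edge → Set
  Decomposes e j F P =
    LoopErasedWalk e j P × support P ⊆ F × ConservativeFlow (F ─ support P)

  decomposes? : ∀ e j F → Decidable (Decomposes e j F)
  decomposes? e j F P = (path? e j P ×-dec unique? Fin._≟_ P)
    ×-dec (support P ⊆? F ×-dec conservativeFlow? (F ─ support P))

  -- The edge loop-erased walk P_{e,b_j} of the flow F, found by search; having
  -- distinct edges, its length is at most the number of edges.  For an edge
  -- flow of a plabic graph exactly one word qualifies, so the default [] is
  -- never reached.
  walkOf : Edge → Fin n → Subset edges → List Edge
  walkOf e j F = fromMaybe [] (head (filter (decomposes? e j F)
    (concatMap (words edges) (upTo (suc edges)))))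

  conservativeFlowPolynomial : Polynomial edges
  conservativeFlowPolynomial =
    map (λ C → 1ℤ , indicator C) (filter conservativeFlow? (subsets edges))

data Colour : Set where
  white black : Colour

record PlabicGraph {c ℓ₁ ℓ₂} (𝕂 : OrderedField c ℓ₁ ℓ₂) (k n : ℕ)
  : Set (c ⊔ ℓ₁ ⊔ ℓ₂) where
  open OrderedField 𝕂 using (0#; _<_)
  open Plane 𝕂

  field
    digraph : Digraph n
  open Digraph digraph public

  field
    base            : Fin k → Fin n
    base-increasing : ∀ {r r′} → r Fin.< r′ → base r Fin.< base r′
    base-sources    : ∀ j → IsSource j ⇔ (∃ λ r → base r ≡ j)
    boundary-degree : ∀ j → degree (boundary j) ≡ 1
    inner-degree    : ∀ v → degree (inner v) ≡ 2 ⊎ degree (inner v) ≡ 3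
    colour          : Fin internal → Colour
    white-indegree  : ∀ v → colour v ≡ white → indegree (inner v) ≡ 1
    black-outdegree : ∀ v → colour v ≡ black → outdegree (inner v) ≡ 1
    connected       : ∀ v → ∃ λ j → EqClosure Adjacent (inner v) (boundary j)

    position           : Vertex → Point
    position-injective : ∀ u v → position u ≋ position v → u ≡ v
    edge-nondegenerate : ∀ e → src e ≢ tgt e
    planar : ∀ e f → e ≢ f → ∀ x →
      OnSegment (position (src e)) (position (tgt e)) x →
      OnSegment (position (src f)) (position (tgt f)) x →
      ∃ λ v → Incident v e × Incident v f × x ≋ position v

    -- The disk lies on one side of the line through its straight boundary
    -- interval, and its interior is represented by that open half-plane.  The
    -- axis points from b_1 towards b_n; the interior is on its right, since
    -- the labels are clockwise.
    axis     : Point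
    on-axis  : ∀ {i j} → i Fin.< j → ∃ λ t → 0# < t ×
      position (boundary j) ⊖ position (boundary i) ≋ t · axis
    interior : ∀ j v → cross axis (position (inner v) ⊖ position (boundary j)) < 0#

  vector : Edge → Point
  vector e = position (tgt e) ⊖ position (src e)

  IsSink : Fin n → Set
  IsSink j = ∀ r → base r ≢ j

  isSink? : Decidable IsSink
  isSink? j = all? λ r → ¬? (base r Fin.≟ j)

  sinks : List (Fin n)
  sinks = filter isSink? (allFin n)

record PlabicNetwork {c ℓ₁ ℓ₂} (𝕂 : OrderedField c ℓ₁ ℓ₂) (k n : ℕ)
  : Set (c ⊔ ℓ₁ ⊔ ℓ₂) where
  open OrderedField 𝕂 using (Carrier; 0#; _<_)
  field
    graph : PlabicGraph 𝕂 k n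
  open PlabicGraph graph public
  field
    weight          : Edge → Carrier
    weight-positive : ∀ e → 0# < weight e

module _ {c ℓ₁ ℓ₂} {𝕂 : OrderedField c ℓ₁ ℓ₂} {k n : ℕ} where
  open OrderedField 𝕂 using (Carrier; _≈_; 0#; 1#; _*_; _⁻¹; _<_; _≤_; sum; det)
  open Plane 𝕂
  open Evaluation 𝕂

  record GaugeRayDirection (G : PlabicGraph 𝕂 k n) : Set (c ⊔ ℓ₁ ⊔ ℓ₂) where
    open PlabicGraph G
    field
      direction     : Point
      points-inside : cross axis direction < 0#
      not-parallel  : ∀ e {u v} → src e ≡ inner u → tgt e ≡ inner v →
        ¬ cross (vector e) direction ≈ 0#
      avoids-inner  : ∀ j v t → 0# ≤ t →
        ¬ position (inner v) ≋ position (boundary j) ⊕ t · direction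

    windPair : Edge → Edge → ℤ
    windPair e f =
      if does (s (vector e) (vector f) ℤ.≟ s (vector e) direction
               ×-dec s (vector e) direction ℤ.≟ s direction (vector f))
      then s (vector e) (vector f) else 0ℤ

    wind : List Edge → ℤ
    wind (e ∷ f ∷ P) = windPair e f ℤ.+ wind (f ∷ P)
    wind _           = 0ℤ

    -- An edge is never parallel to the direction (at a boundary vertex this
    -- follows from points-inside and avoids-inner), so it meets each ray in
    -- at most one point.
    intEdge : Edge → ℕ
    intEdge e = length (filter
      (λ r → meetsRay? (position (boundary (base r))) direction
                       (position (src e)) (position (tgt e)))
      (allFin k))

    int : List Edge → ℕ
    int = ℕ.sum ∘ map intEdge

    pathSign : List Edge → ℤ
    pathSign P = negOnePow (wind P ℤ.+ + int P)

    pathSeries : Edge → Fin n → Series edges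
    pathSeries e j = wordSeries (path? e j) pathSign

    edgeFlowPolynomial : Edge → Fin n → Polynomial edges
    edgeFlowPolynomial e j =
      map (λ F → pathSign (walkOf e j F) , indicator F)
          (filter (edgeFlow? e j) (subsets edges))

  module EdgeVectors
    (N : PlabicNetwork 𝕂 k n) (𝔩 : GaugeRayDirection (PlabicNetwork.graph N))
    {m ℓm} (V : Module (OrderedField.commutativeRing 𝕂) m ℓm) where
    open PlabicNetwork N
    open GaugeRayDirection 𝔩
    open Module V

    -- Only the values of B at boundary sinks are used.
    sinkCombination : (Fin n → Carrier) → (Fin n → Carrierᴹ) → Carrierᴹ
    sinkCombination a B = foldr (λ j x → a j *ₗ B j +ᴹ x) 0ᴹ sinks

    IsEdgeVector : (Fin n → Carrierᴹ) → Edge → Carrierᴹ → Set (c ⊔ ℓ₁ ⊔ ℓm)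
    IsEdgeVector B e E = ∃ λ a →
      (∀ j → IsSink j → HasValue (pathSeries e j) weight (a j))
      × E ≈ᴹ sinkCombination a B

    flowQuotient : Edge → Fin n → Carrier
    flowQuotient e j = evaluate weight (edgeFlowPolynomial e j)
      * evaluate weight conservativeFlowPolynomial ⁻¹

  module BoundaryMeasurement (N : PlabicNetwork 𝕂 k n) where
    open PlabicNetwork N
    open Grassmannian 𝕂

    -- The number of elements of the base strictly between base r and j.
    σ : Fin k → Fin n → ℕ
    σ r j = length (filter
      (λ q → (base r Fin.<? base q ×-dec base q Fin.<? j)
        ⊎-dec (j Fin.<? base q ×-dec base q Fin.<? base r))
      (allFin k))

    measurementSeries : Fin k → Fin n → Series edges
    measurementSeries r j =
      wordSeries (walk? (base r) j) (λ P → -1ℤ ℤ.^ (σ r j ℕ.+ loops P))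

    IsMeasurementMatrix : Matrix k n → Set ℓ₁
    IsMeasurementMatrix A =
        (∀ r q → A r (base q) ≈ (if does (r Fin.≟ q) then 1# else 0#))
      × (∀ r j → IsSink j → HasValue (measurementSeries r j) weight (A r j))

    Represents : Matrix k n → Set (c ⊔ ℓ₁ ⊔ ℓ₂)
    Represents A = ∃ λ A₀ → IsMeasurementMatrix A₀ × SameClass A A₀

{-# OPTIONS --safe #-}
module Submission where

-- Let C(x) be the generating polynomial of the conservative flows, P_e(x) the
-- signed series of the paths from e to b_j and Φ_e(x) the signed polynomial of
-- the edge flows.  Splitting off the first edge gives
--   P_e = ± x_e ([e ends at b_j] + Σ_f ± P_f),
-- the sum being over the edges f that continue e.  The products C P_e satisfy
-- this recursion with C in place of 1, and a solution is determined by
-- induction on the degree, so it suffices that the Φ_e satisfy it too.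
-- Deleting e from an edge flow at e leaves an edge flow at the next edge f, or
-- a conservative flow when e ends at b_j; this accounts for all terms except
-- those in which a flow F at f already contains e.  Then e enters a white
-- vertex at which F leaves along both of its other edges f and g, and one of
-- the walks of F from f and from g is the other one preceded by a simple cycle
-- through e.  The two terms cancel because a simple cycle has sign -1: it meets
-- every ray starting outside of it an even number of times, and its winding
-- number relative to the gauge direction is odd, which is the parity version
-- of Hopf's Umlaufsatz.

open import Defs
open import Algebra.Module using (Module)
import Algebra.Properties.CommutativeMonoid.Sum as Sums
import Algebra.Properties.Ring as RingProperties
import Algebra.Properties.Semiring.Exp as Exponentiation
open import Data.Bool as Bool using (Bool; true; false; if_then_else_; _xor_)
open import Data.Bool.Properties using (xor-identityʳ; not-involutive; xor-assoc; xor-comm; xor-same)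
open import Data.Empty using (⊥; ⊥-elim)
open import Data.Fin as Fin using (Fin)
open import Data.Fin.Properties as Fin using (any?)
open import Data.Fin.Subset as Subset using (Subset)
open import Data.Fin.Subset.Properties as Subset using (_∈?_; anySubset?)
open import Data.Integer as ℤ using (ℤ; 0ℤ; 1ℤ; -1ℤ; +_; -[1+_])
import Data.Integer.Properties as ℤ
open import Data.Integer.Solver using (module +-*-Solver)
open import Data.List as List using (List; []; _∷_; _∷ʳ_; _++_; map; filter; concatMap; length; upTo; allFin; last; head)
import Data.List.Properties as List
open import Data.List.Membership.DecPropositional using () renaming (_∈?_ to memberOf)
open import Data.List.Membership.Propositional using (_∈_; lose)
open import Data.List.Membership.Propositional.Properties using (∈-upTo⁺; ∈-allFin; ∈-concatMap⁺; ∈-map⁺; ∈-map⁻; ∈-++⁺ˡ; ∈-++⁺ʳ; ∈-filter⁺)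
open import Data.List.Relation.Unary.All as All using (All; []; _∷_)
import Data.List.Relation.Unary.All.Properties as All
open import Data.List.Relation.Unary.AllPairs using ([]; _∷_)
open import Data.List.Relation.Unary.Any using (here; there)
open import Data.List.Relation.Unary.Linked using (Linked; []; [-]; _∷_)
open import Data.List.Relation.Unary.Unique.Propositional using (Unique)
import Data.List.Relation.Unary.Unique.Propositional.Properties as Unique
open import Data.Maybe using (just; fromMaybe)
import Data.Maybe.Properties as Maybe
open import Data.Nat as ℕ using (ℕ; zero; suc; s≤s)
import Data.Nat.Properties as ℕ
import Data.Nat.Solver as NatSolver
open import Data.Product using (∃; _×_; _,_; proj₁; proj₂)
open import Data.Sum as Sum using (_⊎_; inj₁; inj₂)
import Data.Sum.Properties as Sum
open import Data.Unit.Polymorphic using (⊤; tt)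
open import Data.Vec as Vec using (Vec; []; _∷_; here; there; zipWith; replicate; tabulate)
import Data.Vec.Properties as Vec
open import Function using (_∘_; _⇔_; mk⇔)
open import Level using (_⊔_)
open import Relation.Binary using (DecidableEquality; tri<; tri≈; tri>)
open import Relation.Binary.PropositionalEquality as ≡ using (_≡_; _≢_; _≗_)
import Relation.Binary.Reasoning.Setoid as SetoidReasoning
open import Relation.Nullary using (¬_; Dec; yes; no; does; contradiction)
open import Relation.Nullary.Decidable using (False; toWitnessFalse; decidable-stable; ¬?; map′; dec-true; dec-false; does-⇔; _×-dec_; _⊎-dec_)
open import Relation.Unary using (Decidable)

-- The argument works because every internal vertex has indegree or outdegree one. A balanced set of
-- edges therefore passes each internal vertex at most once: a flow leaves no choice of
-- continuation, and a closed walk with distinct edges inside it also has distinct vertices, as a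
-- simple polygon must. The flow polynomials are squarefree, while a product of C with a path series
-- has no evident reason to be; the squares can only disappear by cancellation, and this is the one
-- place where geometry enters. The parity of a cycle is found without the Jordan curve theorem and
-- without angles. A cycle stays in the open half-plane in which a ray from the boundary cannot be
-- told from its whole line, so intersections are governed by the sides of that line. Winding is
-- compared modulo 2 with finitely many secants. Finally, a value of a series may come from any
-- representation as a quotient of polynomials. The identity for C provides one such value; that no
-- other representation yields a different one is a separate argument by cross-multiplication.

module OrderedFieldProperties {c ℓ₁ ℓ₂} (𝕂 : OrderedField c ℓ₁ ℓ₂) where
  open OrderedField 𝕂
  open RingProperties ring public using (-0#≈0#; -‿involutive)
  open IntegerMultiples.Solver commutativeRing
  open SetoidReasoning setoid

  pos-resp : ∀ {x y} → x ≈ y → 0# < x → 0# < y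
  pos-resp = <-respʳ-≈

  +-pos : ∀ {x y} → 0# < x → 0# < y → 0# < x + y
  +-pos {x} {y} 0<x 0<y =
    <-trans 0<y (<-respˡ-≈ (+-identityˡ y) (+-monoˡ-< y 0<x))

  neg⇒pos- : ∀ {x} → x < 0# → 0# < - x
  neg⇒pos- {x} x<0 = <-respˡ-≈ (-‿inverseʳ x) (<-respʳ-≈ (+-identityˡ (- x)) (+-monoˡ-< (- x) x<0))

  pos-⇒neg : ∀ {x} → 0# < - x → x < 0#
  pos-⇒neg {x} 0<-x = <-respˡ-≈ (+-identityˡ x) (<-respʳ-≈ (-‿inverseˡ x) (+-monoˡ-< x 0<-x))

  pos⇒≉0 : ∀ {x} → 0# < x → ¬ x ≈ 0#
  pos⇒≉0 0<x x≈0 = irrefl (sym x≈0) 0<x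

  ¬pos-pos : ∀ {x} → 0# < x → ¬ 0# < - x
  ¬pos-pos 0<x 0<-x = asym 0<x (pos-⇒neg 0<-x)

  pos⊎neg : ∀ {x} → ¬ x ≈ 0# → 0# < x ⊎ 0# < - x
  pos⊎neg {x} x≉0 with compare x 0#
  ... | tri< x<0 _ _ = inj₂ (neg⇒pos- x<0)
  ... | tri≈ _ x≈0 _ = ⊥-elim (x≉0 x≈0)
  ... | tri> _ _ 0<x = inj₁ 0<x

  nonneg-resp : ∀ {x y} → x ≈ y → 0# ≤ x → 0# ≤ y
  nonneg-resp x≈y (inj₁ 0<x) = inj₁ (pos-resp x≈y 0<x)
  nonneg-resp x≈y (inj₂ 0≈x) = inj₂ (trans 0≈x x≈y)

  +-pos-nonneg : ∀ {x y} → 0# < x → 0# ≤ y → 0# < x + y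
  +-pos-nonneg 0<x (inj₁ 0<y) = +-pos 0<x 0<y
  +-pos-nonneg {x} {y} 0<x (inj₂ 0≈y) = pos-resp (trans (sym (+-identityʳ x)) (+-congˡ 0≈y)) 0<x

  +-nonneg-pos : ∀ {x y} → 0# ≤ x → 0# < y → 0# < x + y
  +-nonneg-pos 0≤x 0<y = pos-resp (+-comm _ _) (+-pos-nonneg 0<y 0≤x)

  +-nonneg : ∀ {x y} → 0# ≤ x → 0# ≤ y → 0# ≤ x + y
  +-nonneg (inj₁ 0<x) 0≤y = inj₁ (+-pos-nonneg 0<x 0≤y)
  +-nonneg {x} {y} (inj₂ 0≈x) 0≤y = nonneg-resp (trans (sym (+-identityˡ y)) (+-congʳ 0≈x)) 0≤y

  *-nonneg : ∀ {x y} → 0# ≤ x → 0# ≤ y → 0# ≤ x * y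
  *-nonneg (inj₁ 0<x) (inj₁ 0<y) = inj₁ (*-positive 0<x 0<y)
  *-nonneg {x} (inj₁ 0<x) (inj₂ 0≈y) = inj₂ (trans (sym (zeroʳ x)) (*-congˡ 0≈y))
  *-nonneg {x} {y} (inj₂ 0≈x) _ = inj₂ (trans (sym (zeroˡ y)) (*-congʳ 0≈x))

  *-positive-neg : ∀ {x y} → 0# < x → 0# < - y → 0# < - (x * y)
  *-positive-neg {x} {y} 0<x 0<-y =
    pos-resp (solve 2 (λ x y → x :* (:- y) := :- (x :* y)) refl x y) (*-positive 0<x 0<-y)

  x≤1⇒0≤1-x : ∀ {x} → x ≤ 1# → 0# ≤ 1# - x
  x≤1⇒0≤1-x {x} (inj₁ x<1) = inj₁ (<-respˡ-≈ (-‿inverseʳ x) (+-monoˡ-< (- x) x<1))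
  x≤1⇒0≤1-x {x} (inj₂ x≈1) = inj₂ (sym (trans (+-congʳ (sym x≈1)) (-‿inverseʳ x)))

  0≤y⇒x≤x+y : ∀ {x y z} → 0# ≤ y → x + y ≈ z → x ≤ z
  0≤y⇒x≤x+y {x} {y} (inj₁ 0<y) eq = inj₁ (<-respˡ-≈ (+-identityˡ x)
    (<-respʳ-≈ (trans (+-comm y x) eq) (+-monoˡ-< x 0<y)))
  0≤y⇒x≤x+y {x} {y} (inj₂ 0≈y) eq = inj₂ (trans (sym (+-identityʳ x)) (trans (+-congˡ 0≈y) eq))

  inv : ∀ {x} → ¬ x ≈ 0# → ∃ λ i → x * i ≈ 1#
  inv x≉0 = proj₁ (invertible _ x≉0) , proj₂ (proj₂ (invertible _ x≉0))

  cancel-nonzero : ∀ {x y} → ¬ x ≈ 0# → x * y ≈ 0# → y ≈ 0#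
  cancel-nonzero {x} {y} x≉0 xy≈0 with inv x≉0
  ... | i , xi≈1 = begin
    y ≈⟨ *-identityˡ y ⟨
    1# * y ≈⟨ *-congʳ xi≈1 ⟨
    x * i * y ≈⟨ solve 3 (λ x i y → x :* i :* y := i :* (x :* y)) refl x i y ⟩
    i * (x * y) ≈⟨ *-congˡ xy≈0 ⟩
    i * 0# ≈⟨ zeroʳ i ⟩
    0# ∎

  inverse-pos : ∀ {x i} → 0# < x → x * i ≈ 1# → 0# < i
  inverse-pos {x} {i} 0<x xi≈1 with compare i 0#
  ... | tri> _ _ 0<i = 0<i
  ... | tri≈ _ i≈0 _ = ⊥-elim (irrefl (trans (sym (zeroʳ x)) (trans (*-congˡ (sym i≈0)) xi≈1)) 0<1)
  ... | tri< i<0 _ _ = ⊥-elim (¬pos-pos 0<1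
    (pos-resp (-‿cong xi≈1) (*-positive-neg 0<x (neg⇒pos- i<0))))

  half : ∃ λ i → 0# < i × i + i ≈ 1#
  half with inv (pos⇒≉0 (+-pos 0<1 0<1))
  ... | i , 2i≈1 = i , inverse-pos (+-pos 0<1 0<1) 2i≈1 ,
    trans (sym (trans (distribʳ i 1# 1#) (+-cong (*-identityˡ i) (*-identityˡ i)))) 2i≈1

-- Turns between plane vectors relative to a fixed direction

module Turning {c ℓ₁ ℓ₂} (𝕂 : OrderedField c ℓ₁ ℓ₂) where
  open OrderedField 𝕂
  open Plane 𝕂
  open OrderedFieldProperties 𝕂
  open IntegerMultiples.Solver commutativeRing
  open SetoidReasoning setoid

  𝟘 : Point
  𝟘 = 0# , 0#

  ⊝_ : Point → Point
  ⊝ (x , y) = - x , - y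

  ≋-refl : ∀ {p} → p ≋ p
  ≋-refl = refl , refl

  ≋-sym : ∀ {p q} → p ≋ q → q ≋ p
  ≋-sym (x , y) = sym x , sym y

  cross-cong : ∀ {p p′ q q′} → p ≋ p′ → q ≋ q′ → cross p q ≈ cross p′ q′
  cross-cong (p₁ , p₂) (q₁ , q₂) = +-cong (*-cong p₁ q₂) (-‿cong (*-cong p₂ q₁))

  cross-anti : ∀ p q → cross q p ≈ - cross p q
  cross-anti (a , b) (c , d) = solve 4 (λ a b c d → c :* b :- d :* a := :- (a :* d :- b :* c)) refl a b c d

  cross-neg : ∀ p q → cross (⊝ p) q ≈ - cross p q
  cross-neg (a , b) (c , d) = solve 4 (λ a b c d →
    (:- a) :* d :- (:- b) :* c := :- (a :* d :- b :* c)) refl a b c d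

  cross-neg₂ : ∀ p q → cross (⊝ p) (⊝ q) ≈ cross p q
  cross-neg₂ (a , b) (c , d) = solve 4 (λ a b c d →
    (:- a) :* (:- d) :- (:- b) :* (:- c) := a :* d :- b :* c) refl a b c d

  cramer : ∀ p q r → cross q r · p ⊕ cross r p · q ⊕ cross p q · r ≋ 𝟘
  cramer (p₁ , p₂) (q₁ , q₂) (r₁ , r₂) =
    solve 6 (λ p₁ p₂ q₁ q₂ r₁ r₂ → (q₁ :* r₂ :- q₂ :* r₁) :* p₁ :+ (r₁ :* p₂ :- r₂ :* p₁) :* q₁
      :+ (p₁ :* q₂ :- p₂ :* q₁) :* r₁ := con 0ℤ) refl p₁ p₂ q₁ q₂ r₁ r₂ ,
    solve 6 (λ p₁ p₂ q₁ q₂ r₁ r₂ → (q₁ :* r₂ :- q₂ :* r₁) :* p₂ :+ (r₁ :* p₂ :- r₂ :* p₁) :* q₂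
      :+ (p₁ :* q₂ :- p₂ :* q₁) :* r₂ := con 0ℤ) refl p₁ p₂ q₁ q₂ r₁ r₂

  plücker : ∀ p q r s → cross p r * cross q s - cross q r * cross p s ≈ cross p q * cross r s
  plücker (p₁ , p₂) (q₁ , q₂) (r₁ , r₂) (s₁ , s₂) =
    solve 8 (λ p₁ p₂ q₁ q₂ r₁ r₂ s₁ s₂ →
      (p₁ :* r₂ :- p₂ :* r₁) :* (q₁ :* s₂ :- q₂ :* s₁) :- (q₁ :* r₂ :- q₂ :* r₁) :* (p₁ :* s₂ :- p₂ :* s₁)
      := (p₁ :* q₂ :- p₂ :* q₁) :* (r₁ :* s₂ :- r₂ :* s₁)) refl p₁ p₂ q₁ q₂ r₁ r₂ s₁ s₂

  -- The origin lies outside the closed triangle with corners p, q, r. The weights only need a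
  -- positive sum, so that the coefficients of `cramer` can be used as they are.
  record OriginFree (p q r : Point) : Set (c ⊔ ℓ₁ ⊔ ℓ₂) where
    field
      hull-avoids : ∀ α β γ → 0# ≤ α → 0# ≤ β → 0# ≤ γ → 0# < α + β + γ →
        ¬ α · p ⊕ β · q ⊕ γ · r ≋ 𝟘

  open OriginFree

  -- Divide by the positive sum of the weights. Geometric hypotheses speak of points on segments,
  -- whose weights add up to 1, and enter through this form.
  originFree-normalised : ∀ {p q r} →
    (∀ α β γ → 0# ≤ α → 0# ≤ β → 0# ≤ γ → α + β + γ ≈ 1# → ¬ α · p ⊕ β · q ⊕ γ · r ≋ 𝟘) →
    OriginFree p q r
  originFree-normalised {p₁ , p₂} {q₁ , q₂} {r₁ , r₂} free .hull-avoids α β γ 0≤α 0≤β 0≤γ 0<s (eq₁ , eq₂) =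
    free (i * α) (i * β) (i * γ) (*-nonneg 0≤i 0≤α) (*-nonneg 0≤i 0≤β) (*-nonneg 0≤i 0≤γ)
      (trans (solve 4 (λ i α β γ → i :* α :+ i :* β :+ i :* γ := (α :+ β :+ γ) :* i) refl i α β γ) si≈1)
      (scale p₁ q₁ r₁ eq₁ , scale p₂ q₂ r₂ eq₂)
    where
    i = proj₁ (inv (pos⇒≉0 0<s))
    si≈1 = proj₂ (inv (pos⇒≉0 0<s))
    0≤i : 0# ≤ i
    0≤i = inj₁ (inverse-pos 0<s si≈1)
    scale : ∀ x y z → α * x + β * y + γ * z ≈ 0# → i * α * x + i * β * y + i * γ * z ≈ 0#
    scale x y z eq = begin
      i * α * x + i * β * y + i * γ * z ≈⟨ solve 7 (λ i α β γ x y z → i :* α :* x :+ i :* β :* y :+ i :* γ :* z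
        := i :* (α :* x :+ β :* y :+ γ :* z)) refl i α β γ x y z ⟩
      i * (α * x + β * y + γ * z) ≈⟨ *-congˡ eq ⟩
      i * 0# ≈⟨ zeroʳ i ⟩
      0# ∎

  originFree-swap : ∀ {p q r} → OriginFree p q r → OriginFree q p r
  originFree-swap free .hull-avoids α β γ 0≤α 0≤β 0≤γ 0<s (eq₁ , eq₂) =
    free .hull-avoids β α γ 0≤β 0≤α 0≤γ (pos-resp (+-congʳ (+-comm α β)) 0<s)
      (trans (+-congʳ (+-comm _ _)) eq₁ , trans (+-congʳ (+-comm _ _)) eq₂)

  originFree-rotate : ∀ {p q r} → OriginFree p q r → OriginFree r p q
  originFree-rotate free .hull-avoids γ α β 0≤γ 0≤α 0≤β 0<s (eq₁ , eq₂) =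
    free .hull-avoids α β γ 0≤α 0≤β 0≤γ (pos-resp (rot γ α β) 0<s)
      (trans (sym (rot _ _ _)) eq₁ , trans (sym (rot _ _ _)) eq₂)
    where
    rot : ∀ x y z → x + y + z ≈ y + z + x
    rot = solve 3 (λ x y z → x :+ y :+ z := y :+ z :+ x) refl

  originFree-pair : ∀ {p q r} → OriginFree p q r → OriginFree p q q
  originFree-pair {p₁ , p₂} {q₁ , q₂} {r₁ , r₂} free .hull-avoids α β γ 0≤α 0≤β 0≤γ 0<s (eq₁ , eq₂) =
    free .hull-avoids α (β + γ) 0# 0≤α (+-nonneg 0≤β 0≤γ) (inj₂ refl)
      (pos-resp (solve 3 (λ α β γ → α :+ β :+ γ := α :+ (β :+ γ) :+ con 0ℤ) refl α β γ) 0<s)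
      (merge p₁ q₁ r₁ eq₁ , merge p₂ q₂ r₂ eq₂)
    where
    merge : ∀ x y z → α * x + β * y + γ * y ≈ 0# → α * x + (β + γ) * y + 0# * z ≈ 0#
    merge x y z eq = trans (solve 6 (λ α β γ x y z → α :* x :+ (β :+ γ) :* y :+ con 0ℤ :* z
      := α :* x :+ β :* y :+ γ :* y) refl α β γ x y z) eq

  originFree-neg : ∀ {p q r} → OriginFree p q r → OriginFree (⊝ p) (⊝ q) (⊝ r)
  originFree-neg {p₁ , p₂} {q₁ , q₂} {r₁ , r₂} free .hull-avoids α β γ 0≤α 0≤β 0≤γ 0<s (eq₁ , eq₂) =
    free .hull-avoids α β γ 0≤α 0≤β 0≤γ 0<s (flip p₁ q₁ r₁ eq₁ , flip p₂ q₂ r₂ eq₂)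
    where
    flip : ∀ x y z → α * (- x) + β * (- y) + γ * (- z) ≈ 0# → α * x + β * y + γ * z ≈ 0#
    flip x y z eq = begin
      α * x + β * y + γ * z ≈⟨ solve 6 (λ α β γ x y z → α :* x :+ β :* y :+ γ :* z
        := :- (α :* (:- x) :+ β :* (:- y) :+ γ :* (:- z))) refl α β γ x y z ⟩
      - (α * (- x) + β * (- y) + γ * (- z)) ≈⟨ -‿cong eq ⟩
      - 0# ≈⟨ -0#≈0# ⟩
      0# ∎

  originFree-resp : ∀ {p q r p′ q′ r′} → p ≋ p′ → q ≋ q′ → r ≋ r′ → OriginFree p q r → OriginFree p′ q′ r′
  originFree-resp (p₁ , p₂) (q₁ , q₂) (r₁ , r₂) free .hull-avoids α β γ 0≤α 0≤β 0≤γ 0<s (eq₁ , eq₂) =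
    free .hull-avoids α β γ 0≤α 0≤β 0≤γ 0<s
      ( trans (+-cong (+-cong (*-congˡ p₁) (*-congˡ q₁)) (*-congˡ r₁)) eq₁
      , trans (+-cong (+-cong (*-congˡ p₂) (*-congˡ q₂)) (*-congˡ r₂)) eq₂)

  -- χ p q tells whether the turn from p to q along the shorter arc crosses the
  -- direction l.  The half-plane to the right of l is completed lexicographically
  -- by a second vector a, so that p or ⊝ p lies in it whenever p is nonzero.
  module Crossing (l a : Point) (0<l×a : 0# < cross l a) where
    h g : Point → Carrier
    h p = cross p l
    g p = cross p a

    RightOf LeftOf : Point → Set (ℓ₁ ⊔ ℓ₂)
    RightOf p = 0# < h p ⊎ (h p ≈ 0# × 0# < g p)
    LeftOf p  = 0# < - h p ⊎ (h p ≈ 0# × 0# < - g p)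

    rightOf? : ∀ p → Dec (RightOf p)
    rightOf? p = 0# <? h p ⊎-dec (h p ≟ 0# ×-dec 0# <? g p)

    side : Point → Bool
    side p = does (rightOf? p)

    left⇒¬right : ∀ {p} → LeftOf p → ¬ RightOf p
    left⇒¬right (inj₁ x) (inj₁ y) = ¬pos-pos y x
    left⇒¬right (inj₁ x) (inj₂ (y , _)) = irrefl (trans (sym -0#≈0#) (-‿cong (sym y))) x
    left⇒¬right (inj₂ (x , _)) (inj₁ y) = pos⇒≉0 y x
    left⇒¬right (inj₂ (_ , x)) (inj₂ (_ , y)) = ¬pos-pos y x

    right-side : ∀ {p} → RightOf p → side p ≡ true
    right-side r = dec-true (rightOf? _) r

    left-side : ∀ {p} → LeftOf p → side p ≡ false
    left-side r = dec-false (rightOf? _) (left⇒¬right r)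

    left⇒right-neg : ∀ {p} → LeftOf p → RightOf (⊝ p)
    left⇒right-neg {p} (inj₁ x) = inj₁ (pos-resp (sym (cross-neg p l)) x)
    left⇒right-neg {p} (inj₂ (x , y)) =
      inj₂ (trans (cross-neg p l) (trans (-‿cong x) -0#≈0#) , pos-resp (sym (cross-neg p a)) y)

    right⇒left-neg : ∀ {p} → RightOf p → LeftOf (⊝ p)
    right⇒left-neg {p} (inj₁ x) =
      inj₁ (pos-resp (trans (solve 1 (λ x → x := :- (:- x)) refl (h p)) (-‿cong (sym (cross-neg p l)))) x)
    right⇒left-neg {p} (inj₂ (x , y)) =
      inj₂ (trans (cross-neg p l) (trans (-‿cong x) -0#≈0#) ,
        pos-resp (trans (solve 1 (λ x → x := :- (:- x)) refl (g p)) (-‿cong (sym (cross-neg p a)))) y)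

    ≋0-from : ∀ {p} → h p ≈ 0# → g p ≈ 0# → p ≋ 𝟘
    ≋0-from {p@(p₁ , p₂)} hp gp = comp p₁ (proj₁ l) (proj₁ a) (proj₁ (cramer p l a)) , comp p₂ (proj₂ l) (proj₂ a) (proj₂ (cramer p l a))
      where
      comp : ∀ x y z → cross l a * x + cross a p * y + cross p l * z ≈ 0# → x ≈ 0#
      comp x y z eq = cancel-nonzero (pos⇒≉0 0<l×a) (begin
        cross l a * x ≈⟨ solve 3 (λ u y z →
          u := u :+ (:- con 0ℤ) :* y :+ con 0ℤ :* z) refl (cross l a * x) y z ⟩
        cross l a * x + (- 0#) * y + 0# * z
          ≈⟨ +-cong (+-congˡ (*-congʳ (trans (cross-anti p a) (-‿cong gp)))) (*-congʳ hp) ⟨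
        cross l a * x + cross a p * y + cross p l * z ≈⟨ eq ⟩
        0#                                             ∎)

    left⊎right : ∀ {p} → ¬ p ≋ 𝟘 → LeftOf p ⊎ RightOf p
    left⊎right {p} p≉0 with compare (h p) 0#
    ... | tri< x _ _ = inj₁ (inj₁ (neg⇒pos- x))
    ... | tri> _ _ x = inj₂ (inj₁ x)
    ... | tri≈ _ x _ with compare (g p) 0#
    ...   | tri< y _ _ = inj₁ (inj₂ (x , neg⇒pos- y))
    ...   | tri> _ _ y = inj₂ (inj₂ (x , y))
    ...   | tri≈ _ y _ = ⊥-elim (p≉0 (≋0-from x y))

    chi : Bool → Bool → Carrier → Carrier → Bool
    chi true  false x y = does (0# <? x)
    chi false true  x y = does (0# <? y)
    chi _     _     x y = false

    χ : Point → Point → Bool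
    χ p q = chi (side p) (side q) (cross p q) (cross q p)

    h-sign : ∀ {p} → LeftOf p → 0# ≤ - h p
    h-sign (inj₁ x) = inj₁ x
    h-sign (inj₂ (x , _)) = inj₂ (trans (sym -0#≈0#) (-‿cong (sym x)))

    private
      collinear : ∀ {p q} r s → cross p q ≈ 0# → (- cross q s) · p ⊕ cross p s · q ⊕ 0# · r ≋ 𝟘
      collinear {p} {q} r s pq≈0 =
        combine (proj₁ p) (proj₁ q) (proj₁ r) (proj₁ s) (proj₁ (cramer p q s)) ,
        combine (proj₂ p) (proj₂ q) (proj₂ r) (proj₂ s) (proj₂ (cramer p q s))
        where
        combine : ∀ x y z w → cross q s * x + cross s p * y + cross p q * w ≈ 0# →
          - cross q s * x + cross p s * y + 0# * z ≈ 0#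
        combine x y z w eq = begin
          - cross q s * x + cross p s * y + 0# * z ≈⟨ solve 6 (λ qs ps x y z w →
            :- qs :* x :+ ps :* y :+ con 0ℤ :* z := :- (qs :* x :+ :- ps :* y :+ con 0ℤ :* w))
            refl (cross q s) (cross p s) x y z w ⟩
          - (cross q s * x + - cross p s * y + 0# * w)
            ≈⟨ -‿cong (+-cong (+-congˡ (*-congʳ (cross-anti p s))) (*-congʳ pq≈0)) ⟨
          - (cross q s * x + cross s p * y + cross p q * w) ≈⟨ -‿cong eq ⟩
          - 0# ≈⟨ -0#≈0# ⟩
          0# ∎

    -- Parallel vectors on opposite sides point in opposite directions, so the segment between them
    -- would contain the origin. The weights that show it are the values of h, or those of g when
    -- both vectors lie on the line of l. If p lies on that line and q strictly to its left, they
    -- cannot be parallel at all.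
    opposite-cross≉0 : ∀ {p q r} → OriginFree p q r → RightOf p → LeftOf q → ¬ cross p q ≈ 0#
    opposite-cross≉0 {p} {q} {r} free (inj₁ 0<hp) left pq≈0 =
      free .hull-avoids (- h q) (h p) 0# (h-sign left) (inj₁ 0<hp) (inj₂ refl)
        (+-pos-nonneg (+-nonneg-pos (h-sign left) 0<hp) (inj₂ refl)) (collinear r l pq≈0)
    opposite-cross≉0 {p} {q} {r} free (inj₂ (_ , 0<gp)) (inj₂ (_ , 0<-gq)) pq≈0 =
      free .hull-avoids (- g q) (g p) 0# (inj₁ 0<-gq) (inj₁ 0<gp) (inj₂ refl)
        (+-pos-nonneg (+-pos 0<-gq 0<gp) (inj₂ refl)) (collinear r a pq≈0)
    opposite-cross≉0 {p} {q} free (inj₂ (hp≈0 , 0<gp)) (inj₁ 0<-hq) pq≈0 =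
      pos⇒≉0 0<-hq (trans (-‿cong hq≈0) -0#≈0#)
      where
      hq≈0 : h q ≈ 0#
      hq≈0 = cancel-nonzero (pos⇒≉0 0<gp) (begin
        g p * h q ≈⟨ solve 3 (λ hq gp gq → gp :* hq := :- (con 0ℤ :* gq :- hq :* gp))
              refl (h q) (g p) (g q) ⟩
        - (0# * g q - h q * g p) ≈⟨ -‿cong (+-congʳ (*-congʳ hp≈0)) ⟨
        - (h p * g q - h q * g p) ≈⟨ -‿cong (plücker p q l a) ⟩
        - (cross p q * cross l a) ≈⟨ -‿cong (*-congʳ pq≈0) ⟩
        - (0# * cross l a) ≈⟨ trans (-‿cong (zeroˡ _)) -0#≈0# ⟩
        0#                             ∎)

    cramer-cross : ∀ p q r s → cross q r * cross p s + cross r p * cross q s + cross p q * cross r s ≈ 0#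
    cramer-cross (p₁ , p₂) (q₁ , q₂) (r₁ , r₂) (s₁ , s₂) =
      solve 8 (λ p₁ p₂ q₁ q₂ r₁ r₂ s₁ s₂ →
        (q₁ :* r₂ :- q₂ :* r₁) :* (p₁ :* s₂ :- p₂ :* s₁) :+ (r₁ :* p₂ :- r₂ :* p₁) :* (q₁ :* s₂ :- q₂ :* s₁)
          :+ (p₁ :* q₂ :- p₂ :* q₁) :* (r₁ :* s₂ :- r₂ :* s₁) := con 0ℤ) refl p₁ p₂ q₁ q₂ r₁ r₂ s₁ s₂

    -- Otherwise a multiple of p on the right would be a positive combination of q and r on the left.
    no-fan : ∀ {p q r} → OriginFree p q r → RightOf p → LeftOf q → LeftOf r →
      0# < cross p q → 0# < - cross p r → ⊥
    no-fan {p} {q} {r} free right left₁ left₂ 0<pq 0<-pr = go (compare (cross q r) 0#)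
      where
      0<rp : 0# < cross r p
      0<rp = pos-resp (sym (cross-anti p r)) 0<-pr
      -- With a nonnegative `cross q r` the coefficients in `cramer` are weights that put the origin
      -- into the triangle.
      hull : 0# ≤ cross q r → ⊥
      hull 0≤qr = free .hull-avoids (cross q r) (cross r p) (cross p q) 0≤qr (inj₁ 0<rp) (inj₁ 0<pq)
        (+-pos (+-nonneg-pos 0≤qr 0<rp) 0<pq) (cramer p q r)
      balance : ∀ s → - cross q r * cross p s + (cross r p * - cross q s + cross p q * - cross r s) ≈ 0#
      balance s = begin
        - cross q r * cross p s + (cross r p * - cross q s + cross p q * - cross r s) ≈⟨ solve 6 (λ A B C x y z →
          :- A :* x :+ (B :* :- y :+ C :* :- z) := :- (A :* x :+ B :* y :+ C :* z)) refl
            (cross q r) (cross r p) (cross p q) (cross p s) (cross q s) (cross r s) ⟩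
        - (cross q r * cross p s + cross r p * cross q s + cross p q * cross r s)
          ≈⟨ -‿cong (cramer-cross p q r s) ⟩
        - 0# ≈⟨ -0#≈0# ⟩
        0# ∎
      -- Otherwise the same relation, paired with l, or with a when all three vectors lie on the
      -- line of l, is a vanishing sum of nonnegative terms of which one is positive.
      cone : 0# < - cross q r → RightOf p → LeftOf q → LeftOf r → ⊥
      cone 0<-qr (inj₁ x) y z = pos⇒≉0 (+-pos-nonneg (*-positive 0<-qr x)
        (+-nonneg (*-nonneg (inj₁ 0<rp) (h-sign y)) (*-nonneg (inj₁ 0<pq) (h-sign z)))) (balance l)
      cone 0<-qr (inj₂ (x , _)) (inj₁ y) z = pos⇒≉0 (+-nonneg-pos (*-nonneg (inj₁ 0<-qr) (inj₂ (sym x)))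
        (+-pos-nonneg (*-positive 0<rp y) (*-nonneg (inj₁ 0<pq) (h-sign z)))) (balance l)
      cone 0<-qr (inj₂ (x , _)) (inj₂ (y , y′)) (inj₁ z) = pos⇒≉0 (+-nonneg-pos (*-nonneg (inj₁ 0<-qr) (inj₂ (sym x)))
        (+-nonneg-pos (*-nonneg (inj₁ 0<rp) (h-sign (inj₂ (y , y′)))) (*-positive 0<pq z))) (balance l)
      cone 0<-qr (inj₂ (_ , x)) (inj₂ (_ , y)) (inj₂ (_ , z)) =
        pos⇒≉0 (+-pos (*-positive 0<-qr x) (+-pos (*-positive 0<rp y) (*-positive 0<pq z))) (balance a)
      go : _ → ⊥
      go (tri< x _ _) = cone (neg⇒pos- x) right left₁ left₂
      go (tri≈ _ x _) = hull (inj₂ (sym x))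
      go (tri> _ _ x) = hull (inj₁ x)

    SameSign : Carrier → Carrier → Set ℓ₂
    SameSign x y = (0# < x × 0# < y) ⊎ (0# < - x × 0# < - y)

    -- Seen from p, all vectors of the opposite side are reached by turning the same way round;
    -- otherwise the fan would close up around the origin.
    fan-right : ∀ {p q r} → OriginFree p q r → RightOf p → LeftOf q → LeftOf r → SameSign (cross p q) (cross p r)
    fan-right free right left₁ left₂
      with pos⊎neg (opposite-cross≉0 free right left₁)
         | pos⊎neg (opposite-cross≉0 (originFree-swap (originFree-rotate free)) right left₂)
    ... | inj₁ x | inj₁ y = inj₁ (x , y)
    ... | inj₂ x | inj₂ y = inj₂ (x , y)
    ... | inj₁ x | inj₂ y = ⊥-elim (no-fan free right left₁ left₂ x y)
    ... | inj₂ x | inj₁ y = ⊥-elim (no-fan (originFree-swap (originFree-rotate free)) right left₂ left₁ y x)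

    fan-left : ∀ {p q r} → OriginFree p q r → LeftOf p → RightOf q → RightOf r → SameSign (cross p q) (cross p r)
    fan-left {p} {q} {r} free left right₁ right₂
      with fan-right (originFree-neg free) (left⇒right-neg left) (right⇒left-neg right₁) (right⇒left-neg right₂)
    ... | inj₁ (x , y) = inj₁ (pos-resp (cross-neg₂ p q) x , pos-resp (cross-neg₂ p r) y)
    ... | inj₂ (x , y) = inj₂ (pos-resp (-‿cong (cross-neg₂ p q)) x , pos-resp (-‿cong (cross-neg₂ p r)) y)

    χ-right-left : ∀ {p q} → RightOf p → LeftOf q → χ p q ≡ does (0# <? cross p q)
    χ-right-left right left rewrite right-side right | left-side left = ≡.refl

    χ-left-right : ∀ {p q} → LeftOf p → RightOf q → χ p q ≡ does (0# <? cross q p)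
    χ-left-right left right rewrite right-side right | left-side left = ≡.refl

    χ-right-right : ∀ {p q} → RightOf p → RightOf q → χ p q ≡ false
    χ-right-right right₁ right₂ rewrite right-side right₁ | right-side right₂ = ≡.refl

    χ-left-left : ∀ {p q} → LeftOf p → LeftOf q → χ p q ≡ false
    χ-left-left left₁ left₂ rewrite left-side left₁ | left-side left₂ = ≡.refl

    chi-sym : ∀ b b′ x y → chi b b′ x y ≡ chi b′ b y x
    chi-sym true true x y = ≡.refl
    chi-sym true false x y = ≡.refl
    chi-sym false true x y = ≡.refl
    chi-sym false false x y = ≡.refl

    χ-sym : ∀ p q → χ p q ≡ χ q p
    χ-sym p q = chi-sym (side p) (side q) (cross p q) (cross q p)

    positive : ∀ {x} → 0# < x → does (0# <? x) ≡ true
    positive = dec-true (0# <? _)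

    nonpositive : ∀ {x} → 0# < - x → does (0# <? x) ≡ false
    nonpositive 0<-x = dec-false (0# <? _) (λ 0<x → ¬pos-pos 0<x 0<-x)

    anti-pos : ∀ {p q} → 0# < cross p q → 0# < - cross q p
    anti-pos {p} {q} = pos-resp (cross-anti q p)

    anti-neg : ∀ {p q} → 0# < - cross p q → 0# < cross q p
    anti-neg {p} {q} = pos-resp (sym (cross-anti p q))

    fan-χ : ∀ {p q r} → OriginFree p q r → RightOf p × LeftOf q × LeftOf r ⊎ LeftOf p × RightOf q × RightOf r →
      χ p q ≡ χ p r
    fan-χ {p} {q} {r} free (inj₁ (right , left₁ , left₂))
      rewrite χ-right-left {p} {q} right left₁ | χ-right-left {p} {r} right left₂ with fan-right free right left₁ left₂
    ... | inj₁ (x , y) = ≡.trans (positive x) (≡.sym (positive y))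
    ... | inj₂ (x , y) = ≡.trans (nonpositive x) (≡.sym (nonpositive y))
    fan-χ {p} {q} {r} free (inj₂ (left , right₁ , right₂))
      rewrite χ-left-right {p} {q} left right₁ | χ-left-right {p} {r} left right₂ with fan-left free left right₁ right₂
    ... | inj₁ (x , y) = ≡.trans (nonpositive (anti-pos x)) (≡.sym (nonpositive (anti-pos y)))
    ... | inj₂ (x , y) = ≡.trans (positive (anti-neg x)) (≡.sym (positive (anti-neg y)))

    originFree⇒≉0 : ∀ {p q r} → OriginFree p q r → ¬ p ≋ 𝟘
    originFree⇒≉0 {p₁ , p₂} {q₁ , q₂} {r₁ , r₂} free (x , y) = free .hull-avoids 1# 0# 0# (inj₁ 0<1) (inj₂ refl) (inj₂ refl)
      (+-pos-nonneg (+-pos-nonneg 0<1 (inj₂ refl)) (inj₂ refl)) (comp p₁ q₁ r₁ x , comp p₂ q₂ r₂ y)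
      where
      comp : ∀ x y z → x ≈ 0# → 1# * x + 0# * y + 0# * z ≈ 0#
      comp x y z eq = trans (+-cong (+-cong (*-identityˡ x) (zeroˡ y)) (zeroˡ z))
        (trans (+-identityʳ _) (trans (+-identityʳ x) eq))

    -- A triangle that misses the origin does not wind around it, so its boundary crosses the ray of
    -- l an even number of times. Vectors on the same side contribute nothing, and if one vector is
    -- alone on its side, its two crossings agree by `fan-χ`.
    χ-triangle : ∀ {p q r} → OriginFree p q r → (χ p q xor χ q r) xor χ p r ≡ false
    χ-triangle {p} {q} {r} free
      with left⊎right {p} (originFree⇒≉0 free)
         | left⊎right {q} (originFree⇒≉0 (originFree-swap free))
         | left⊎right {r} (originFree⇒≉0 (originFree-rotate free))
    ... | inj₁ x | inj₁ y | inj₁ z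
      rewrite χ-left-left {p} {q} x y | χ-left-left {q} {r} y z | χ-left-left {p} {r} x z = ≡.refl
    ... | inj₂ x | inj₂ y | inj₂ z
      rewrite χ-right-right {p} {q} x y | χ-right-right {q} {r} y z | χ-right-right {p} {r} x z = ≡.refl
    ... | inj₁ x | inj₂ y | inj₂ z
      rewrite χ-right-right {q} {r} y z | fan-χ {p} {q} {r} free (inj₂ (x , y , z)) | xor-identityʳ (χ p r) = xor-same (χ p r)
    ... | inj₂ x | inj₁ y | inj₁ z
      rewrite χ-left-left {q} {r} y z | fan-χ {p} {q} {r} free (inj₁ (x , y , z)) | xor-identityʳ (χ p r) = xor-same (χ p r)
    ... | inj₂ x | inj₁ y | inj₂ z
      rewrite χ-right-right {p} {r} x z | χ-sym p q | fan-χ {q} {p} {r} (originFree-swap free) (inj₂ (y , x , z)) | xor-same (χ q r) = ≡.refl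
    ... | inj₁ x | inj₂ y | inj₁ z
      rewrite χ-left-left {p} {r} x z | χ-sym p q | fan-χ {q} {p} {r} (originFree-swap free) (inj₁ (y , x , z)) | xor-same (χ q r) = ≡.refl
    ... | inj₂ x | inj₂ y | inj₁ z
      rewrite χ-right-right {p} {q} x y | χ-sym q r | χ-sym p r | fan-χ {r} {p} {q} (originFree-rotate free) (inj₂ (z , x , y)) = xor-same (χ r q)
    ... | inj₁ x | inj₁ y | inj₂ z
      rewrite χ-left-left {p} {q} x y | χ-sym q r | χ-sym p r | fan-χ {r} {p} {q} (originFree-rotate free) (inj₁ (z , x , y)) = xor-same (χ r q)

    -- The turn of the opposite vectors crosses l when the turn from p to q crosses the opposite of
    -- l. Together the two terms count crossings of the whole line, and a turn by less than a half
    -- circle crosses a line exactly when its ends lie on different sides.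
    χ-antipodal : ∀ {p q} → OriginFree p q q → χ p q xor χ (⊝ p) (⊝ q) ≡ side p xor side q
    χ-antipodal {p} {q} free with left⊎right (originFree⇒≉0 free) | left⊎right (originFree⇒≉0 (originFree-swap free))
    ... | inj₁ x | inj₁ y rewrite χ-left-left x y | χ-right-right (left⇒right-neg x) (left⇒right-neg y) | left-side x | left-side y = ≡.refl
    ... | inj₂ x | inj₂ y rewrite χ-right-right x y | χ-left-left (right⇒left-neg x) (right⇒left-neg y) | right-side x | right-side y = ≡.refl
    ... | inj₁ x | inj₂ y rewrite χ-left-right x y | χ-right-left (left⇒right-neg x) (right⇒left-neg y) | left-side x | right-side y
      = one-of free x y
      where
      one-of : OriginFree p q q → LeftOf p → RightOf q → does (0# <? cross q p) xor does (0# <? cross (⊝ p) (⊝ q)) ≡ true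
      one-of free x y with fan-left free x y y
      ... | inj₁ (z , _) = ≡.cong₂ _xor_ (nonpositive (anti-pos z)) (positive (pos-resp (sym (cross-neg₂ p q)) z))
      ... | inj₂ (z , _) = ≡.cong₂ _xor_ (positive (anti-neg z)) (nonpositive (pos-resp (-‿cong (sym (cross-neg₂ p q))) z))
    ... | inj₂ x | inj₁ y rewrite χ-right-left x y | χ-left-right (right⇒left-neg x) (left⇒right-neg y) | right-side x | left-side y
      = one-of free x y
      where
      one-of : OriginFree p q q → RightOf p → LeftOf q → does (0# <? cross p q) xor does (0# <? cross (⊝ q) (⊝ p)) ≡ true
      one-of free x y with fan-right free x y y
      ... | inj₁ (z , _) = ≡.cong₂ _xor_ (positive z) (nonpositive (anti-pos (pos-resp (sym (cross-neg₂ p q)) z)))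
      ... | inj₂ (z , _) = ≡.cong₂ _xor_ (nonpositive z) (positive (anti-neg (pos-resp (-‿cong (sym (cross-neg₂ p q))) z)))

    side-antipodal : ∀ {p} → ¬ p ≋ 𝟘 → side p xor side (⊝ p) ≡ true
    side-antipodal p≉0 with left⊎right p≉0
    ... | inj₁ x rewrite left-side x | right-side (left⇒right-neg x) = ≡.refl
    ... | inj₂ x rewrite right-side x | left-side (right⇒left-neg x) = ≡.refl

-- Parity of the turns along a simple polygon

module Xor where
  -- A subset of an n-element set is a vector of n Booleans, so `anySubset?` searches all valuations
  -- for a counterexample, and its failure is established by computation.
  truth-table : ∀ {n} (f g : Vec Bool n → Bool) {_ : False (anySubset? λ v → ¬? (f v Bool.≟ g v))} → f ≗ g
  truth-table f g {none} v = decidable-stable (f v Bool.≟ g v) λ f≢g → toWitnessFalse none (v , f≢g)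

  xor-transpose : ∀ x {y z} → x xor y ≡ z → y ≡ x xor z
  xor-transpose true  {y} ≡.refl = ≡.sym (not-involutive y)
  xor-transpose false     ≡.refl = ≡.refl

  -- This and the following steps add up parities around adjoining cells of secants: a side shared
  -- by two cells occurs twice and cancels.
  turn-step : ∀ χ₁ χ₂ χ₃ Rₐ R ρ C → (χ₁ xor χ₂) xor χ₃ ≡ false → Rₐ xor R ≡ χ₂ xor ρ →
    χ₃ xor (R xor C) ≡ (χ₁ xor Rₐ) xor (ρ xor C)
  turn-step χ₁ χ₂ χ₃ Rₐ R ρ C triangle row
    rewrite xor-transpose (χ₁ xor χ₂) triangle | xor-transpose Rₐ row =
    truth-table
      (λ { (χ₁ ∷ χ₂ ∷ Rₐ ∷ ρ ∷ C ∷ []) → ((χ₁ xor χ₂) xor false) xor ((Rₐ xor (χ₂ xor ρ)) xor C) })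
      (λ { (χ₁ ∷ χ₂ ∷ Rₐ ∷ ρ ∷ C ∷ []) → (χ₁ xor Rₐ) xor (ρ xor C) }) (χ₁ ∷ χ₂ ∷ Rₐ ∷ ρ ∷ C ∷ [])

  row-step : ∀ χ χ′ R R′ ρ₁ ρ₂ ρ → χ xor χ′ ≡ ρ₁ xor ρ₂ → R xor R′ ≡ ρ₂ xor ρ →
    (χ xor R) xor (χ′ xor R′) ≡ ρ₁ xor ρ
  row-step χ χ′ R R′ ρ₁ ρ₂ ρ cell rows
    rewrite xor-transpose χ cell | xor-transpose R rows =
    truth-table
      (λ { (χ ∷ R ∷ ρ₁ ∷ ρ₂ ∷ ρ ∷ []) → (χ xor R) xor ((χ xor (ρ₁ xor ρ₂)) xor (R xor (ρ₂ xor ρ))) })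
      (λ { (χ ∷ R ∷ ρ₁ ∷ ρ₂ ∷ ρ ∷ []) → ρ₁ xor ρ }) (χ ∷ R ∷ ρ₁ ∷ ρ₂ ∷ ρ ∷ [])

  cell-step : ∀ χ₁ χ₂ χ₃ χ₄ χ₅ → (χ₁ xor χ₂) xor χ₅ ≡ false → (χ₃ xor χ₄) xor χ₅ ≡ false →
    χ₁ xor χ₄ ≡ χ₃ xor χ₂
  cell-step χ₁ χ₂ χ₃ χ₄ χ₅ eq₁ eq₂
    rewrite xor-transpose (χ₁ xor χ₂) eq₁
          | xor-transpose χ₃ (xor-transpose ((χ₁ xor χ₂) xor false) (≡.trans (xor-comm _ (χ₃ xor χ₄)) eq₂)) =
    truth-table
      (λ { (χ₁ ∷ χ₂ ∷ χ₃ ∷ []) → χ₁ xor (χ₃ xor (((χ₁ xor χ₂) xor false) xor false)) })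
      (λ { (χ₁ ∷ χ₂ ∷ χ₃ ∷ []) → χ₃ xor χ₂ }) (χ₁ ∷ χ₂ ∷ χ₃ ∷ [])

  closing-step : ∀ χₐ χ₂ χ₃ χ₄ χ₅ χ₆ R₀ R₁ C ρ s₁ s₂ s₃ →
    (χₐ xor χ₂) xor χ₃ ≡ false → R₀ xor R₁ ≡ χ₂ xor ρ → (χₐ xor R₀) xor C ≡ s₁ xor s₂ →
    (ρ xor χ₄) xor χ₅ ≡ false → χ₅ xor χ₆ ≡ s₂ xor s₃ → s₃ xor s₁ ≡ true →
    (χ₃ xor ((R₁ xor χ₄) xor C)) xor χ₆ ≡ true
  closing-step χₐ χ₂ χ₃ χ₄ χ₅ χ₆ R₀ R₁ C ρ s₁ s₂ s₃ eq₁ eq₂ eq₃ eq₄ eq₅ eq₆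
    rewrite xor-transpose (χₐ xor χ₂) eq₁ | xor-transpose R₀ eq₂ | xor-transpose (χₐ xor R₀) eq₃
          | xor-transpose χ₅ eq₅ | xor-transpose (ρ xor χ₄) eq₄ | xor-transpose s₃ eq₆ =
    truth-table
      (λ { (χₐ ∷ χ₂ ∷ χ₄ ∷ R₀ ∷ ρ ∷ s₂ ∷ s₃ ∷ []) →
        (((χₐ xor χ₂) xor false) xor (((R₀ xor (χ₂ xor ρ)) xor χ₄) xor ((χₐ xor R₀) xor ((s₃ xor true) xor s₂))))
          xor (((ρ xor χ₄) xor false) xor (s₂ xor s₃)) })
      (λ { _ → true }) (χₐ ∷ χ₂ ∷ χ₄ ∷ R₀ ∷ ρ ∷ s₂ ∷ s₃ ∷ [])

final : ∀ {a} {A : Set a} → A → List A → A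
final x []       = x
final _ (x ∷ xs) = final x xs

final-∷ʳ : ∀ {a} {A : Set a} (w : A) ws z → final w (ws ∷ʳ z) ≡ z
final-∷ʳ w []       z = ≡.refl
final-∷ʳ _ (w ∷ ws) z = final-∷ʳ w ws z

final-map : ∀ {a b} {A : Set a} {B : Set b} (f : A → B) x xs → final (f x) (List.map f xs) ≡ f (final x xs)
final-map f x []       = ≡.refl
final-map f _ (x ∷ xs) = final-map f x xs

module SimplePolygon {c ℓ₁ ℓ₂} (𝕂 : OrderedField c ℓ₁ ℓ₂) where
  open OrderedField 𝕂
  open Plane 𝕂
  open OrderedFieldProperties 𝕂
  open Turning 𝕂
  open IntegerMultiples.Solver commutativeRing
  open Xor

  Unit : Carrier → Set (ℓ₁ ⊔ ℓ₂)
  Unit s = 0# ≤ s × s ≤ 1#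

  Disjoint : (u v w w′ : Point) → Set (c ⊔ ℓ₁ ⊔ ℓ₂)
  Disjoint u v w w′ = ∀ s t → Unit s → Unit t → ¬ u ⊕ s · (v ⊖ u) ≋ w ⊕ t · (w′ ⊖ w)

  Off : (u w w′ : Point) → Set (c ⊔ ℓ₁ ⊔ ℓ₂)
  Off u w w′ = ∀ t → Unit t → ¬ u ≋ w ⊕ t · (w′ ⊖ w)

  Corner : (u v w : Point) → Set (c ⊔ ℓ₁ ⊔ ℓ₂)
  Corner u v w = ∀ s t → Unit s → Unit t → 0# < s + t → ¬ v ⊕ s · (u ⊖ v) ≋ v ⊕ t · (w ⊖ v)

  -- The next edge meets uv only at v, and all later edges miss it; `Linked` reads those later edges
  -- off as consecutive pairs of vertices.
  Simple : Point → Point → List Point → Set (c ⊔ ℓ₁ ⊔ ℓ₂)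
  Simple u v []       = ⊤
  Simple u v (w ∷ ws) = Corner u v w × Linked (Disjoint u v) (w ∷ ws) × Simple v w ws

  private
    difference≈0 : ∀ {x y z} → x - y ≈ z → z ≈ 0# → x ≈ y
    difference≈0 {x} {y} eq z≈0 = trans (solve 2 (λ x y → x := (x :- y) :+ y) refl x y)
      (trans (+-congʳ (trans eq z≈0)) (+-identityˡ y))

    fill : ∀ {s α} x → s ≈ 1# → (s - (1# + 0#)) * x + α ≈ α
    fill {s} {α} x s≈1 = trans (+-congʳ (trans (*-congʳ (trans (+-cong s≈1 (-‿cong (+-identityʳ 1#))) (-‿inverseʳ 1#))) (zeroˡ x)))
      (+-identityˡ α)

  last-unit : ∀ {α β γ} → 0# ≤ α → 0# ≤ β → 0# ≤ γ → α + β + γ ≈ 1# → Unit γ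
  last-unit {α} {β} {γ} 0≤α 0≤β 0≤γ s≈1 = 0≤γ , 0≤y⇒x≤x+y (+-nonneg 0≤α 0≤β) (trans (+-comm γ (α + β)) s≈1)

  last-two-unit : ∀ {α β γ} → 0# ≤ α → 0# ≤ β → 0# ≤ γ → α + β + γ ≈ 1# → Unit (β + γ)
  last-two-unit {α} {β} {γ} 0≤α 0≤β 0≤γ s≈1 = +-nonneg 0≤β 0≤γ , 0≤y⇒x≤x+y 0≤α
    (trans (solve 3 (λ α β γ → β :+ γ :+ α := α :+ β :+ γ) refl α β γ) s≈1)

  first-two-unit : ∀ {α β γ} → 0# ≤ α → 0# ≤ β → 0# ≤ γ → α + β + γ ≈ 1# → Unit (α + β)
  first-two-unit 0≤α 0≤β 0≤γ s≈1 = +-nonneg 0≤α 0≤β , 0≤y⇒x≤x+y 0≤γ s≈1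

  -- A vanishing combination of the three secants rearranges into a common point of the two
  -- segments, with parameters α + β and β + γ.
  corner-free : ∀ {u v w} → Corner u v w → OriginFree (v ⊖ u) (w ⊖ u) (w ⊖ v)
  corner-free {u₁ , u₂} {v₁ , v₂} {w₁ , w₂} corner =
    originFree-normalised λ α β γ 0≤α 0≤β 0≤γ s≈1 (eq₁ , eq₂) →
      corner (α + β) (β + γ) (first-two-unit 0≤α 0≤β 0≤γ s≈1) (last-two-unit 0≤α 0≤β 0≤γ s≈1)
        -- The weights add up to 1, so the two parameters add up to 1 + β.
        (pos-resp (sum≈ α β γ) (+-nonneg-pos 0≤β (pos-resp (sym s≈1) 0<1)))
        (meet α β γ u₁ v₁ w₁ eq₁ , meet α β γ u₂ v₂ w₂ eq₂)
    where
    sum≈ : ∀ α β γ → β + (α + β + γ) ≈ α + β + (β + γ)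
    sum≈ = solve 3 (λ α β γ → β :+ (α :+ β :+ γ) := α :+ β :+ (β :+ γ)) refl
    meet : ∀ α β γ u v w → α * (v - u) + β * (w - u) + γ * (w - v) ≈ 0# →
      v + (α + β) * (u - v) ≈ v + (β + γ) * (w - v)
    meet α β γ u v w eq = difference≈0 (solve 6 (λ α β γ u v w →
      (v :+ (α :+ β) :* (u :- v)) :- (v :+ (β :+ γ) :* (w :- v))
        := :- (α :* (v :- u) :+ β :* (w :- u) :+ γ :* (w :- v))) refl α β γ u v w) (trans (-‿cong eq) -0#≈0#)

  off-free : ∀ {u w w′} → Off u w w′ → OriginFree (w ⊖ u) (w′ ⊖ u) (w′ ⊖ u)
  off-free {u₁ , u₂} {w₁ , w₂} {w′₁ , w′₂} off =
    originFree-normalised λ α β γ 0≤α 0≤β 0≤γ s≈1 (eq₁ , eq₂) →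
      off (β + γ) (last-two-unit 0≤α 0≤β 0≤γ s≈1) (meet α β γ s≈1 u₁ w₁ w′₁ eq₁ , meet α β γ s≈1 u₂ w₂ w′₂ eq₂)
    where
    meet : ∀ α β γ → α + β + γ ≈ 1# → ∀ u w w′ → α * (w - u) + β * (w′ - u) + γ * (w′ - u) ≈ 0# →
      u ≈ w + (β + γ) * (w′ - w)
    meet α β γ s≈1 u w w′ eq = difference≈0 (solve 6 (λ α β γ u w w′ →
      u :- (w :+ (β :+ γ) :* (w′ :- w))
        := (α :+ β :+ γ :- con 1ℤ) :* (w :- u) :+ :- (α :* (w :- u) :+ β :* (w′ :- u) :+ γ :* (w′ :- u)))
        refl α β γ u w w′) (trans (fill (w - u) s≈1) (trans (-‿cong eq) -0#≈0#))

  -- The secants between the ends of uv and those of ww′ are the corners of a cell, cut into two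
  -- triangles along the diagonal from w - u to w′ - v. This is one of them; `disjoint-free₂` is the
  -- other.
  disjoint-free₁ : ∀ {u v w w′} → Disjoint u v w w′ → OriginFree (w ⊖ u) (w′ ⊖ u) (w′ ⊖ v)
  disjoint-free₁ {u₁ , u₂} {v₁ , v₂} {w₁ , w₂} {w′₁ , w′₂} disjoint =
    originFree-normalised λ α β γ 0≤α 0≤β 0≤γ s≈1 (eq₁ , eq₂) →
      disjoint γ (β + γ) (last-unit 0≤α 0≤β 0≤γ s≈1) (last-two-unit 0≤α 0≤β 0≤γ s≈1)
        (meet α β γ s≈1 u₁ v₁ w₁ w′₁ eq₁ , meet α β γ s≈1 u₂ v₂ w₂ w′₂ eq₂)
    where
    meet : ∀ α β γ → α + β + γ ≈ 1# → ∀ u v w w′ → α * (w - u) + β * (w′ - u) + γ * (w′ - v) ≈ 0# →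
      u + γ * (v - u) ≈ w + (β + γ) * (w′ - w)
    meet α β γ s≈1 u v w w′ eq = difference≈0 (solve 7 (λ α β γ u v w w′ →
      (u :+ γ :* (v :- u)) :- (w :+ (β :+ γ) :* (w′ :- w))
        := (α :+ β :+ γ :- con 1ℤ) :* (w :- u) :+ :- (α :* (w :- u) :+ β :* (w′ :- u) :+ γ :* (w′ :- v)))
        refl α β γ u v w w′) (trans (fill (w - u) s≈1) (trans (-‿cong eq) -0#≈0#))

  disjoint-free₂ : ∀ {u v w w′} → Disjoint u v w w′ → OriginFree (w ⊖ u) (w ⊖ v) (w′ ⊖ v)
  disjoint-free₂ {u₁ , u₂} {v₁ , v₂} {w₁ , w₂} {w′₁ , w′₂} disjoint =
    originFree-normalised λ α β γ 0≤α 0≤β 0≤γ s≈1 (eq₁ , eq₂) →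
      disjoint (β + γ) γ (last-two-unit 0≤α 0≤β 0≤γ s≈1) (last-unit 0≤α 0≤β 0≤γ s≈1)
        (meet α β γ s≈1 u₁ v₁ w₁ w′₁ eq₁ , meet α β γ s≈1 u₂ v₂ w₂ w′₂ eq₂)
    where
    meet : ∀ α β γ → α + β + γ ≈ 1# → ∀ u v w w′ → α * (w - u) + β * (w - v) + γ * (w′ - v) ≈ 0# →
      u + (β + γ) * (v - u) ≈ w + γ * (w′ - w)
    meet α β γ s≈1 u v w w′ eq = difference≈0 (solve 7 (λ α β γ u v w w′ →
      (u :+ (β :+ γ) :* (v :- u)) :- (w :+ γ :* (w′ :- w))
        := (α :+ β :+ γ :- con 1ℤ) :* (w :- u) :+ :- (α :* (w :- u) :+ β :* (w :- v) :+ γ :* (w′ :- v)))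
        refl α β γ u v w w′) (trans (fill (w - u) s≈1) (trans (-‿cong eq) -0#≈0#))

  ⊝-⊖ : ∀ u v → ⊝ (u ⊖ v) ≋ v ⊖ u
  ⊝-⊖ (u₁ , u₂) (v₁ , v₂) = comp u₁ v₁ , comp u₂ v₂
    where
    comp : ∀ u v → - (u - v) ≈ v - u
    comp = solve 2 (λ u v → :- (u :- v) := v :- u) refl

  module Parity (l a : Point) (0<l×a : 0# < cross l a) where
    open Crossing l a 0<l×a

    side-cong : ∀ {p q} → p ≋ q → side p ≡ side q
    side-cong {p} {q} p≋q = does-⇔ (mk⇔ (to p≋q) (to (≋-sym p≋q))) (rightOf? p) (rightOf? q)
      where
      to : ∀ {p q} → p ≋ q → RightOf p → RightOf q
      to p≋q (inj₁ x) = inj₁ (pos-resp (cross-cong p≋q ≋-refl) x)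
      to p≋q (inj₂ (x , y)) = inj₂ (trans (sym (cross-cong p≋q ≋-refl)) x , pos-resp (cross-cong p≋q ≋-refl) y)

    positive-cong : ∀ {x y} → x ≈ y → does (0# <? x) ≡ does (0# <? y)
    positive-cong x≈y = does-⇔ (mk⇔ (pos-resp x≈y) (pos-resp (sym x≈y))) (0# <? _) (0# <? _)

    χ-cong : ∀ {p p′ q q′} → p ≋ p′ → q ≋ q′ → χ p q ≡ χ p′ q′
    χ-cong {p} {p′} {q} {q′} p≋p′ q≋q′
      rewrite side-cong {p} {p′} p≋p′ | side-cong {q} {q′} q≋q′ = chi-cong (side p′) (side q′)
      where
      chi-cong : ∀ b b′ → chi b b′ (cross p q) (cross q p) ≡ chi b b′ (cross p′ q′) (cross q′ p′)
      chi-cong true true = ≡.refl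
      chi-cong false false = ≡.refl
      chi-cong true false = positive-cong (cross-cong p≋p′ q≋q′)
      chi-cong false true = positive-cong (cross-cong q≋q′ p≋p′)

    turn : Point → Point → List Point → Bool
    turn u v []       = false
    turn u v (w ∷ ws) = χ (v ⊖ u) (w ⊖ v) xor turn v w ws

    -- The turns of the secants from u to a point running along the path, and
    -- from a point running along the path, without its last edge, to z.
    row : Point → Point → List Point → Bool
    row u w []        = false
    row u w (w′ ∷ ws) = χ (w ⊖ u) (w′ ⊖ u) xor row u w′ ws

    column : Point → Point → Point → List Point → Bool
    column z u v []       = false
    column z u v (w ∷ ws) = χ (z ⊖ u) (z ⊖ v) xor column z v w ws

    -- The crossings around a strip of cells are even in number: `cell-step` treats each cell, and
    -- the sides between neighbouring cells cancel.
    rows : ∀ {u v} w ws → Linked (Disjoint u v) (w ∷ ws) →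
      row u w ws xor row v w ws ≡ χ (w ⊖ u) (w ⊖ v) xor χ (final w ws ⊖ u) (final w ws ⊖ v)
    rows {u} {v} w [] _ = ≡.sym (xor-same (χ (w ⊖ u) (w ⊖ v)))
    rows {u} {v} w (w′ ∷ ws) (disjoint ∷ disjoints) =
      row-step (χ (w ⊖ u) (w′ ⊖ u)) (χ (w ⊖ v) (w′ ⊖ v)) (row u w′ ws) (row v w′ ws)
        (χ (w ⊖ u) (w ⊖ v)) (χ (w′ ⊖ u) (w′ ⊖ v)) _
        (cell-step (χ (w ⊖ u) (w′ ⊖ u)) (χ (w′ ⊖ u) (w′ ⊖ v)) (χ (w ⊖ u) (w ⊖ v)) (χ (w ⊖ v) (w′ ⊖ v)) (χ (w ⊖ u) (w′ ⊖ v))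
          (χ-triangle (disjoint-free₁ {u} {v} {w} {w′} disjoint)) (χ-triangle (disjoint-free₂ {u} {v} {w} {w′} disjoint)))
        (rows w′ ws disjoints)

    -- The secants from earlier to later vertices form a triangle whose hypotenuse consists of the
    -- edges and whose legs are the first row and the last column. Corner triangles and strips, all
    -- with even boundary, fill it, so hypotenuse and legs have the same parity.
    open-path : ∀ u v ws → Simple u v ws →
      turn u v ws ≡ row u v ws xor column (final v ws) u v ws
    open-path u v [] _ = ≡.refl
    open-path u v (w ∷ ws) (corner , disjoints , simple) rewrite open-path v w ws simple =
      turn-step (χ (v ⊖ u) (w ⊖ u)) (χ (w ⊖ u) (w ⊖ v)) (χ (v ⊖ u) (w ⊖ v)) (row u w ws) (row v w ws) _ _
        (χ-triangle (corner-free {u} {v} {w} corner)) (rows w ws disjoints)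

    row-∷ʳ : ∀ u w ws z → row u w (ws ∷ʳ z) ≡ row u w ws xor χ (final w ws ⊖ u) (z ⊖ u)
    row-∷ʳ u w [] z = xor-identityʳ _
    row-∷ʳ u w (w′ ∷ ws) z rewrite row-∷ʳ u w′ ws z =
      ≡.sym (xor-assoc (χ (w ⊖ u) (w′ ⊖ u)) (row u w′ ws) _)

    antipodal : ∀ z u v → Off z u v → χ (u ⊖ z) (v ⊖ z) xor χ (z ⊖ u) (z ⊖ v) ≡ side (u ⊖ z) xor side (v ⊖ z)
    antipodal z u v off = ≡.trans (≡.cong (χ (u ⊖ z) (v ⊖ z) xor_) (≡.sym (χ-cong (⊝-⊖ u z) (⊝-⊖ v z))))
      (χ-antipodal (off-free {z} {u} {v} off))

    -- Corresponding steps of the row and the column turn between opposite secants. By `χ-antipodal`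
    -- such a pair records only a change of side, and the changes telescope.
    row-column : ∀ z u v ws → Linked (Off z) (u ∷ v ∷ ws) →
      row z u (v ∷ ws) xor column z u v (ws ∷ʳ z) ≡ side (u ⊖ z) xor side (final v ws ⊖ z)
    row-column z u v [] (off ∷ _)
      rewrite xor-identityʳ (χ (u ⊖ z) (v ⊖ z)) | xor-identityʳ (χ (z ⊖ u) (z ⊖ v)) = antipodal z u v off
    row-column z u v (w ∷ ws) (off ∷ offs) =
      row-step (χ (u ⊖ z) (v ⊖ z)) (χ (z ⊖ u) (z ⊖ v)) (row z v (w ∷ ws)) (column z v w (ws ∷ʳ z))
        (side (u ⊖ z)) (side (v ⊖ z)) (side (final w ws ⊖ z)) (antipodal z u v off) (row-column z v w ws offs)

    -- A discrete version of Hopf's proof of the Umlaufsatz: the turns of the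
    -- edges are compared, cell by cell in the triangle of secants, with the
    -- turns of the secants through v₀.
    closed-path : ∀ v₀ v₁ w ws → let z = final w ws in
      Corner v₀ v₁ w → Linked (Disjoint v₀ v₁) (w ∷ ws) → Simple v₁ w (ws ∷ʳ v₀) →
      Linked (Off v₀) (v₁ ∷ w ∷ ws) → Corner z v₀ v₁ →
      turn v₀ v₁ (w ∷ ws ∷ʳ v₀) xor χ (v₀ ⊖ z) (v₁ ⊖ v₀) ≡ true
    closed-path v₀ v₁ w ws corner disjoints simple offs corner′
      -- The secant triangle of the whole polygon would contain the zero secant from v₀ to itself.
      -- Hence `open-path` is used without the first edge, and the row of v₀ is joined on by
      -- `closing-step`.
      rewrite open-path v₁ w (ws ∷ʳ v₀) simple | final-∷ʳ w ws v₀ | row-∷ʳ v₁ w ws v₀ =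
      closing-step (χ (v₁ ⊖ v₀) (w ⊖ v₀)) (χ (w ⊖ v₀) (w ⊖ v₁)) (χ (v₁ ⊖ v₀) (w ⊖ v₁))
        (χ (z ⊖ v₁) (v₀ ⊖ v₁)) (χ (z ⊖ v₀) (v₀ ⊖ v₁)) (χ (v₀ ⊖ z) (v₁ ⊖ v₀)) (row v₀ w ws) (row v₁ w ws)
        (column v₀ v₁ w (ws ∷ʳ v₀)) (χ (z ⊖ v₀) (z ⊖ v₁)) (side (v₁ ⊖ v₀)) (side (z ⊖ v₀)) (side (v₀ ⊖ v₁))
        (χ-triangle (corner-free {v₀} {v₁} {w} corner)) (rows w ws disjoints) (row-column v₀ v₁ w ws offs)
        (χ-triangle cut)
        (≡.trans (≡.cong (χ (z ⊖ v₀) (v₀ ⊖ v₁) xor_) (≡.sym (χ-cong (⊝-⊖ z v₀) (⊝-⊖ v₀ v₁))))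
          (χ-antipodal (originFree-pair (originFree-swap (originFree-rotate cut)))))
        -- Here the odd parity arises: an edge and its reverse lie on different sides.
        (≡.trans (≡.cong (side (v₀ ⊖ v₁) xor_) (≡.sym (side-cong (⊝-⊖ v₀ v₁))))
          (side-antipodal (originFree⇒≉0 (originFree-rotate cut))))
      where
      z = final w ws
      cut : OriginFree (z ⊖ v₀) (z ⊖ v₁) (v₀ ⊖ v₁)
      cut = originFree-resp (⊝-⊖ v₀ z) (⊝-⊖ v₁ z) (⊝-⊖ v₁ v₀) (originFree-neg (corner-free {z} {v₀} {v₁} corner′))

-- Signs of the cycles of a plabic graph

module Planarity {c ℓ₁ ℓ₂} {𝕂 : OrderedField c ℓ₁ ℓ₂} {k n : ℕ} (G : PlabicGraph 𝕂 k n) where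
  open OrderedField 𝕂
  open Plane 𝕂
  open OrderedFieldProperties 𝕂
  open Turning 𝕂
  open SimplePolygon 𝕂
  open PlabicGraph G
  open IntegerMultiples.Solver commutativeRing

  Inner : Vertex → Set
  Inner v = ∃ λ u → v ≡ inner u

  adjacent-disjoint : ∀ {u v w w′} → Adjacent u v → Adjacent w w′ →
    u ≢ w → u ≢ w′ → v ≢ w → v ≢ w′ → Disjoint (position u) (position v) (position w) (position w′)
  adjacent-disjoint (e , ≡.refl , ≡.refl) (f , ≡.refl , ≡.refl) u≢w u≢w′ v≢w v≢w′ s t (0≤s , s≤1) (0≤t , t≤1) eq
    with planar e f (u≢w ∘ ≡.cong src) (position (src f) ⊕ t · (position (tgt f) ⊖ position (src f)))
           (s , 0≤s , s≤1 , ≋-sym eq) (t , 0≤t , t≤1 , ≋-refl)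
  ... | _ , inj₁ ≡.refl , inj₁ eq′ , _ = u≢w (≡.sym eq′)
  ... | _ , inj₁ ≡.refl , inj₂ eq′ , _ = u≢w′ (≡.sym eq′)
  ... | _ , inj₂ ≡.refl , inj₁ eq′ , _ = v≢w (≡.sym eq′)
  ... | _ , inj₂ ≡.refl , inj₂ eq′ , _ = v≢w′ (≡.sym eq′)

  adjacent-off : ∀ {u v w w′} → Adjacent u v → Adjacent w w′ → u ≢ w → u ≢ w′ →
    Off (position u) (position w) (position w′)
  adjacent-off (e , ≡.refl , ≡.refl) (f , ≡.refl , ≡.refl) u≢w u≢w′ t (0≤t , t≤1) eq
    with planar e f (u≢w ∘ ≡.cong src) (position (src e))
           (0# , inj₂ refl , inj₁ 0<1 , start) (t , 0≤t , t≤1 , eq)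
    where
    start : position (src e) ≋ position (src e) ⊕ 0# · (position (tgt e) ⊖ position (src e))
    start = sym (trans (+-congˡ (zeroˡ _)) (+-identityʳ _)) , sym (trans (+-congˡ (zeroˡ _)) (+-identityʳ _))
  ... | _ , _ , inj₁ ≡.refl , eq′ = u≢w (position-injective _ _ eq′)
  ... | _ , _ , inj₂ ≡.refl , eq′ = u≢w′ (position-injective _ _ eq′)

  private
    reversed : ∀ s u v → v + s * (u - v) ≈ u + (1# - s) * (v - u)
    reversed s u v = sym (trans (+-congˡ (*-congʳ (+-congʳ (sym (+-identityʳ 1#)))))
      (solve 3 (λ s u v → u :+ (con 1ℤ :- s) :* (v :- u) := v :+ s :* (u :- v)) refl s u v))

    stationary : ∀ {s u v} → 0# < s → v + s * (u - v) ≈ v → u ≈ v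
    stationary {s} {u} {v} 0<s eq =
      trans (solve 2 (λ u v → u := (u :- v) :+ v) refl u v) (trans (+-congʳ (cancel-nonzero (pos⇒≉0 0<s)
        (trans (solve 3 (λ s u v → s :* (u :- v) := (v :+ s :* (u :- v)) :- v) refl s u v)
          (trans (+-congʳ eq) (-‿inverseʳ v))))) (+-identityˡ v))

  adjacent-corner : ∀ {u v w} → Adjacent u v → Adjacent v w → u ≢ w →
    Corner (position u) (position v) (position w)
  adjacent-corner {v = v} (e , ≡.refl , ≡.refl) (f , src≡ , ≡.refl) u≢w s t (0≤s , s≤1) (0≤t , t≤1) 0<s+t eq
    with planar e f (λ e≡f → edge-nondegenerate e (≡.trans (≡.cong src e≡f) src≡))
           (position (tgt e) ⊕ s · (position (src e) ⊖ position (tgt e)))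
           -- `Corner` parametrises the first segment from v back to u, `OnSegment` from source to
           -- target.
           (1# - s , x≤1⇒0≤1-x s≤1 , 0≤y⇒x≤x+y 0≤s (solve′ s) , reversed s _ _ , reversed s _ _)
           (t , 0≤t , t≤1 , ≡.subst (λ v → position (tgt e) ⊕ s · (position (src e) ⊖ position (tgt e))
             ≋ position v ⊕ t · (position (tgt f) ⊖ position v)) (≡.sym src≡) eq)
    where
    solve′ : ∀ s → 1# - s + s ≈ 1#
    solve′ s = solve 2 (λ x s → x :- s :+ s := x) refl 1# s
  ... | _ , inj₁ ≡.refl , inj₁ eq′ , _ = edge-nondegenerate e (≡.trans (≡.sym eq′) src≡)
  ... | _ , inj₁ ≡.refl , inj₂ eq′ , _ = u≢w (≡.sym eq′)
  ... | _ , inj₂ ≡.refl , inj₂ eq′ , _ = edge-nondegenerate f (≡.trans src≡ (≡.sym eq′))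
  -- The common point is the corner itself. A positive s would then identify the ends of e, a
  -- positive t those of f, and s and t do not both vanish.
  ... | _ , inj₂ ≡.refl , inj₁ _ , at = either 0≤s 0≤t
    where
    either : 0# ≤ s → 0# ≤ t → ⊥
    either (inj₁ 0<s) _ = edge-nondegenerate e (position-injective _ _
      (stationary 0<s (proj₁ at) , stationary 0<s (proj₂ at)))
    either (inj₂ 0≈s) (inj₁ 0<t) = edge-nondegenerate f (≡.trans src≡ (≡.sym (position-injective _ _
      ( stationary 0<t (trans (sym (proj₁ eq)) (proj₁ at)) , stationary 0<t (trans (sym (proj₂ eq)) (proj₂ at))))))
    either (inj₂ 0≈s) (inj₂ 0≈t) = irrefl (trans (sym (+-identityʳ 0#)) (+-cong 0≈s 0≈t)) 0<s+t

  -- Two opposite straight edges share their midpoint, which planarity would make a vertex. This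
  -- excludes cycles of length two, to which the polygon argument does not apply.
  no-reversal : ∀ {u v} → Adjacent u v → ¬ Adjacent v u
  no-reversal {u} {v} (e , ≡.refl , ≡.refl) (f , src≡ , tgt≡) with half
  ... | i , 0<i , i+i≈1
    with planar e f (λ e≡f → edge-nondegenerate e (≡.trans (≡.cong src e≡f) src≡))
           (middle (position (src e)) (position (tgt e)))
           (i , inj₁ 0<i , i≤1 , ≋-refl)
           (i , inj₁ 0<i , i≤1 , ≡.subst₂ (λ u v → middle (position (src e)) (position (tgt e)) ≋ middle (position u) (position v))
             (≡.sym src≡) (≡.sym tgt≡) (swap _ _ , swap _ _))
    where
    i≤1 : i ≤ 1#
    i≤1 = 0≤y⇒x≤x+y (inj₁ 0<i) i+i≈1
    middle : Point → Point → Point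
    middle p q = p ⊕ i · (q ⊖ p)
    swap : ∀ x y → x + i * (y - x) ≈ y + i * (x - y)
    swap x y = trans (solve 3 (λ i x y → x :+ i :* (y :- x) := y :+ i :* (x :- y) :+ ((x :- y) :- (i :+ i) :* (x :- y))) refl i x y)
      (trans (+-congˡ (trans (+-congˡ (-‿cong (trans (*-congʳ i+i≈1) (*-identityˡ _)))) (-‿inverseʳ _))) (+-identityʳ _))
  ...   | _ , inj₁ ≡.refl , _ , eq = edge-nondegenerate e (≡.sym (position-injective _ _
      (stationary 0<i (proj₁ eq) , stationary 0<i (proj₂ eq))))
  ...   | _ , inj₂ ≡.refl , _ , eq = edge-nondegenerate e (position-injective _ _
      (stationary 0<i (trans (swap′ _ _) (proj₁ eq)) , stationary 0<i (trans (swap′ _ _) (proj₂ eq))))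
    where
    swap′ : ∀ x y → y + i * (x - y) ≈ x + i * (y - x)
    swap′ x y = trans (solve 3 (λ i x y → y :+ i :* (x :- y) := x :+ i :* (y :- x) :+ ((i :+ i) :* (x :- y) :- (x :- y))) refl i x y)
      (trans (+-congˡ (trans (+-congʳ (trans (*-congʳ i+i≈1) (*-identityˡ _))) (-‿inverseʳ _))) (+-identityʳ _))

  disjoint-path : ∀ {u v ws} → Adjacent u v → Linked Adjacent ws → All (u ≢_) ws → All (v ≢_) ws →
    Linked (Disjoint (position u) (position v)) (map position ws)
  disjoint-path uv [] _ _ = []
  disjoint-path uv [-] _ _ = [-]
  disjoint-path uv (ww′ ∷ linked) (u≢w ∷ u≢ws@(u≢w′ ∷ _)) (v≢w ∷ v≢ws@(v≢w′ ∷ _)) =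
    adjacent-disjoint uv ww′ u≢w u≢w′ v≢w v≢w′ ∷ disjoint-path uv linked u≢ws v≢ws

  off-path : ∀ {u v ws} → Adjacent u v → Linked Adjacent ws → All (u ≢_) ws →
    Linked (Off (position u)) (map position ws)
  off-path uv [] _ = []
  off-path uv [-] _ = [-]
  off-path uv (ww′ ∷ linked) (u≢w ∷ u≢ws@(u≢w′ ∷ _)) = adjacent-off uv ww′ u≢w u≢w′ ∷ off-path uv linked u≢ws

  simple-path : ∀ u v ws → Linked Adjacent (u ∷ v ∷ ws) → Unique (u ∷ v ∷ ws) →
    Simple (position u) (position v) (map position ws)
  simple-path u v [] _ _ = tt
  simple-path u v (w ∷ ws) (uv ∷ linked@(vw ∷ linked′)) (((u≢v ∷ u≢w ∷ u≢ws)) ∷ unique@((v≢w ∷ v≢ws) ∷ _)) =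
    adjacent-corner uv vw u≢w , disjoint-path uv linked′ (u≢w ∷ u≢ws) (v≢w ∷ v≢ws) , simple-path v w ws linked unique

sgn : Bool → ℤ
sgn true  = -1ℤ
sgn false = 1ℤ

sgn-xor : ∀ b b′ → sgn (b xor b′) ≡ sgn b ℤ.* sgn b′
sgn-xor true  true  = ≡.refl
sgn-xor true  false = ≡.refl
sgn-xor false true  = ≡.refl
sgn-xor false false = ≡.refl

negOnePow-⊖ : ∀ m n → negOnePow (m ℤ.⊖ n) ≡ -1ℤ ℤ.^ m ℤ.* -1ℤ ℤ.^ n
negOnePow-⊖ zero    zero    = ≡.refl
negOnePow-⊖ zero    (suc n) = ≡.sym (ℤ.*-identityˡ _)
negOnePow-⊖ (suc m) zero    = ≡.sym (ℤ.*-identityʳ _)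
negOnePow-⊖ (suc m) (suc n) = ≡.trans (≡.cong negOnePow (ℤ.[1+m]⊖[1+n]≡m⊖n m n))
  (≡.trans (negOnePow-⊖ m n) (cancel (-1ℤ ℤ.^ m) (-1ℤ ℤ.^ n)))
  where
  open +-*-Solver
  cancel : ∀ x y → x ℤ.* y ≡ -1ℤ ℤ.* x ℤ.* (-1ℤ ℤ.* y)
  cancel = solve 2 (λ x y → x :* y := con -1ℤ :* x :* (con -1ℤ :* y)) ≡.refl

negOnePow-+ : ∀ i j → negOnePow (i ℤ.+ j) ≡ negOnePow i ℤ.* negOnePow j
negOnePow-+ (+ m)    (+ n)    = ℤ.^-distribˡ-+-* -1ℤ m n
negOnePow-+ (+ m)    -[1+ n ] = negOnePow-⊖ m (suc n)
negOnePow-+ -[1+ m ] (+ n)    = ≡.trans (negOnePow-⊖ n (suc m)) (ℤ.*-comm (-1ℤ ℤ.^ n) (-1ℤ ℤ.^ suc m))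
negOnePow-+ -[1+ m ] -[1+ n ] =
  ≡.trans (≡.cong (λ k → -1ℤ ℤ.^ suc k) (≡.sym (ℕ.+-suc m n))) (ℤ.^-distribˡ-+-* -1ℤ (suc m) (suc n))

module RayCrossing {c ℓ₁ ℓ₂} (𝕂 : OrderedField c ℓ₁ ℓ₂) where
  open OrderedField 𝕂
  open Plane 𝕂
  open OrderedFieldProperties 𝕂
  open Turning 𝕂
  open SimplePolygon 𝕂
  open IntegerMultiples.Solver commutativeRing
  open SetoidReasoning setoid

  convex-pos : ∀ {u x y} → Unit u → 0# < x → 0# < y → 0# < (1# - u) * x + u * y
  convex-pos {u} (inj₁ 0<u , u≤1) 0<x 0<y =
    +-nonneg-pos (*-nonneg (x≤1⇒0≤1-x u≤1) (inj₁ 0<x)) (*-positive 0<u 0<y)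
  convex-pos {u} {x} {y} (inj₂ 0≈u , _) 0<x 0<y = pos-resp
    (sym (trans (+-cong (*-congʳ (trans (+-congˡ (trans (-‿cong (sym 0≈u)) -0#≈0#)) (+-identityʳ 1#)))
      (trans (*-congʳ (sym 0≈u)) (zeroˡ y))) (trans (+-identityʳ _) (*-identityˡ x)))) 0<x

  module _ (l a : Point) (0<l×a : 0# < cross l a) where

    on-ray : ∀ {y} → cross l y ≈ 0# → 0# < cross y a → ∃ λ t → 0# < t × y ≋ t · l
    on-ray {y@(y₁ , y₂)} l×y≈0 0<y×a = cross y a * i , *-positive 0<y×a (inverse-pos 0<l×a li≈1) ,
      comp (proj₁ (cramer y l a)) , comp (proj₂ (cramer y l a))
      where
      i = proj₁ (inv (pos⇒≉0 0<l×a))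
      li≈1 = proj₂ (inv (pos⇒≉0 0<l×a))
      comp : ∀ {y′ l′ a′} → cross l a * y′ + cross a y * l′ + cross y l * a′ ≈ 0# → y′ ≈ cross y a * i * l′
      comp {y′} {l′} {a′} eq = begin
        y′ ≈⟨ *-identityˡ y′ ⟨
        1# * y′ ≈⟨ *-congʳ li≈1 ⟨
        cross l a * i * y′ ≈⟨ solve 7 (λ la i y′ ay l′ yl a′ → la :* i :* y′ :=
          i :* (la :* y′ :+ ay :* l′ :+ yl :* a′) :+ :- ay :* i :* l′ :+ :- yl :* (i :* a′))
            refl (cross l a) i y′ (cross a y) l′ (cross y l) a′ ⟩
        i * (cross l a * y′ + cross a y * l′ + cross y l * a′) + - cross a y * i * l′ + - cross y l * (i * a′)
          ≈⟨ +-cong (+-cong (trans (*-congˡ eq) (zeroʳ i)) (*-congʳ (*-congʳ (sym (cross-anti a y)))))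
               (trans (*-congʳ (trans (sym (cross-anti y l)) l×y≈0)) (zeroˡ _)) ⟩
        0# + cross y a * i * l′ + 0# ≈⟨ trans (+-identityʳ _) (+-identityˡ _) ⟩
        cross y a * i * l′ ∎

    cross-segmentˡ : ∀ b p q u → cross l (p ⊕ u · (q ⊖ p) ⊖ b) ≈ (1# - u) * cross l (p ⊖ b) + u * cross l (q ⊖ b)
    cross-segmentˡ (b₁ , b₂) (p₁ , p₂) (q₁ , q₂) u =
      trans (solve 9 (λ l₁ l₂ b₁ b₂ p₁ p₂ q₁ q₂ u →
        l₁ :* (p₂ :+ u :* (q₂ :- p₂) :- b₂) :- l₂ :* (p₁ :+ u :* (q₁ :- p₁) :- b₁)
          := (con 1ℤ :- u) :* (l₁ :* (p₂ :- b₂) :- l₂ :* (p₁ :- b₁)) :+ u :* (l₁ :* (q₂ :- b₂) :- l₂ :* (q₁ :- b₁)))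
        refl (proj₁ l) (proj₂ l) b₁ b₂ p₁ p₂ q₁ q₂ u) (+-congʳ (*-congʳ (+-congʳ (+-identityʳ 1#))))

    cross-segmentʳ : ∀ b p q u → cross (p ⊕ u · (q ⊖ p) ⊖ b) a ≈ (1# - u) * cross (p ⊖ b) a + u * cross (q ⊖ b) a
    cross-segmentʳ (b₁ , b₂) (p₁ , p₂) (q₁ , q₂) u =
      trans (solve 9 (λ a₁ a₂ b₁ b₂ p₁ p₂ q₁ q₂ u →
        (p₁ :+ u :* (q₁ :- p₁) :- b₁) :* a₂ :- (p₂ :+ u :* (q₂ :- p₂) :- b₂) :* a₁
          := (con 1ℤ :- u) :* ((p₁ :- b₁) :* a₂ :- (p₂ :- b₂) :* a₁) :+ u :* ((q₁ :- b₁) :* a₂ :- (q₂ :- b₂) :* a₁))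
        refl (proj₁ a) (proj₂ a) b₁ b₂ p₁ p₂ q₁ q₂ u) (+-congʳ (*-congʳ (+-congʳ (+-identityʳ 1#))))

    cross-ray : ∀ b t → cross l (b ⊕ t · l ⊖ b) ≈ 0#
    cross-ray (b₁ , b₂) t = solve 5 (λ l₁ l₂ b₁ b₂ t →
      l₁ :* (b₂ :+ t :* l₂ :- b₂) :- l₂ :* (b₁ :+ t :* l₁ :- b₁) := con 0ℤ) refl (proj₁ l) (proj₂ l) b₁ b₂ t

    ⊖-cong : ∀ {p q} b → p ≋ q → p ⊖ b ≋ q ⊖ b
    ⊖-cong b (x , y) = +-congʳ x , +-congʳ y

    leftOfRay : Point → Point → Bool
    leftOfRay b p = does (0# <? cross l (p ⊖ b))

    meets-zero : ∀ {b p q} → MeetsRay b l p q →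
      ∃ λ u → Unit u × (1# - u) * cross l (p ⊖ b) + u * cross l (q ⊖ b) ≈ 0#
    meets-zero {b} {p} {q} (_ , t , _ , u , 0≤u , u≤1 , eq) = u , (0≤u , u≤1) ,
      trans (sym (cross-segmentˡ b p q u)) (trans (cross-cong ≋-refl (⊖-cong b (≋-sym eq))) (cross-ray b t))

    opposite-meets : ∀ {b p q P Q} → 0# < cross (p ⊖ b) a → 0# < cross (q ⊖ b) a →
      0# < P → 0# < Q → Q * cross l (p ⊖ b) + P * cross l (q ⊖ b) ≈ 0# → ¬ cross l (q ⊖ p) ≈ 0# →
      MeetsRay b l p q
    opposite-meets {b@(b₁ , b₂)} {p@(p₁ , p₂)} {q@(q₁ , q₂)} {P} {Q} inside-p inside-q 0<P 0<Q balance not-parallel =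
      not-parallel , t , 0<t , u , proj₁ unit , proj₂ unit , back b₁ (proj₁ y≋tl) , back b₂ (proj₂ y≋tl)
      where
      i = proj₁ (inv (pos⇒≉0 (+-pos 0<P 0<Q)))
      si≈1 = proj₂ (inv (pos⇒≉0 (+-pos 0<P 0<Q)))
      0<i = inverse-pos (+-pos 0<P 0<Q) si≈1
      -- For P and Q proportional to the distances of p and q from the line, the crossing divides
      -- the segment in the ratio P : Q.
      u = P * i
      unit : Unit u
      unit = inj₁ (*-positive 0<P 0<i) ,
        0≤y⇒x≤x+y (inj₁ (*-positive 0<Q 0<i)) (trans (sym (distribʳ i P Q)) si≈1)
      1-u≈Qi : 1# - u ≈ Q * i
      1-u≈Qi = trans (+-congʳ (trans (sym si≈1) (distribʳ i P Q)))
        (solve 2 (λ x y → x :+ y :- x := y) refl (P * i) (Q * i))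
      y = p ⊕ u · (q ⊖ p) ⊖ b
      ly≈0 : cross l y ≈ 0#
      ly≈0 = begin
        cross l y ≈⟨ cross-segmentˡ b p q u ⟩
        (1# - u) * cross l (p ⊖ b) + u * cross l (q ⊖ b) ≈⟨ +-congʳ (*-congʳ 1-u≈Qi) ⟩
        Q * i * cross l (p ⊖ b) + P * i * cross l (q ⊖ b) ≈⟨ solve 5 (λ Q i x P y →
          Q :* i :* x :+ P :* i :* y := i :* (Q :* x :+ P :* y)) refl Q i (cross l (p ⊖ b)) P (cross l (q ⊖ b)) ⟩
        i * (Q * cross l (p ⊖ b) + P * cross l (q ⊖ b)) ≈⟨ *-congˡ balance ⟩
        i * 0# ≈⟨ zeroʳ i ⟩
        0# ∎
      ray = on-ray {y} ly≈0 (pos-resp (sym (cross-segmentʳ b p q u)) (convex-pos unit inside-p inside-q))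
      t = proj₁ ray
      0<t = proj₁ (proj₂ ray)
      y≋tl = proj₂ (proj₂ ray)
      back : ∀ {x z} b → x - b ≈ z → b + z ≈ x
      back {x} b eq = trans (+-congˡ (sym eq)) (solve 2 (λ x b → b :+ (x :- b) := x) refl x b)

    -- Within the half-plane to which p and q belong, the line through b in direction l consists of
    -- the ray alone. A segment in the half-plane therefore meets the ray exactly when it changes
    -- sides of the line.
    meets-xor : ∀ {b p q} → 0# < cross (p ⊖ b) a → 0# < cross (q ⊖ b) a →
      ¬ cross l (p ⊖ b) ≈ 0# → ¬ cross l (q ⊖ b) ≈ 0# →
      does (meetsRay? b l p q) ≡ leftOfRay b p xor leftOfRay b q
    meets-xor {b@(b₁ , b₂)} {p@(p₁ , p₂)} {q@(q₁ , q₂)} inside-p inside-q p-off q-off with pos⊎neg p-off | pos⊎neg q-off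
    ... | inj₁ x | inj₁ y rewrite dec-true (0# <? cross l (p ⊖ b)) x | dec-true (0# <? cross l (q ⊖ b)) y =
      dec-false (meetsRay? b l p q) λ meets → let u , unit , eq = meets-zero {b} {p} {q} meets in
        pos⇒≉0 (convex-pos unit x y) eq
    ... | inj₂ x | inj₂ y
      rewrite dec-false (0# <? cross l (p ⊖ b)) (λ z → ¬pos-pos z x) | dec-false (0# <? cross l (q ⊖ b)) (λ z → ¬pos-pos z y) =
      dec-false (meetsRay? b l p q) λ meets → let u , unit , eq = meets-zero {b} {p} {q} meets in
        pos⇒≉0 (convex-pos unit x y) (trans (negate u _ _) (trans (-‿cong eq) -0#≈0#))
      where
      negate : ∀ u x y → (1# - u) * (- x) + u * (- y) ≈ - ((1# - u) * x + u * y)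
      negate u = solve 4 (λ e u x y → (e :- u) :* :- x :+ u :* :- y := :- ((e :- u) :* x :+ u :* y)) refl 1# u
    ... | inj₁ x | inj₂ y
      rewrite dec-true (0# <? cross l (p ⊖ b)) x | dec-false (0# <? cross l (q ⊖ b)) (λ z → ¬pos-pos z y) =
      dec-true (meetsRay? b l p q) (opposite-meets {b} {p} {q} inside-p inside-q x y
        (solve 2 (λ x y → :- y :* x :+ x :* y := con 0ℤ) refl (cross l (p ⊖ b)) (cross l (q ⊖ b)))
        (λ z → pos⇒≉0 (+-pos x y) (trans (sym (apart (proj₁ l) (proj₂ l))) (trans (-‿cong z) -0#≈0#))))
      where
      apart : ∀ l₁ l₂ → - cross (l₁ , l₂) (q ⊖ p) ≈ cross (l₁ , l₂) (p ⊖ b) + - cross (l₁ , l₂) (q ⊖ b)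
      apart l₁ l₂ = solve 8 (λ l₁ l₂ b₁ b₂ p₁ p₂ q₁ q₂ → :- (l₁ :* (q₂ :- p₂) :- l₂ :* (q₁ :- p₁)) :=
        (l₁ :* (p₂ :- b₂) :- l₂ :* (p₁ :- b₁)) :+ :- (l₁ :* (q₂ :- b₂) :- l₂ :* (q₁ :- b₁))) refl l₁ l₂ b₁ b₂ p₁ p₂ q₁ q₂
    ... | inj₂ x | inj₁ y
      rewrite dec-false (0# <? cross l (p ⊖ b)) (λ z → ¬pos-pos z x) | dec-true (0# <? cross l (q ⊖ b)) y =
      dec-true (meetsRay? b l p q) (opposite-meets {b} {p} {q} inside-p inside-q x y
        (solve 2 (λ x y → y :* x :+ :- x :* y := con 0ℤ) refl (cross l (p ⊖ b)) (cross l (q ⊖ b)))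
        (λ z → pos⇒≉0 (+-pos x y) (trans (sym (apart (proj₁ l) (proj₂ l))) z)))
      where
      apart : ∀ l₁ l₂ → cross (l₁ , l₂) (q ⊖ p) ≈ - cross (l₁ , l₂) (p ⊖ b) + cross (l₁ , l₂) (q ⊖ b)
      apart l₁ l₂ = solve 8 (λ l₁ l₂ b₁ b₂ p₁ p₂ q₁ q₂ → (l₁ :* (q₂ :- p₂) :- l₂ :* (q₁ :- p₁)) :=
        :- (l₁ :* (p₂ :- b₂) :- l₂ :* (p₁ :- b₁)) :+ (l₁ :* (q₂ :- b₂) :- l₂ :* (q₁ :- b₁))) refl l₁ l₂ b₁ b₂ p₁ p₂ q₁ q₂

final∈ : ∀ {a} {A : Set a} (x : A) xs → final x xs ∈ x ∷ xs
final∈ x []       = here ≡.refl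
final∈ x (y ∷ xs) = there (final∈ y xs)

module Cycles {c ℓ₁ ℓ₂} {𝕂 : OrderedField c ℓ₁ ℓ₂} {k n : ℕ} (G : PlabicGraph 𝕂 k n) (𝔩 : GaugeRayDirection G) where
  open OrderedField 𝕂
  open Plane 𝕂
  open OrderedFieldProperties 𝕂
  open Turning 𝕂
  open SimplePolygon 𝕂
  open RayCrossing 𝕂
  open PlabicGraph G
  open GaugeRayDirection 𝔩
  open Planarity G

  0<l×a : 0# < cross direction axis
  0<l×a = pos-resp (sym (cross-anti axis direction)) (neg⇒pos- points-inside)

  open Crossing direction axis 0<l×a
  open Parity direction axis 0<l×a

  private
    linked-∷ʳ : ∀ u us {v} → Linked Adjacent (u ∷ us) → Adjacent (final u us) v → Linked Adjacent (u ∷ us ∷ʳ v)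
    linked-∷ʳ u []       [-]      zv = zv ∷ [-]
    linked-∷ʳ u (w ∷ us) (uw ∷ l) zv = uw ∷ linked-∷ʳ w us l zv

  polygon-odd : ∀ v₀ v₁ w ws → Linked Adjacent (v₀ ∷ v₁ ∷ w ∷ ws) → Adjacent (final w ws) v₀ →
    Unique (v₀ ∷ v₁ ∷ w ∷ ws) →
    turn (position v₀) (position v₁) (map position (w ∷ ws) ∷ʳ position v₀)
      xor χ (position v₀ ⊖ position (final w ws)) (position v₁ ⊖ position v₀) ≡ true
  polygon-odd v₀ v₁ w ws (v₀v₁ ∷ linked@(v₁w ∷ linked′)) zv₀ ((v₀≢v₁ ∷ v₀≢ws) ∷ unique@((v₁≢w ∷ v₁≢ws) ∷ _)) =
    ≡.subst (λ z → turn (position v₀) (position v₁) (map position (w ∷ ws) ∷ʳ position v₀)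
                     xor χ (position v₀ ⊖ z) (position v₁ ⊖ position v₀) ≡ true)
      (final-map position w ws)
      (closed-path (position v₀) (position v₁) (position w) (map position ws)
        (adjacent-corner v₀v₁ v₁w (All.head v₀≢ws)) (disjoint-path v₀v₁ linked′ v₀≢ws (v₁≢w ∷ v₁≢ws))
        (≡.subst (Simple (position v₁) (position w)) (List.map-++ position ws (v₀ ∷ []))
          (simple-path v₁ w (ws ∷ʳ v₀) (linked-∷ʳ v₁ (w ∷ ws) linked zv₀) unique′))
        (off-path v₀v₁ linked (v₀≢v₁ ∷ v₀≢ws))
        (≡.subst (λ z → Corner z (position v₀) (position v₁)) (≡.sym (final-map position w ws))
          (adjacent-corner zv₀ v₀v₁ (λ z≡v₁ → All.lookup (v₁≢w ∷ v₁≢ws) (final∈ w ws) (≡.sym z≡v₁)))))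
    where
    unique′ : Unique (v₁ ∷ w ∷ ws ∷ʳ v₀)
    unique′ = Unique.++⁺ unique ([] ∷ []) λ { (v∈ , here ≡.refl) → All.lookup (v₀≢v₁ ∷ v₀≢ws) v∈ ≡.refl }

  oddTurns : Edge → List Edge → Bool
  oddTurns e []      = false
  oddTurns e (f ∷ P) = χ (vector e) (vector f) xor oddTurns f P

  oddTurns-∷ʳ : ∀ e P f → oddTurns e (P ∷ʳ f) ≡ oddTurns e P xor χ (vector (final e P)) (vector f)
  oddTurns-∷ʳ e []      f = xor-identityʳ _
  oddTurns-∷ʳ e (g ∷ P) f = ≡.trans (≡.cong (χ (vector e) (vector g) xor_) (oddTurns-∷ʳ g P f))
    (≡.sym (xor-assoc (χ (vector e) (vector g)) (oddTurns g P) _))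

  turn-sources : ∀ e f P → Linked Consecutive (e ∷ f ∷ P) →
    turn (position (src e)) (position (src f)) (map position (map src P) ∷ʳ position (tgt (final f P))) ≡ oddTurns e (f ∷ P)
  turn-sources e f []      (≡e ∷ _) =
    ≡.cong (λ v → χ (position v ⊖ position (src e)) (vector f) xor false) (≡.sym ≡e)
  turn-sources e f (g ∷ P) (≡e ∷ linked@(≡f ∷ _)) = ≡.cong₂ _xor_
    (≡.cong₂ (λ u v → χ (position u ⊖ position (src e)) (position v ⊖ position (src f))) (≡.sym ≡e) (≡.sym ≡f))
    (turn-sources f g P linked)

  sources-adjacent : ∀ {P} → Linked Consecutive P → Linked Adjacent (map src P)
  sources-adjacent []           = []
  sources-adjacent [-]          = [-]
  sources-adjacent (eq ∷ linked) = (_ , ≡.refl , eq) ∷ sources-adjacent linked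

  -- Appending e after P includes the closing turn, which `polygon-odd` carries as a separate term.
  -- A polygon needs three vertices; cycles of length one or two are excluded by nondegenerate edges
  -- and `no-reversal`.
  closed-odd : ∀ e P → Linked Consecutive (e ∷ P) → tgt (final e P) ≡ src e → Unique (map src (e ∷ P)) →
    oddTurns e (P ∷ʳ e) ≡ true
  closed-odd e []          _ closed _ = ⊥-elim (edge-nondegenerate e (≡.sym closed))
  closed-odd e (f ∷ [])    (≡e ∷ _) closed _ =
    ⊥-elim (no-reversal (e , ≡.refl , ≡e) (f , ≡.refl , closed))
  closed-odd e (f ∷ g ∷ P) linked@(≡e ∷ _) closed unique =
    ≡.trans (oddTurns-∷ʳ e (f ∷ g ∷ P) e) (≡.trans (≡.cong₂ _xor_
        (≡.trans (≡.sym (turn-sources e f (g ∷ P) linked))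
          (≡.cong (λ v → turn (position (src e)) (position (src f)) (map position (map src (g ∷ P)) ∷ʳ position v)) closed))
        (≡.cong₂ χ
          (≡.cong₂ (λ u v → position v ⊖ position u) (≡.sym (final-map src g P)) closed)
          (≡.cong (λ v → position v ⊖ position (src e)) ≡e)))
      (polygon-odd (src e) (src f) (src g) (map src P) (sources-adjacent linked)
        (final g P , ≡.sym (final-map src g P) , closed) unique))

  NotParallel : Edge → Set ℓ₁
  NotParallel e = ¬ h (vector e) ≈ 0#

  sign-pos : ∀ {x} → 0# < x → sign x ≡ 1ℤ
  sign-pos {x} 0<x with compare x 0#
  ... | tri< x<0 _ _ = ⊥-elim (asym 0<x x<0)
  ... | tri≈ _ x≈0 _ = ⊥-elim (pos⇒≉0 0<x x≈0)
  ... | tri> _ _ _   = ≡.refl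

  sign-neg : ∀ {x} → 0# < - x → sign x ≡ -1ℤ
  sign-neg {x} 0<-x with compare x 0#
  ... | tri< _ _ _   = ≡.refl
  ... | tri≈ _ x≈0 _ = ⊥-elim (pos⇒≉0 0<-x (trans (-‿cong x≈0) -0#≈0#))
  ... | tri> _ _ 0<x = ⊥-elim (¬pos-pos 0<x 0<-x)

  private
    agreement : ℤ → ℤ → ℤ → ℤ
    agreement x y z = if does (x ℤ.≟ y ×-dec y ℤ.≟ z) then x else 0ℤ

    agreement-≢ : ∀ x {y z} → y ≢ z → agreement x y z ≡ 0ℤ
    agreement-≢ x {y} {z} y≢z =
      ≡.cong (λ b → if b then x else 0ℤ) (dec-false (x ℤ.≟ y ×-dec y ℤ.≟ z) (y≢z ∘ proj₂))

    agreement-1 : ∀ x → negOnePow (agreement (sign x) 1ℤ 1ℤ) ≡ sgn (does (0# <? x))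
    agreement-1 x with compare x 0#
    ... | tri< z _ _ = ≡.cong sgn (≡.sym (nonpositive (neg⇒pos- z)))
    ... | tri≈ _ z _ = ≡.cong sgn (≡.sym (dec-false (0# <? x) (λ 0<z → pos⇒≉0 0<z z)))
    ... | tri> _ _ z = ≡.cong sgn (≡.sym (positive z))

    agreement-neg1 : ∀ x y → y ≈ - x → negOnePow (agreement (sign x) -1ℤ -1ℤ) ≡ sgn (does (0# <? y))
    agreement-neg1 x y y≈-x with compare x 0#
    ... | tri< z _ _ = ≡.cong sgn (≡.sym (positive (pos-resp (sym y≈-x) (neg⇒pos- z))))
    ... | tri≈ _ z _ = ≡.cong sgn (≡.sym (dec-false (0# <? y) (λ 0<y →
      pos⇒≉0 0<y (trans y≈-x (trans (-‿cong z) -0#≈0#)))))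
    ... | tri> _ _ z = ≡.cong sgn (≡.sym (nonpositive
      (pos-resp (trans (sym (-‿involutive x)) (-‿cong (sym y≈-x))) z)))

  windPair-agreement : ∀ e f {y z} → s (vector e) direction ≡ y → s direction (vector f) ≡ z →
    windPair e f ≡ agreement (sign (cross (vector e) (vector f))) y z
  windPair-agreement e f ≡.refl ≡.refl = ≡.refl

  -- The three orientations agree and are nonzero exactly when the short turn from e to f sweeps
  -- over the gauge direction, which is what χ detects. Non-parallel edges lie strictly to one side
  -- of it, leaving four cases.
  windPair-parity : ∀ e f → NotParallel e → NotParallel f →
    negOnePow (windPair e f) ≡ sgn (χ (vector e) (vector f))
  windPair-parity e f e∦ f∦ = cases (vector e) (vector f) (windPair-agreement e f) (pos⊎neg e∦) (pos⊎neg f∦)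
    where
    cases : ∀ p q {i} → (∀ {y z} → s p direction ≡ y → s direction q ≡ z → i ≡ agreement (sign (cross p q)) y z) →
      0# < h p ⊎ 0# < - h p → 0# < h q ⊎ 0# < - h q → negOnePow i ≡ sgn (χ p q)
    cases p q agree (inj₁ x) (inj₁ y) = ≡.trans
      (≡.cong negOnePow (≡.trans (agree (sign-pos x) (sign-neg (anti-pos {q} {direction} y)))
        (agreement-≢ (sign (cross p q)) {1ℤ} { -1ℤ} λ ())))
      (≡.cong sgn (≡.sym (χ-right-right {p} {q} (inj₁ x) (inj₁ y))))
    cases p q agree (inj₂ x) (inj₂ y) = ≡.trans
      (≡.cong negOnePow (≡.trans (agree (sign-neg x) (sign-pos (anti-neg {q} {direction} y)))
        (agreement-≢ (sign (cross p q)) { -1ℤ} {1ℤ} λ ())))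
      (≡.cong sgn (≡.sym (χ-left-left {p} {q} (inj₁ x) (inj₁ y))))
    cases p q agree (inj₁ x) (inj₂ y) = ≡.trans
      (≡.trans (≡.cong negOnePow (agree (sign-pos x) (sign-pos (anti-neg {q} {direction} y))))
        (agreement-1 (cross p q)))
      (≡.cong sgn (≡.sym (χ-right-left {p} {q} (inj₁ x) (inj₁ y))))
    cases p q agree (inj₂ x) (inj₁ y) = ≡.trans
      (≡.trans (≡.cong negOnePow (agree (sign-neg x) (sign-neg (anti-pos {q} {direction} y))))
        (agreement-neg1 (cross p q) (cross q p) (cross-anti p q)))
      (≡.cong sgn (≡.sym (χ-left-right {p} {q} (inj₁ x) (inj₁ y))))

negOnePow-split : ∀ w v i j →
  negOnePow (w ℤ.+ v ℤ.+ (+ (i ℕ.+ j))) ≡ -1ℤ ℤ.^ i ℤ.* negOnePow w ℤ.* negOnePow (v ℤ.+ (+ j))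
negOnePow-split w v i j = begin
  negOnePow (w ℤ.+ v ℤ.+ (+ (i ℕ.+ j))) ≡⟨ negOnePow-+ (w ℤ.+ v) (+ (i ℕ.+ j)) ⟩
  negOnePow (w ℤ.+ v) ℤ.* -1ℤ ℤ.^ (i ℕ.+ j)
    ≡⟨ ≡.cong₂ ℤ._*_ (negOnePow-+ w v) (ℤ.^-distribˡ-+-* -1ℤ i j) ⟩
  negOnePow w ℤ.* negOnePow v ℤ.* (-1ℤ ℤ.^ i ℤ.* -1ℤ ℤ.^ j)
    ≡⟨ solve 4 (λ a b c d → a :* b :* (c :* d) := c :* a :* (b :* d))
        ≡.refl (negOnePow w) (negOnePow v) (-1ℤ ℤ.^ i) (-1ℤ ℤ.^ j) ⟩
  -1ℤ ℤ.^ i ℤ.* negOnePow w ℤ.* (negOnePow v ℤ.* -1ℤ ℤ.^ j)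
    ≡⟨ ≡.cong (-1ℤ ℤ.^ i ℤ.* negOnePow w ℤ.*_) (negOnePow-+ v (+ j)) ⟨
  -1ℤ ℤ.^ i ℤ.* negOnePow w ℤ.* negOnePow (v ℤ.+ (+ j)) ∎
  where
  open ≡.≡-Reasoning
  open +-*-Solver

xorAll : ∀ {A : Set} → (A → Bool) → List A → Bool
xorAll p = List.foldr (λ x b → p x xor b) false

filter-parity : ∀ {A : Set} {ℓ} {P : A → Set ℓ} (P? : ∀ x → Dec (P x)) (p q : A → Bool) →
  (∀ x → does (P? x) ≡ p x xor q x) → ∀ xs →
  -1ℤ ℤ.^ length (filter P? xs) ≡ sgn (xorAll p xs) ℤ.* sgn (xorAll q xs)
filter-parity P? p q eq [] = ≡.refl
filter-parity P? p q eq (x ∷ xs) =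
  ≡.trans step (≡.trans (≡.cong₂ ℤ._*_ (≡.trans (≡.cong sgn (eq x)) (sgn-xor (p x) (q x))) (filter-parity P? p q eq xs))
    (≡.trans (interchange (sgn (p x)) (sgn (q x)) _ _) (≡.sym (≡.cong₂ ℤ._*_ (sgn-xor (p x) _) (sgn-xor (q x) _)))))
  where
  open +-*-Solver
  interchange : ∀ a b c d → a ℤ.* b ℤ.* (c ℤ.* d) ≡ a ℤ.* c ℤ.* (b ℤ.* d)
  interchange = solve 4 (λ a b c d → a :* b :* (c :* d) := a :* c :* (b :* d)) ≡.refl
  step : -1ℤ ℤ.^ length (filter P? (x ∷ xs)) ≡ sgn (does (P? x)) ℤ.* -1ℤ ℤ.^ length (filter P? xs)
  step with does (P? x)
  ... | true  = ≡.refl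
  ... | false = ≡.sym (ℤ.*-identityˡ _)

module CycleSigns {c ℓ₁ ℓ₂} {𝕂 : OrderedField c ℓ₁ ℓ₂} {k n : ℕ} (G : PlabicGraph 𝕂 k n) (𝔩 : GaugeRayDirection G) where
  open OrderedField 𝕂
  open Plane 𝕂
  open OrderedFieldProperties 𝕂
  open Turning 𝕂
  open RayCrossing 𝕂
  open PlabicGraph G
  open GaugeRayDirection 𝔩
  open Planarity G using (Inner)
  open Cycles G 𝔩
  open Crossing direction axis 0<l×a
  open +-*-Solver

  τ : Edge → Edge → ℤ
  τ e f = negOnePow (windPair e f)

  ι : Edge → ℤ
  ι e = -1ℤ ℤ.^ intEdge e

  pathSign-∷∷ : ∀ e f P → pathSign (e ∷ f ∷ P) ≡ ι e ℤ.* τ e f ℤ.* pathSign (f ∷ P)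
  pathSign-∷∷ e f P = negOnePow-split (windPair e f) (wind (f ∷ P)) (intEdge e) (int (f ∷ P))

  pathSign-[-] : ∀ e → pathSign (e ∷ []) ≡ ι e
  pathSign-[-] e = ≡.cong (-1ℤ ℤ.^_) (ℕ.+-identityʳ (intEdge e))

  pathSign-++ : ∀ g R f Q → pathSign (g ∷ R ++ f ∷ Q) ≡ pathSign (g ∷ R) ℤ.* τ (final g R) f ℤ.* pathSign (f ∷ Q)
  pathSign-++ g []      f Q = ≡.trans (pathSign-∷∷ g f Q)
    (≡.cong (λ x → x ℤ.* τ g f ℤ.* pathSign (f ∷ Q)) (≡.sym (pathSign-[-] g)))
  pathSign-++ g (r ∷ R) f Q = extend (ι g ℤ.* τ g r) (τ (final r R) f) (pathSign (f ∷ Q))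
    (pathSign-∷∷ g r (R ++ f ∷ Q)) (pathSign-++ r R f Q) (pathSign-∷∷ g r R)
    where
    extend : ∀ {x y y′ z} a c d → x ≡ a ℤ.* y → y ≡ z ℤ.* c ℤ.* d → y′ ≡ a ℤ.* z → x ≡ y′ ℤ.* c ℤ.* d
    extend {z = z} a c d ≡.refl ≡.refl ≡.refl =
      solve 4 (λ a b c d → a :* (b :* c :* d) := a :* b :* c :* d) ≡.refl a z c d

  inner-inside : ∀ j v → 0# < cross (position (inner v) ⊖ position (boundary j)) axis
  inner-inside j v = pos-resp (sym (cross-anti axis _)) (neg⇒pos- (interior j v))

  -- A point on the line of the ray that lies inside the disk lies on the ray itself, and the rays
  -- contain no internal vertex.
  off-rays : ∀ j v → ¬ cross direction (position (inner v) ⊖ position (boundary j)) ≈ 0#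
  off-rays j v eq =
    hit (on-ray direction axis 0<l×a {position (inner v) ⊖ position (boundary j)} eq (inner-inside j v))
    where
    back : ∀ {x y b} → x - b ≈ y → x ≈ b + y
    back {x} {y} {b} eq = trans (sym (trans (+-comm b (x - b)) (trans (+-assoc x (- b) b) (trans (+-congˡ (-‿inverseˡ b)) (+-identityʳ x)))))
      (+-congˡ eq)
    hit : ¬ ∃ λ t → 0# < t × position (inner v) ⊖ position (boundary j) ≋ t · direction
    hit (t , 0<t , eq₁ , eq₂) = avoids-inner j v t (inj₁ 0<t) (back eq₁ , back eq₂)

  leftParity : Vertex → Bool
  leftParity v = xorAll (λ r → leftOfRay direction axis 0<l×a (position (boundary (base r))) (position v)) (allFin k)

  -- For internal edges the intersection sign is a coboundary: it is the product of two vertex signs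
  -- that record on which sides of the source rays the ends lie. Along a path it telescopes, and
  -- around a cycle it disappears.
  ι-inner : ∀ e → Inner (src e) → Inner (tgt e) → ι e ≡ sgn (leftParity (src e)) ℤ.* sgn (leftParity (tgt e))
  ι-inner e (u , src≡) (v , tgt≡) = ≡.subst₂
    (λ x y → -1ℤ ℤ.^ length (filter (λ r → meetsRay? (position (boundary (base r))) direction (position x) (position y)) (allFin k))
               ≡ sgn (leftParity x) ℤ.* sgn (leftParity y))
    (≡.sym src≡) (≡.sym tgt≡)
    (filter-parity (λ r → meetsRay? (position (boundary (base r))) direction (position (inner u)) (position (inner v)))
      (λ r → leftOfRay direction axis 0<l×a (position (boundary (base r))) (position (inner u)))
      (λ r → leftOfRay direction axis 0<l×a (position (boundary (base r))) (position (inner v)))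
      (λ r → meets-xor direction axis 0<l×a {position (boundary (base r))} {position (inner u)} {position (inner v)}
        (inner-inside (base r) u) (inner-inside (base r) v) (off-rays (base r) u) (off-rays (base r) v))
      (allFin k))

  sgn-square : ∀ b → sgn b ℤ.* sgn b ≡ 1ℤ
  sgn-square true  = ≡.refl
  sgn-square false = ≡.refl

  private
    successor-inner : ∀ {e f P} → Linked Consecutive (e ∷ f ∷ P) → All (Inner ∘ src) (e ∷ f ∷ P) → Inner (tgt e)
    successor-inner (≡e ∷ _) (_ ∷ (u , eq) ∷ _) = u , ≡.trans ≡e eq

  int-telescope : ∀ e P → Linked Consecutive (e ∷ P) → All (Inner ∘ src) (e ∷ P) → Inner (tgt (final e P)) →
    -1ℤ ℤ.^ int (e ∷ P) ≡ sgn (leftParity (src e)) ℤ.* sgn (leftParity (tgt (final e P)))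
  int-telescope e []      _ (inner₁ ∷ _) inner₂ =
    ≡.trans (≡.cong (-1ℤ ℤ.^_) (ℕ.+-identityʳ (intEdge e))) (ι-inner e inner₁ inner₂)
  int-telescope e (f ∷ P) linked@(≡e ∷ linked′) inners@(inner₁ ∷ inners′) inner₂ =
    ≡.trans (ℤ.^-distribˡ-+-* -1ℤ (intEdge e) (int (f ∷ P)))
      (≡.trans (≡.cong₂ ℤ._*_ (≡.trans (ι-inner e inner₁ (successor-inner linked inners))
          (≡.cong (λ v → sgn (leftParity (src e)) ℤ.* sgn (leftParity v)) ≡e)) (int-telescope f P linked′ inners′ inner₂))
        (telescope (sgn (leftParity (src e))) (leftParity (src f)) _))
    where
    telescope : ∀ x b y → x ℤ.* sgn b ℤ.* (sgn b ℤ.* y) ≡ x ℤ.* y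
    telescope x b y = ≡.trans (solve 3 (λ x b y → x :* b :* (b :* y) := x :* (b :* b) :* y) ≡.refl x (sgn b) y)
      (≡.cong (ℤ._* y) (≡.trans (≡.cong (x ℤ.*_) (sgn-square b)) (ℤ.*-identityʳ x)))

  inner⇒notParallel : ∀ e → Inner (src e) → Inner (tgt e) → NotParallel e
  inner⇒notParallel e (_ , src≡) (_ , tgt≡) = not-parallel e src≡ tgt≡

  inners⇒notParallel : ∀ e P → Linked Consecutive (e ∷ P) → All (Inner ∘ src) (e ∷ P) → Inner (tgt (final e P)) →
    All NotParallel (e ∷ P)
  inners⇒notParallel e [] _ (i ∷ _) i′ = inner⇒notParallel e i i′ ∷ []
  inners⇒notParallel e (f ∷ P) linked@(_ ∷ linked′) inners@(i ∷ inners′) i′ =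
    inner⇒notParallel e i (successor-inner linked inners) ∷ inners⇒notParallel f P linked′ inners′ i′

  wind-parity : ∀ e P → All NotParallel (e ∷ P) → negOnePow (wind (e ∷ P)) ≡ sgn (oddTurns e P)
  wind-parity e []      _ = ≡.refl
  wind-parity e (f ∷ P) (e∦ ∷ ∦s@(f∦ ∷ _)) = ≡.trans (negOnePow-+ (windPair e f) (wind (f ∷ P)))
    (≡.trans (≡.cong₂ ℤ._*_ (windPair-parity e f e∦ f∦) (wind-parity f P ∦s))
      (≡.sym (sgn-xor (χ (vector e) (vector f)) (oddTurns f P))))

  -- The sign of a path omits the turn from its last edge back to its first, hence the extra factor.
  -- The intersections contribute 1 because they telescope to a square, so only the odd number of
  -- turns across the gauge direction is left.
  cycle-sign : ∀ e P → Linked Consecutive (e ∷ P) → tgt (final e P) ≡ src e → Unique (map src (e ∷ P)) →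
    All (Inner ∘ src) (e ∷ P) → pathSign (e ∷ P) ℤ.* τ (final e P) e ≡ -1ℤ
  cycle-sign e P linked closed unique inners@(i ∷ _) = begin
    pathSign (e ∷ P) ℤ.* τ z e
      ≡⟨ ≡.cong (ℤ._* τ z e) (negOnePow-+ (wind (e ∷ P)) (+ int (e ∷ P))) ⟩
    negOnePow (wind (e ∷ P)) ℤ.* -1ℤ ℤ.^ int (e ∷ P) ℤ.* τ z e
      ≡⟨ ≡.cong₂ ℤ._*_ (≡.cong₂ ℤ._*_ (wind-parity e P ∦s)
          (≡.trans (int-telescope e P linked inners i′)
          (≡.trans (≡.cong (λ v → sgn (leftParity (src e)) ℤ.* sgn (leftParity v)) closed)
          (sgn-square (leftParity (src e))))))
          (windPair-parity z e (All.lookup ∦s (final∈ e P)) (All.head ∦s)) ⟩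
    sgn (oddTurns e P) ℤ.* 1ℤ ℤ.* sgn (χ (vector z) (vector e))
      ≡⟨ ≡.cong (ℤ._* sgn (χ (vector z) (vector e))) (ℤ.*-identityʳ (sgn (oddTurns e P))) ⟩
    sgn (oddTurns e P) ℤ.* sgn (χ (vector z) (vector e))
      ≡⟨ sgn-xor (oddTurns e P) (χ (vector z) (vector e)) ⟨
    sgn (oddTurns e P xor χ (vector z) (vector e)) ≡⟨ ≡.cong sgn (oddTurns-∷ʳ e P e) ⟨
    sgn (oddTurns e (P ∷ʳ e))
      ≡⟨ ≡.cong sgn (closed-odd e P linked closed unique) ⟩
    -1ℤ ∎
    where
    open ≡.≡-Reasoning
    z = final e P
    i′ : Inner (tgt z)
    i′ = proj₁ i , ≡.trans closed (proj₂ i)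
    ∦s = inners⇒notParallel e P linked inners i′

-- Power series and their evaluation

module Summation where
  open ≡ using (refl; sym; trans; cong; cong₂)

  -- Only the Boolean of the decision enters, so decisions of equivalent propositions may be
  -- exchanged.
  guard : ∀ {p} {P : Set p} → Dec P → ℤ → ℤ
  guard d z = if does d then z else 0ℤ

  guard-yes : ∀ {p} {P : Set p} (d : Dec P) {z} → P → guard d z ≡ z
  guard-yes d {z} p = cong (λ b → if b then z else 0ℤ) (dec-true d p)

  guard-no : ∀ {p} {P : Set p} (d : Dec P) {z} → ¬ P → guard d z ≡ 0ℤ
  guard-no d {z} ¬p = cong (λ b → if b then z else 0ℤ) (dec-false d ¬p)

  guard-⇔ : ∀ {p q} {P : Set p} {Q : Set q} (d : Dec P) (d′ : Dec Q) {z} →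
    (P → Q) → (Q → P) → guard d z ≡ guard d′ z
  guard-⇔ d d′ {z} to from = cong (λ b → if b then z else 0ℤ) (does-⇔ (mk⇔ to from) d d′)

  guard-cong : ∀ {p} {P : Set p} (d : Dec P) {x y} → (P → x ≡ y) → guard d x ≡ guard d y
  guard-cong (yes p) eq = eq p
  guard-cong (no _)  eq = refl

  guard-0 : ∀ {p} {P : Set p} (d : Dec P) → guard d 0ℤ ≡ 0ℤ
  guard-0 (yes _) = refl
  guard-0 (no _)  = refl

  guard-zero : ∀ {p} {P : Set p} (d : Dec P) {x} → x ≡ 0ℤ → guard d x ≡ 0ℤ
  guard-zero d x≡0 = trans (cong (guard d) x≡0) (guard-0 d)

  guard-+ : ∀ {p} {P : Set p} (d : Dec P) x y → guard d (x ℤ.+ y) ≡ guard d x ℤ.+ guard d y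
  guard-+ (yes _) x y = refl
  guard-+ (no _)  x y = refl

  guard-* : ∀ {p} {P : Set p} (d : Dec P) c x → guard d (c ℤ.* x) ≡ c ℤ.* guard d x
  guard-* (yes _) c x = refl
  guard-* (no _)  c x = sym (ℤ.*-zeroʳ c)

  guard-1 : ∀ {p} {P : Set p} (d : Dec P) x → guard d x ≡ x ℤ.* guard d 1ℤ
  guard-1 d x = trans (cong (guard d) (sym (ℤ.*-identityʳ x))) (guard-* d x 1ℤ)

  guard-× : ∀ {p q} {P : Set p} {Q : Set q} (d : Dec P) (d′ : Dec Q) x → guard (d ×-dec d′) x ≡ guard d (guard d′ x)
  guard-× (yes _) d′ x = refl
  guard-× (no _)  d′ x = refl

  ∑ : ∀ {a} {A : Set a} → List A → (A → ℤ) → ℤ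
  ∑ xs f = sumℤ (map f xs)

  module _ {a} {A : Set a} where
    ∑-cong-All : ∀ {f g : A → ℤ} {xs} → All (λ x → f x ≡ g x) xs → ∑ xs f ≡ ∑ xs g
    ∑-cong-All []         = refl
    ∑-cong-All (eq ∷ eqs) = cong₂ ℤ._+_ eq (∑-cong-All eqs)

    ∑-cong : ∀ {f g : A → ℤ} xs → (∀ x → f x ≡ g x) → ∑ xs f ≡ ∑ xs g
    ∑-cong xs eq = cong sumℤ (List.map-cong eq xs)

    ∑-zero : ∀ {f : A → ℤ} {xs} → All (λ x → f x ≡ 0ℤ) xs → ∑ xs f ≡ 0ℤ
    ∑-zero []         = refl
    ∑-zero (eq ∷ eqs) = cong₂ ℤ._+_ eq (∑-zero eqs)

    ∑-+ : ∀ (f g : A → ℤ) xs → ∑ xs (λ x → f x ℤ.+ g x) ≡ ∑ xs f ℤ.+ ∑ xs g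
    ∑-+ f g []       = refl
    ∑-+ f g (x ∷ xs) = trans (cong (ℤ._+_ (f x ℤ.+ g x)) (∑-+ f g xs))
      (solve 4 (λ a b c d → a :+ b :+ (c :+ d) := a :+ c :+ (b :+ d)) refl (f x) (g x) (∑ xs f) (∑ xs g))
      where open +-*-Solver

    ∑-* : ∀ c (f : A → ℤ) xs → ∑ xs (λ x → c ℤ.* f x) ≡ c ℤ.* ∑ xs f
    ∑-* c f []       = sym (ℤ.*-zeroʳ c)
    ∑-* c f (x ∷ xs) = trans (cong (ℤ._+_ (c ℤ.* f x)) (∑-* c f xs)) (sym (ℤ.*-distribˡ-+ c (f x) (∑ xs f)))

    ∑-++ : ∀ (f : A → ℤ) xs ys → ∑ (xs ++ ys) f ≡ ∑ xs f ℤ.+ ∑ ys f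
    ∑-++ f []       ys = sym (ℤ.+-identityˡ _)
    ∑-++ f (x ∷ xs) ys = trans (cong (ℤ._+_ (f x)) (∑-++ f xs ys)) (sym (ℤ.+-assoc (f x) (∑ xs f) (∑ ys f)))

    ∑-filter : ∀ {p} {P : A → Set p} (P? : ∀ x → Dec (P x)) (f : A → ℤ) xs →
      ∑ (filter P? xs) f ≡ ∑ xs (λ x → guard (P? x) (f x))
    ∑-filter P? f [] = refl
    ∑-filter P? f (x ∷ xs) with does (P? x)
    ... | true  = cong (ℤ._+_ (f x)) (∑-filter P? f xs)
    ... | false = trans (∑-filter P? f xs) (sym (ℤ.+-identityˡ _))

    ∑-single : ∀ {f : A → ℤ} {xs x} → Unique xs → x ∈ xs → (∀ {y} → y ∈ xs → y ≢ x → f y ≡ 0ℤ) → ∑ xs f ≡ f x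
    ∑-single {f} {x ∷ xs} (x∉xs ∷ _) (here refl) others =
      trans (cong (ℤ._+_ (f x)) (∑-zero (All.tabulate (λ y∈ → others (there y∈) (All.lookup x∉xs y∈ ∘ sym))))) (ℤ.+-identityʳ (f x))
    ∑-single {f} {y ∷ xs} (y∉xs ∷ unique) (there x∈xs) others =
      trans (cong₂ ℤ._+_ (others (here refl) (All.lookup y∉xs x∈xs)) (∑-single unique x∈xs (others ∘ there))) (ℤ.+-identityˡ _)

    ∑-pair : ∀ {f : A → ℤ} {xs x y} → Unique xs → x ∈ xs → y ∈ xs → x ≢ y →
      (∀ z → z ≢ x → z ≢ y → f z ≡ 0ℤ) → ∑ xs f ≡ f x ℤ.+ f y
    ∑-pair _ (here refl) (here refl) x≢y _ = ⊥-elim (x≢y refl)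
    ∑-pair {f} {x ∷ xs} (x∉xs ∷ unique) (here refl) (there y∈xs) _ others =
      cong (ℤ._+_ (f x)) (∑-single unique y∈xs (λ z∈ → others _ (All.lookup x∉xs z∈ ∘ sym)))
    ∑-pair {f} {y ∷ xs} {x} (y∉xs ∷ unique) (there x∈xs) (here refl) _ others =
      trans (cong (ℤ._+_ (f y)) (∑-single unique x∈xs (λ z∈ z≢x → others _ z≢x (All.lookup y∉xs z∈ ∘ sym))))
        (ℤ.+-comm (f y) (f x))
    ∑-pair {f} {z ∷ xs} {x} {y} (z∉xs ∷ unique) (there x∈xs) (there y∈xs) x≢y others =
      trans (cong₂ ℤ._+_ (others z (All.lookup z∉xs x∈xs) (All.lookup z∉xs y∈xs)) (∑-pair unique x∈xs y∈xs x≢y others))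
        (ℤ.+-identityˡ _)

  ∑-map : ∀ {a b} {A : Set a} {B : Set b} (g : A → B) (f : B → ℤ) xs → ∑ (map g xs) f ≡ ∑ xs (f ∘ g)
  ∑-map g f xs = cong sumℤ (sym (List.map-∘ xs))

  ∑-guard : ∀ {p a} {P : Set p} {A : Set a} (d : Dec P) (f : A → ℤ) xs →
    ∑ xs (λ x → guard d (f x)) ≡ guard d (∑ xs f)
  ∑-guard (yes _) f xs = refl
  ∑-guard (no _)  f xs = ∑-zero (All.universal (λ _ → refl) xs)

  ∑-concatMap : ∀ {a b} {A : Set a} {B : Set b} (g : A → List B) (f : B → ℤ) xs →
    ∑ (concatMap g xs) f ≡ ∑ xs (λ x → ∑ (g x) f)
  ∑-concatMap g f []       = refl
  ∑-concatMap g f (x ∷ xs) = trans (∑-++ f (g x) (concatMap g xs)) (cong (ℤ._+_ (∑ (g x) f)) (∑-concatMap g f xs))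

  ∑-swap : ∀ {a b} {A : Set a} {B : Set b} (f : A → B → ℤ) xs ys →
    ∑ xs (λ x → ∑ ys (f x)) ≡ ∑ ys (λ y → ∑ xs (λ x → f x y))
  ∑-swap f []       ys = sym (∑-zero (All.universal (λ _ → refl) ys))
  ∑-swap f (x ∷ xs) ys = trans (cong (ℤ._+_ (∑ ys (f x))) (∑-swap f xs ys))
    (sym (∑-+ (f x) (λ y → ∑ xs (λ x → f x y)) ys))

module PowerSeries where
  open Summation
  open ≡ using (refl; sym; trans; cong; cong₂; module ≡-Reasoning)

  infixr 6 _⊞_
  _⊞_ : ∀ {E} → Exponent E → Exponent E → Exponent E
  _⊞_ = zipWith ℕ._+_

  ⊞-assoc : ∀ {E} (α β γ : Exponent E) → (α ⊞ β) ⊞ γ ≡ α ⊞ (β ⊞ γ)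
  ⊞-assoc = Vec.zipWith-assoc ℕ.+-assoc

  ⊞-comm : ∀ {E} (α β : Exponent E) → α ⊞ β ≡ β ⊞ α
  ⊞-comm = Vec.zipWith-comm ℕ.+-comm

  ⊞-cancel : ∀ {E} (α : Exponent E) {β γ} → α ⊞ β ≡ α ⊞ γ → β ≡ γ
  ⊞-cancel []      {[]}    {[]}    _  = refl
  ⊞-cancel (a ∷ α) {b ∷ β} {c ∷ γ} eq with Vec.∷-injective eq
  ... | eq₁ , eq₂ = cong₂ _∷_ (ℕ.+-cancelˡ-≡ a b c eq₁) (⊞-cancel α eq₂)

  ⊞-∸ : ∀ {E} (α β : Exponent E) → zipWith ℕ._∸_ (α ⊞ β) α ≡ β
  ⊞-∸ []      []      = refl
  ⊞-∸ (a ∷ α) (b ∷ β) = cong₂ _∷_ (ℕ.m+n∸m≡n a b) (⊞-∸ α β)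

  Divides : ∀ {E} → Exponent E → Exponent E → Set
  Divides α μ = ∃ λ ν → α ⊞ ν ≡ μ

  divides? : ∀ {E} (α μ : Exponent E) → Dec (Divides α μ)
  divides? α μ = map′ (zipWith ℕ._∸_ μ α ,_) (λ { (ν , refl) → cong (α ⊞_) (⊞-∸ α ν) })
    (Vec.≡-dec ℕ._≟_ (α ⊞ zipWith ℕ._∸_ μ α) μ)

  -- Multiplication by the monomial with exponent α. The truncated difference is read only where it
  -- is a true difference.
  shift : ∀ {E} → Exponent E → Series E → Series E
  shift α f μ = guard (divides? α μ) (f (zipWith ℕ._∸_ μ α))

  shift-yes : ∀ {E} (α : Exponent E) f ν → shift α f (α ⊞ ν) ≡ f ν
  shift-yes α f ν = trans (guard-yes (divides? α (α ⊞ ν)) (ν , refl)) (cong f (⊞-∸ α ν))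

  shift-no : ∀ {E} (α : Exponent E) f {μ} → ¬ Divides α μ → shift α f μ ≡ 0ℤ
  shift-no α f {μ} = guard-no (divides? α μ)

  shift-cong : ∀ {E} (α : Exponent E) {f g} → f ≗ g → shift α f ≗ shift α g
  shift-cong α f≗g μ = cong (guard (divides? α μ)) (f≗g _)

  shift-+ : ∀ {E} (α : Exponent E) f g μ → shift α (λ ν → f ν ℤ.+ g ν) μ ≡ shift α f μ ℤ.+ shift α g μ
  shift-+ α f g μ = guard-+ (divides? α μ) _ _

  shift-* : ∀ {E} (α : Exponent E) c f μ → shift α (λ ν → c ℤ.* f ν) μ ≡ c ℤ.* shift α f μ
  shift-* α c f μ = guard-* (divides? α μ) c _

  shift-∑ : ∀ {E a} {A : Set a} (α : Exponent E) (f : A → Series E) xs μ →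
    shift α (λ ν → ∑ xs (λ x → f x ν)) μ ≡ ∑ xs (λ x → shift α (f x) μ)
  shift-∑ α f []       μ = guard-0 (divides? α μ)
  shift-∑ α f (x ∷ xs) μ = trans (shift-+ α (f x) (λ ν → ∑ xs (λ x → f x ν)) μ)
    (cong (ℤ._+_ (shift α (f x) μ)) (shift-∑ α f xs μ))

  shift-shift : ∀ {E} (α β : Exponent E) f → shift α (shift β f) ≗ shift (α ⊞ β) f
  shift-shift α β f μ with divides? (α ⊞ β) μ | divides? α μ
  ... | yes (ν , refl) | _ = trans (cong (shift α (shift β f)) (⊞-assoc α β ν)) (trans (shift-yes α (shift β f) (β ⊞ ν))
          (trans (shift-yes β f ν) (sym (shift-yes (α ⊞ β) f ν))))
  ... | no ¬αβ | no ¬α = trans (shift-no α (shift β f) ¬α) (sym (shift-no (α ⊞ β) f ¬αβ))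
  ... | no ¬αβ | yes (ν , refl) = trans (shift-yes α (shift β f) ν)
          (trans (shift-no β f λ { (ρ , refl) → ¬αβ (ρ , ⊞-assoc α β ρ) }) (sym (shift-no (α ⊞ β) f ¬αβ)))

  shift-comm : ∀ {E} (α β : Exponent E) f → shift α (shift β f) ≗ shift β (shift α f)
  shift-comm α β f μ = trans (shift-shift α β f μ)
    (trans (cong (λ γ → shift γ f μ) (⊞-comm α β)) (sym (shift-shift β α f μ)))

  -- The product of a polynomial and a series, expanded along the terms of the polynomial; `⊛-act`
  -- identifies it with the convolution. In this form associativity and commutativity of products
  -- come down to the commutation of shifts, with no nested convolutions.
  act : ∀ {E} → Polynomial E → Series E → Series E
  act q f μ = ∑ q (λ (a , α) → a ℤ.* shift α f μ)

  act-cong : ∀ {E} (q : Polynomial E) {f g} → f ≗ g → act q f ≗ act q g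
  act-cong q f≗g μ = ∑-cong q (λ (a , α) → cong (ℤ._*_ a) (shift-cong α f≗g μ))

  act-+ : ∀ {E} (q : Polynomial E) f g μ → act q (λ ν → f ν ℤ.+ g ν) μ ≡ act q f μ ℤ.+ act q g μ
  act-+ q f g μ = trans (∑-cong q (λ (a , α) → trans (cong (ℤ._*_ a) (shift-+ α f g μ)) (ℤ.*-distribˡ-+ a _ _)))
    (∑-+ (λ (a , α) → a ℤ.* shift α f μ) (λ (a , α) → a ℤ.* shift α g μ) q)

  act-* : ∀ {E} (q : Polynomial E) c f μ → act q (λ ν → c ℤ.* f ν) μ ≡ c ℤ.* act q f μ
  act-* q c f μ = trans (∑-cong q (λ (a , α) → trans (cong (ℤ._*_ a) (shift-* α c f μ)) (commute a c _)))
    (∑-* c (λ (a , α) → a ℤ.* shift α f μ) q)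
    where
    commute : ∀ a c x → a ℤ.* (c ℤ.* x) ≡ c ℤ.* (a ℤ.* x)
    commute = solve 3 (λ a c x → a :* (c :* x) := c :* (a :* x)) refl
      where open +-*-Solver

  act-∑ : ∀ {E a} {A : Set a} (q : Polynomial E) (f : A → Series E) xs μ →
    act q (λ ν → ∑ xs (λ x → f x ν)) μ ≡ ∑ xs (λ x → act q (f x) μ)
  act-∑ q f xs μ = trans (∑-cong q (λ (a , α) → trans (cong (ℤ._*_ a) (shift-∑ α f xs μ)) (sym (∑-* a _ xs))))
    (∑-swap (λ (a , α) x → a ℤ.* shift α (f x) μ) q xs)

  shift-act : ∀ {E} (β : Exponent E) q f → shift β (act q f) ≗ act q (shift β f)
  shift-act β q f μ = trans (shift-∑ β (λ (a , α) ν → a ℤ.* shift α f ν) q μ)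
    (∑-cong q (λ (a , α) → trans (shift-* β a (shift α f) μ) (cong (ℤ._*_ a) (shift-comm β α f μ))))

  act-comm : ∀ {E} (p q : Polynomial E) f → act p (act q f) ≗ act q (act p f)
  act-comm p q f μ = trans (∑-cong p (λ (a , α) →
      trans (cong (ℤ._*_ a) (shift-act α q f μ)) (sym (act-* q a (shift α f) μ))))
    (sym (act-∑ q (λ (a , α) ν → a ℤ.* shift α f ν) p μ))

  _≟ᵉ_ : ∀ {E} (α β : Exponent E) → Dec (α ≡ β)
  _≟ᵉ_ = Vec.≡-dec ℕ._≟_

  toSeries-∑ : ∀ {E} (p : Polynomial E) μ → toSeries p μ ≡ ∑ p (λ (a , α) → guard (α ≟ᵉ μ) a)
  toSeries-∑ p μ = ∑-filter (λ term → Vec.≡-dec ℕ._≟_ (proj₂ term) μ) proj₁ p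

  below-divides : ∀ {E} (μ : Exponent E) → All (λ β → Divides β μ) (below μ)
  below-divides []      = ([] , refl) ∷ []
  below-divides (m ∷ μ) = All.concat⁺ (All.map⁺ (All.map (λ {a} a<1+m → All.map⁺ (All.map
    (λ (ν , eq) → m ℕ.∸ a ∷ ν , cong₂ _∷_ (ℕ.m+[n∸m]≡n (ℕ.≤-pred a<1+m)) eq) (below-divides μ))) (All.all-upTo (suc m))))

  ∑-below : ∀ {E} (α ν : Exponent E) (f : Series E) → ∑ (below (α ⊞ ν)) (λ β → guard (α ≟ᵉ β) (f β)) ≡ f α
  ∑-below []      []      f = trans (ℤ.+-identityʳ _) refl
  ∑-below (a ∷ α) (b ∷ ν) f = begin
    ∑ (concatMap (λ c → map (c ∷_) (below (α ⊞ ν))) (upTo (suc (a ℕ.+ b)))) g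
      ≡⟨ ∑-concatMap (λ c → map (c ∷_) (below (α ⊞ ν))) g (upTo (suc (a ℕ.+ b))) ⟩
    ∑ (upTo (suc (a ℕ.+ b))) (λ c → ∑ (map (c ∷_) (below (α ⊞ ν))) g)
      ≡⟨ ∑-cong (upTo (suc (a ℕ.+ b))) (λ c → ∑-map (c ∷_) g (below (α ⊞ ν))) ⟩
    ∑ (upTo (suc (a ℕ.+ b))) (λ c → ∑ (below (α ⊞ ν)) (λ β → g (c ∷ β)))
      ≡⟨ ∑-single (Unique.upTo⁺ _) (∈-upTo⁺ (s≤s (ℕ.m≤m+n a b))) (λ {c} _ → others c) ⟩
    ∑ (below (α ⊞ ν)) (λ β → g (a ∷ β))
      ≡⟨ ∑-cong (below (α ⊞ ν)) (λ β → guard-⇔ ((a ∷ α) ≟ᵉ (a ∷ β)) (α ≟ᵉ β) Vec.∷-injectiveʳ (cong (a ∷_))) ⟩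
    ∑ (below (α ⊞ ν)) (λ β → guard (α ≟ᵉ β) (f (a ∷ β))) ≡⟨ ∑-below α ν (f ∘ (a ∷_)) ⟩
    f (a ∷ α) ∎
    where
    open ≡-Reasoning
    g = λ β → guard ((a ∷ α) ≟ᵉ β) (f β)
    others : ∀ c → c ≢ a → ∑ (below (α ⊞ ν)) (λ β → g (c ∷ β)) ≡ 0ℤ
    others c c≢a = ∑-zero (All.universal (λ β → guard-no ((a ∷ α) ≟ᵉ (c ∷ β)) (λ eq → c≢a (sym (Vec.∷-injectiveˡ eq)))) (below (α ⊞ ν)))

  -- Expanding `toSeries q` gives a double sum in which a term of exponent α keeps only the
  -- splitting β = α. That splitting occurs once among those below μ if α divides μ, and not at all
  -- otherwise.
  ⊛-act : ∀ {E} (q : Polynomial E) f → toSeries q ⊛ f ≗ act q f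
  ⊛-act q f μ = begin
    ∑ (below μ) (λ β → toSeries q β ℤ.* f (μ ⊟ β))
      ≡⟨ ∑-cong (below μ) (λ β → cong (ℤ._* f (μ ⊟ β)) (toSeries-∑ q β)) ⟩
    ∑ (below μ) (λ β → ∑ q (λ (a , α) → guard (α ≟ᵉ β) a) ℤ.* f (μ ⊟ β))
      ≡⟨ ∑-cong (below μ) (λ β → trans (ℤ.*-comm _ (f (μ ⊟ β))) (sym (∑-* (f (μ ⊟ β)) _ q))) ⟩
    ∑ (below μ) (λ β → ∑ q (λ (a , α) → f (μ ⊟ β) ℤ.* guard (α ≟ᵉ β) a))
      ≡⟨ ∑-swap (λ β (a , α) → f (μ ⊟ β) ℤ.* guard (α ≟ᵉ β) a) (below μ) q ⟩
    ∑ q (λ (a , α) → ∑ (below μ) (λ β → f (μ ⊟ β) ℤ.* guard (α ≟ᵉ β) a))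
      ≡⟨ ∑-cong q (λ (a , α) → term a α) ⟩
    ∑ q (λ (a , α) → a ℤ.* shift α f μ) ∎
    where
    open ≡-Reasoning
    _⊟_ = zipWith ℕ._∸_
    commute : ∀ {p} {P : Set p} (d : Dec P) a x → x ℤ.* guard d a ≡ a ℤ.* guard d x
    commute d a x with does d
    ... | true  = ℤ.*-comm x a
    ... | false = trans (ℤ.*-zeroʳ x) (sym (ℤ.*-zeroʳ a))
    term : ∀ a α → ∑ (below μ) (λ β → f (μ ⊟ β) ℤ.* guard (α ≟ᵉ β) a) ≡ a ℤ.* shift α f μ
    term a α = trans (∑-cong (below μ) (λ β → commute (α ≟ᵉ β) a (f (μ ⊟ β))))
      (trans (∑-* a (λ β → guard (α ≟ᵉ β) (f (μ ⊟ β))) (below μ)) (cong (ℤ._*_ a) (extract (divides? α μ))))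
      where
      extract : (d : Dec (Divides α μ)) → ∑ (below μ) (λ β → guard (α ≟ᵉ β) (f (μ ⊟ β))) ≡ guard d (f (μ ⊟ α))
      extract (yes (ν , refl)) = ∑-below α ν (λ β → f ((α ⊞ ν) ⊟ β))
      extract (no ¬α) = ∑-zero (All.map (λ {β} divides → guard-no (α ≟ᵉ β) (λ { refl → ¬α divides })) (below-divides μ))

  scale : ∀ {E} → ℤ → Exponent E → Polynomial E → Polynomial E
  scale a α = map (λ (b , β) → a ℤ.* b , α ⊞ β)

  infixl 7 _⊠_
  _⊠_ : ∀ {E} → Polynomial E → Polynomial E → Polynomial E
  q ⊠ p = concatMap (λ (a , α) → scale a α p) q

  shift-toSeries : ∀ {E} (α : Exponent E) a (p : Polynomial E) μ →
    a ℤ.* shift α (toSeries p) μ ≡ toSeries (scale a α p) μ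
  shift-toSeries {E} α a p μ = begin
    a ℤ.* shift α (toSeries p) μ
      ≡⟨ cong (ℤ._*_ a) (shift-cong α (toSeries-∑ p) μ) ⟩
    a ℤ.* shift α (λ ν → ∑ p (λ (b , β) → guard (β ≟ᵉ ν) b)) μ
      ≡⟨ cong (ℤ._*_ a) (shift-∑ α (λ (b , β) ν → guard (β ≟ᵉ ν) b) p μ) ⟩
    a ℤ.* ∑ p (λ (b , β) → shift α (λ ν → guard (β ≟ᵉ ν) b) μ) ≡⟨ ∑-* a _ p ⟨
    ∑ p (λ (b , β) → a ℤ.* shift α (λ ν → guard (β ≟ᵉ ν) b) μ)
      ≡⟨ ∑-cong p (λ (b , β) → term b β (divides? α μ)) ⟩
    ∑ p (λ (b , β) → guard ((α ⊞ β) ≟ᵉ μ) (a ℤ.* b))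
      ≡⟨ ∑-map (λ (b , β) → a ℤ.* b , α ⊞ β) (λ (b , β) → guard (β ≟ᵉ μ) b) p ⟨
    ∑ (scale a α p) (λ (b , β) → guard (β ≟ᵉ μ) b) ≡⟨ toSeries-∑ (scale a α p) μ ⟨
    toSeries (scale a α p) μ ∎
    where
    open ≡-Reasoning
    term : ∀ b β → Dec (Divides α μ) → a ℤ.* shift α (λ ν → guard (β ≟ᵉ ν) b) μ ≡ guard ((α ⊞ β) ≟ᵉ μ) (a ℤ.* b)
    term b β (no ¬α) = trans (cong (ℤ._*_ a) (shift-no α (λ ν → guard (β ≟ᵉ ν) b) ¬α))
      (trans (ℤ.*-zeroʳ a) (sym (guard-no ((α ⊞ β) ≟ᵉ μ) (λ eq → ¬α (β , eq)))))
    term b β (yes (ν , refl)) = trans (cong (ℤ._*_ a) (shift-yes α (λ ν → guard (β ≟ᵉ ν) b) ν)) (trans (sym (guard-* (β ≟ᵉ ν) a b))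
      (guard-⇔ (β ≟ᵉ ν) ((α ⊞ β) ≟ᵉ (α ⊞ ν)) (cong (α ⊞_)) (⊞-cancel α)))

  act-toSeries : ∀ {E} (q p : Polynomial E) → act q (toSeries p) ≗ toSeries (q ⊠ p)
  act-toSeries q p μ = begin
    ∑ q (λ (a , α) → a ℤ.* shift α (toSeries p) μ)
      ≡⟨ ∑-cong q (λ (a , α) → trans (shift-toSeries α a p μ) (toSeries-∑ (scale a α p) μ)) ⟩
    ∑ q (λ (a , α) → ∑ (scale a α p) (λ (b , β) → guard (β ≟ᵉ μ) b)) ≡⟨ ∑-concatMap (λ (a , α) → scale a α p) _ q ⟨
    ∑ (q ⊠ p) (λ (b , β) → guard (β ≟ᵉ μ) b) ≡⟨ toSeries-∑ (q ⊠ p) μ ⟨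
    toSeries (q ⊠ p) μ ∎
    where open ≡-Reasoning

module EvaluationProperties {c ℓ₁ ℓ₂} (𝕂 : OrderedField c ℓ₁ ℓ₂) where
  open OrderedField 𝕂
  open Evaluation 𝕂
  open Summation using (guard; guard-yes; guard-no; guard-⇔; ∑; ∑-++; ∑-map; ∑-cong)
  open PowerSeries
  open IntegerMultiples.Solver commutativeRing hiding (Polynomial)
  open Exponentiation semiring using (^-homo-*)
  open RingProperties ring using (-0#≈0#)
  open SetoidReasoning setoid

  fromℤ-+ : ∀ i j → fromℤ (i ℤ.+ j) ≈ fromℤ i + fromℤ j
  fromℤ-+ i j = solve 0 (con (i ℤ.+ j) := con i :+ con j) refl

  fromℤ-* : ∀ i j → fromℤ (i ℤ.* j) ≈ fromℤ i * fromℤ j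
  fromℤ-* i j = solve 0 (con (i ℤ.* j) := con i :* con j) refl

  fromℤ-neg : ∀ i → fromℤ (ℤ.- i) ≈ - fromℤ i
  fromℤ-neg i = solve 0 (con (ℤ.- i) := :- con i) refl

  monomial-⊞ : ∀ {E} (w : Fin E → Carrier) α β → monomial w (α ⊞ β) ≈ monomial w α * monomial w β
  monomial-⊞ w []      []      = sym (*-identityˡ 1#)
  monomial-⊞ w (a ∷ α) (b ∷ β) = begin
    w Fin.zero ^ (a ℕ.+ b) * monomial (w ∘ Fin.suc) (α ⊞ β)
      ≈⟨ *-cong (^-homo-* (w Fin.zero) a b) (monomial-⊞ (w ∘ Fin.suc) α β) ⟩
    w Fin.zero ^ a * w Fin.zero ^ b * (monomial (w ∘ Fin.suc) α * monomial (w ∘ Fin.suc) β)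
      ≈⟨ solve 4 (λ a b c d → a :* b :* (c :* d) := a :* c :* (b :* d)) refl (w Fin.zero ^ a) (w Fin.zero ^ b) (monomial (w ∘ Fin.suc) α) (monomial (w ∘ Fin.suc) β) ⟩
    w Fin.zero ^ a * monomial (w ∘ Fin.suc) α * (w Fin.zero ^ b * monomial (w ∘ Fin.suc) β) ∎

  module _ {E} (w : Fin E → Carrier) where
    evaluate-++ : ∀ p q → evaluate w (p ++ q) ≈ evaluate w p + evaluate w q
    evaluate-++ []            q = sym (+-identityˡ _)
    evaluate-++ ((a , α) ∷ p) q = trans (+-congˡ (evaluate-++ p q)) (sym (+-assoc _ _ _))

    evaluate-scale : ∀ a α p → evaluate w (scale a α p) ≈ fromℤ a * monomial w α * evaluate w p
    evaluate-scale a α []            = sym (zeroʳ _)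
    evaluate-scale a α ((b , β) ∷ p) = begin
      fromℤ (a ℤ.* b) * monomial w (α ⊞ β) + evaluate w (scale a α p)
        ≈⟨ +-cong (*-cong (fromℤ-* a b) (monomial-⊞ w α β)) (evaluate-scale a α p) ⟩
      fromℤ a * fromℤ b * (monomial w α * monomial w β) + fromℤ a * monomial w α * evaluate w p
        ≈⟨ solve 5 (λ a b x y z → a :* b :* (x :* y) :+ a :* x :* z := a :* x :* (b :* y :+ z)) refl
             (fromℤ a) (fromℤ b) (monomial w α) (monomial w β) (evaluate w p) ⟩
      fromℤ a * monomial w α * (fromℤ b * monomial w β + evaluate w p) ∎

    evaluate-⊠ : ∀ q p → evaluate w (q ⊠ p) ≈ evaluate w q * evaluate w p
    evaluate-⊠ []            p = sym (zeroˡ _)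
    evaluate-⊠ ((a , α) ∷ q) p = trans (evaluate-++ (scale a α p) (q ⊠ p))
      (trans (+-cong (evaluate-scale a α p) (evaluate-⊠ q p)) (sym (distribʳ _ _ _)))

    remove : Exponent E → Polynomial E → Polynomial E
    remove μ = filter (λ (_ , α) → ¬? (α ≟ᵉ μ))

    coefficient-∷ : ∀ a (α : Exponent E) p ν → toSeries ((a , α) ∷ p) ν ≡ guard (α ≟ᵉ ν) a ℤ.+ toSeries p ν
    coefficient-∷ a α p ν = ≡.trans (toSeries-∑ ((a , α) ∷ p) ν) (≡.cong (ℤ._+_ (guard (α ≟ᵉ ν) a)) (≡.sym (toSeries-∑ p ν)))

    evaluate-remove : ∀ μ p → evaluate w p ≈ fromℤ (toSeries p μ) * monomial w μ + evaluate w (remove μ p)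
    evaluate-remove μ [] = sym (trans (+-identityʳ _) (zeroˡ _))
    evaluate-remove μ ((a , α) ∷ p) with α ≟ᵉ μ
    ... | yes ≡.refl = begin
      fromℤ a * monomial w μ + evaluate w p
        ≈⟨ +-congˡ (evaluate-remove μ p) ⟩
      fromℤ a * monomial w μ + (fromℤ (toSeries p μ) * monomial w μ + evaluate w (remove μ p))
        ≈⟨ solve 4 (λ a b m x →
        a :* m :+ (b :* m :+ x) := (a :+ b) :* m :+ x) refl (fromℤ a) (fromℤ (toSeries p μ)) (monomial w μ) (evaluate w (remove μ p)) ⟩
      (fromℤ a + fromℤ (toSeries p μ)) * monomial w μ + evaluate w (remove μ p)
        ≈⟨ +-congʳ (*-congʳ (fromℤ-+ a (toSeries p μ))) ⟨
      fromℤ (a ℤ.+ toSeries p μ) * monomial w μ + evaluate w (remove μ p) ∎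
    ... | no _ = trans (+-congˡ (evaluate-remove μ p))
      (solve 3 (λ x y z → x :+ (y :+ z) := y :+ (x :+ z)) refl (fromℤ a * monomial w α) _ _)

    remove-self : ∀ μ p → toSeries (remove μ p) μ ≡ 0ℤ
    remove-self μ [] = ≡.refl
    remove-self μ ((a , α) ∷ p) with α ≟ᵉ μ
    ... | yes _  = remove-self μ p
    ... | no α≢μ = ≡.trans (coefficient-∷ a α (remove μ p) μ)
      (≡.cong₂ ℤ._+_ (guard-no (α ≟ᵉ μ) {a} α≢μ) (remove-self μ p))

    remove-other : ∀ μ p ν → ν ≢ μ → toSeries (remove μ p) ν ≡ toSeries p ν
    remove-other μ [] ν ν≢μ = ≡.refl
    remove-other μ ((a , α) ∷ p) ν ν≢μ with α ≟ᵉ μ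
    ... | yes ≡.refl = ≡.trans (remove-other μ p ν ν≢μ) (≡.sym (≡.trans (coefficient-∷ a α p ν)
      (≡.trans (≡.cong (ℤ._+ toSeries p ν) (guard-no (α ≟ᵉ ν) {a} (ν≢μ ∘ ≡.sym))) (ℤ.+-identityˡ _))))
    ... | no _ = ≡.trans (coefficient-∷ a α (remove μ p) ν) (≡.trans (≡.cong (ℤ._+_ (guard (α ≟ᵉ ν) a)) (remove-other μ p ν ν≢μ))
      (≡.sym (coefficient-∷ a α p ν)))

    remove-zero : ∀ μ p → (∀ ν → toSeries p ν ≡ 0ℤ) → ∀ ν → toSeries (remove μ p) ν ≡ 0ℤ
    remove-zero μ p p≡0 ν with ν ≟ᵉ μ
    ... | yes ≡.refl = remove-self μ p
    ... | no ν≢μ     = ≡.trans (remove-other μ p ν ν≢μ) (p≡0 ν)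

    remove-shorter : ∀ a α p → length (remove α ((a , α) ∷ p)) ℕ.≤ length p
    remove-shorter a α p with α ≟ᵉ α
    ... | yes _  = List.length-filter _ p
    ... | no α≢α = ⊥-elim (α≢α ≡.refl)

    -- Terms of equal exponent may be scattered over the list, so all terms with the exponent of the
    -- first one are collected at once; their coefficients add up to 0. What is left need not be the
    -- tail of the list, and the bound m on its length carries the induction.
    evaluate-zero : ∀ m p → length p ℕ.≤ m → (∀ ν → toSeries p ν ≡ 0ℤ) → evaluate w p ≈ 0#
    evaluate-zero m       []              _           p≡0 = refl
    evaluate-zero (suc m) p@((a , α) ∷ p′) (s≤s ∣p′∣≤m) p≡0 = begin
      evaluate w p ≈⟨ evaluate-remove α p ⟩
      fromℤ (toSeries p α) * monomial w α + evaluate w (remove α p)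
        ≈⟨ +-cong (*-congʳ (reflexive (≡.cong fromℤ (p≡0 α))))
            (evaluate-zero m (remove α p) (ℕ.≤-trans (remove-shorter a α p′) ∣p′∣≤m) (remove-zero α p p≡0)) ⟩
      0# * monomial w α + 0# ≈⟨ trans (+-identityʳ _) (zeroˡ _) ⟩
      0# ∎

    negate : Polynomial E → Polynomial E
    negate = map (λ (a , α) → ℤ.- a , α)

    evaluate-negate : ∀ p → evaluate w (negate p) ≈ - evaluate w p
    evaluate-negate [] = sym -0#≈0#
    evaluate-negate ((a , α) ∷ p) = trans (+-cong (*-congʳ (fromℤ-neg a)) (evaluate-negate p))
      (solve 3 (λ a m x → :- a :* m :+ :- x := :- (a :* m :+ x)) refl (fromℤ a) (monomial w α) (evaluate w p))

    toSeries-negate : ∀ p ν → toSeries (negate p) ν ≡ ℤ.- toSeries p ν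
    toSeries-negate [] ν = ≡.refl
    toSeries-negate ((a , α) ∷ p) ν = ≡.trans (coefficient-∷ (ℤ.- a) α (negate p) ν)
      (≡.trans (≡.cong₂ ℤ._+_ (guard-neg (α ≟ᵉ ν)) (toSeries-negate p ν))
        (≡.trans (≡.sym (ℤ.neg-distrib-+ (guard (α ≟ᵉ ν) a) (toSeries p ν))) (≡.cong ℤ.-_ (≡.sym (coefficient-∷ a α p ν)))))
      where
      guard-neg : ∀ {P : Set} (d : Dec P) → guard d (ℤ.- a) ≡ ℤ.- guard d a
      guard-neg d with does d
      ... | true  = ≡.refl
      ... | false = ≡.refl

    -- Apply `evaluate-zero` to the difference. Evaluation thus depends on the coefficients alone,
    -- which allows identities between series to be evaluated.
    evaluate-cong : ∀ p q → toSeries p ≗ toSeries q → evaluate w p ≈ evaluate w q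
    evaluate-cong p q p≗q = begin
      evaluate w p
        ≈⟨ solve 2 (λ x y → x := (x :+ :- y) :+ y) refl (evaluate w p) (evaluate w q) ⟩
      evaluate w p + - evaluate w q + evaluate w q
        ≈⟨ +-congʳ (trans (evaluate-++ p (negate q)) (+-congˡ (evaluate-negate q))) ⟨
      evaluate w (p ++ negate q) + evaluate w q
        ≈⟨ +-congʳ (evaluate-zero _ (p ++ negate q) ℕ.≤-refl difference) ⟩
      0# + evaluate w q ≈⟨ +-identityˡ _ ⟩
      evaluate w q ∎
      where
      difference : ∀ ν → toSeries (p ++ negate q) ν ≡ 0ℤ
      difference ν = ≡.trans (toSeries-∑ (p ++ negate q) ν) (≡.trans (∑-++ _ p (negate q))
        (≡.trans (≡.cong₂ ℤ._+_ (≡.trans (≡.sym (toSeries-∑ p ν)) (p≗q ν)) (≡.trans (≡.sym (toSeries-∑ (negate q) ν)) (toSeries-negate q ν)))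
          (ℤ.+-inverseʳ (toSeries q ν))))

    -- q φ = q (d f) = d (q f) = d p.
    cross-multiply : ∀ (f : Series E) q p d φ → toSeries q ⊛ f ≗ toSeries p → toSeries d ⊛ f ≗ toSeries φ →
      evaluate w q * evaluate w φ ≈ evaluate w d * evaluate w p
    cross-multiply f q p d φ qf≗p df≗φ = begin
      evaluate w q * evaluate w φ ≈⟨ evaluate-⊠ q φ ⟨
      evaluate w (q ⊠ φ) ≈⟨ evaluate-cong (q ⊠ φ) (d ⊠ p) products ⟩
      evaluate w (d ⊠ p) ≈⟨ evaluate-⊠ d p ⟩
      evaluate w d * evaluate w p ∎
      where
      act≗ : ∀ q p → toSeries q ⊛ f ≗ toSeries p → act q f ≗ toSeries p
      act≗ q p eq ν = ≡.trans (≡.sym (⊛-act q f ν)) (eq ν)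
      products : toSeries (q ⊠ φ) ≗ toSeries (d ⊠ p)
      products ν = ≡.trans (≡.sym (act-toSeries q φ ν)) (≡.trans (act-cong q (λ ν → ≡.sym (act≗ d φ df≗φ ν)) ν)
        (≡.trans (act-comm q d f ν) (≡.trans (act-cong d (act≗ q p qf≗p) ν) (act-toSeries d p ν))))

-- Edge flows and their walks

module Notation where
  open import Relation.Binary.PropositionalEquality public
  open import Data.Nat public using (_+_; _≤_; _<_; s≤s; z≤n)
  open import Data.Fin.Subset public using (Subset; _∩_; _∪_; _─_; _-_; ∣_∣; ⁅_⁆; inside; outside; _⊆_)
    renaming (_∈_ to _∈ˢ_; _∉_ to _∉ˢ_; ⊤ to full; ⊥ to empty)

module SubsetProperties where
  open Notation
  ∣-∣-remove : ∀ {m} (F T : Subset m) {x} → x ∈ˢ F → x ∈ˢ T → ∣ F ∩ T ∣ ≡ suc ∣ (F - x) ∩ T ∣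
  ∣-∣-remove (inside  ∷ F) (inside  ∷ T) here       here       = cong (λ G → suc ∣ G ∩ T ∣) (sym (Subset.p─⊥≡p F))
  ∣-∣-remove (inside  ∷ F) (inside  ∷ T) (there x∈F) (there x∈T) = cong suc (∣-∣-remove F T x∈F x∈T)
  ∣-∣-remove (inside  ∷ F) (outside ∷ T) (there x∈F) (there x∈T) = ∣-∣-remove F T x∈F x∈T
  ∣-∣-remove (outside ∷ F) (_       ∷ T) (there x∈F) (there x∈T) = ∣-∣-remove F T x∈F x∈T

  ∣-∣-remove-∉ : ∀ {m} (F T : Subset m) {x} → x ∉ˢ T → ∣ (F - x) ∩ T ∣ ≡ ∣ F ∩ T ∣
  ∣-∣-remove-∉ (s ∷ F)       (inside  ∷ T) {Fin.zero}  x∉T = contradiction here x∉T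
  ∣-∣-remove-∉ (inside  ∷ F) (outside ∷ T) {Fin.zero}  x∉T = cong (λ G → ∣ G ∩ T ∣) (Subset.p─⊥≡p F)
  ∣-∣-remove-∉ (outside ∷ F) (outside ∷ T) {Fin.zero}  x∉T = cong (λ G → ∣ G ∩ T ∣) (Subset.p─⊥≡p F)
  ∣-∣-remove-∉ (inside  ∷ F) (inside  ∷ T) {Fin.suc x} x∉T = cong suc (∣-∣-remove-∉ F T (x∉T ∘ there))
  ∣-∣-remove-∉ (inside  ∷ F) (outside ∷ T) {Fin.suc x} x∉T = ∣-∣-remove-∉ F T (x∉T ∘ there)
  ∣-∣-remove-∉ (outside ∷ F) (_       ∷ T) {Fin.suc x} x∉T = ∣-∣-remove-∉ F T (x∉T ∘ there)

  ∣-∣-witness : ∀ {m} (F : Subset m) {k} → ∣ F ∣ ≡ suc k → ∃ λ x → x ∈ˢ F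
  ∣-∣-witness (inside  ∷ F) eq = Fin.zero , here
  ∣-∣-witness (outside ∷ F) eq = let x , x∈F = ∣-∣-witness F eq in Fin.suc x , there x∈F

  ∈-remove : ∀ {m} {F : Subset m} {x y} → x ∈ˢ F - y → x ∈ˢ F × x ≢ y
  ∈-remove {F = F} {x} {y} x∈ = Subset.p─q⊆p F ⁅ y ⁆ x∈ , λ { refl → not-self F x x∈ }
    where
    not-self : ∀ {m} (F : Subset m) x → ¬ x ∈ˢ F - x
    not-self (_ ∷ F) Fin.zero    ()
    not-self (_ ∷ F) (Fin.suc x) (there x∈) = not-self F x x∈

  insert-remove : ∀ {m} (F : Subset m) {x} → x ∉ˢ F → (F ∪ ⁅ x ⁆) - x ≡ F
  insert-remove (inside  ∷ F) {Fin.zero}  x∉F = contradiction here x∉F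
  insert-remove (outside ∷ F) {Fin.zero}  x∉F = cong (outside ∷_) (trans (Subset.p─⊥≡p (F ∪ empty)) (Subset.∪-identityʳ F))
  insert-remove (inside  ∷ F) {Fin.suc x} x∉F = cong (inside ∷_) (insert-remove F (x∉F ∘ there))
  insert-remove (outside ∷ F) {Fin.suc x} x∉F = cong (outside ∷_) (insert-remove F (x∉F ∘ there))

  ∈-insert : ∀ {m} (F : Subset m) x → x ∈ˢ F ∪ ⁅ x ⁆
  ∈-insert F x = Subset.x∈p∪q⁺ (inj₂ (Subset.x∈⁅x⁆ x))

  ∈-support : ∀ {m} {x : Fin m} {P} → x ∈ P → x ∈ˢ support P
  ∈-support {x = x} (here refl) = Subset.x∈p∪q⁺ (inj₁ (Subset.x∈⁅x⁆ x))
  ∈-support (there x∈P)         = Subset.x∈p∪q⁺ (inj₂ (∈-support x∈P))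

  support-∈ : ∀ {m} {x : Fin m} P → x ∈ˢ support P → x ∈ P
  support-∈ []      x∈ = contradiction x∈ Subset.∉⊥
  support-∈ (y ∷ P) x∈ with Subset.x∈p∪q⁻ ⁅ y ⁆ (support P) x∈
  ... | inj₁ x∈⁅y⁆ = here (Subset.x∈⁅y⁆⇒x≡y y x∈⁅y⁆)
  ... | inj₂ x∈P   = there (support-∈ P x∈P)

  ⊆⇒All : ∀ {m} {F : Subset m} P → support P ⊆ F → All (_∈ˢ F) P
  ⊆⇒All P P⊆F = All.tabulate (P⊆F ∘ ∈-support)

  All⇒⊆ : ∀ {m} {F : Subset m} P → All (_∈ˢ F) P → support P ⊆ F
  All⇒⊆ P P⊆F x∈ = All.lookup P⊆F (support-∈ P x∈)

module Fibres {m : ℕ} {V : Set} (_≟_ : DecidableEquality V) (g : Fin m → V) where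
  open Notation
  open SubsetProperties

  fibre : V → Subset m
  fibre v = tabulate (λ e → does (g e ≟ v))

  ∈-fibre : ∀ {x v} → g x ≡ v → x ∈ˢ fibre v
  ∈-fibre {x} {v} eq = Vec.lookup⇒[]= x (fibre v) (trans (Vec.lookup∘tabulate _ x) (dec-true (g x ≟ v) eq))

  fibre-∈ : ∀ {x v} → x ∈ˢ fibre v → g x ≡ v
  fibre-∈ {x} {v} x∈ with g x ≟ v | trans (sym (Vec.[]=⇒lookup x∈)) (Vec.lookup∘tabulate (λ e → does (g e ≟ v)) x)
  ... | yes eq | _  = eq
  ... | no _   | ()

  -- For `tgt` and `src` this unfolds to `arriving` and `leaving`, so both are treated at once.
  count : Subset m → V → ℕ
  count F v = ∣ F ∩ fibre v ∣

  count-hit : ∀ {F x v} → x ∈ˢ F → g x ≡ v → count F v ≡ suc (count (F - x) v)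
  count-hit {F} {x} {v} x∈F eq = ∣-∣-remove F (fibre v) x∈F (∈-fibre eq)

  count-miss : ∀ F {x v} → g x ≢ v → count (F - x) v ≡ count F v
  count-miss F {x} {v} neq = ∣-∣-remove-∉ F (fibre v) (neq ∘ fibre-∈)

  count-witness : ∀ {F v k} → count F v ≡ suc k → ∃ λ x → x ∈ˢ F × g x ≡ v
  count-witness {F} {v} eq with ∣-∣-witness (F ∩ fibre v) eq
  ... | x , x∈ = x , proj₁ (Subset.x∈p∩q⁻ F (fibre v) x∈) , fibre-∈ (proj₂ (Subset.x∈p∩q⁻ F (fibre v) x∈))

  count-zero : ∀ {F v} → (∀ x → x ∈ˢ F → g x ≢ v) → count F v ≡ 0
  count-zero {F} {v} none with count F v in eq
  ... | zero  = refl
  ... | suc k with count-witness {F} eq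
  ...   | x , x∈F , gx = contradiction gx (none x x∈F)

  count≤ : ∀ F v → count F v ≤ count full v
  count≤ F v = Subset.p⊆q⇒∣p∣≤∣q∣ λ x∈ → Subset.x∈p∩q⁺ (Subset.∈⊤ , proj₂ (Subset.x∈p∩q⁻ F (fibre v) x∈))

  count-positive : ∀ {F x v} → x ∈ˢ F → g x ≡ v → 1 ≤ count F v
  count-positive {F} {x} {v} x∈F gx rewrite count-hit {F} {x} {v} x∈F gx = s≤s z≤n

  count-two : ∀ {F x y v} → x ∈ˢ F → y ∈ˢ F → x ≢ y → g x ≡ v → g y ≡ v → 2 ≤ count F v
  count-two {F} {x} {y} {v} x∈F y∈F x≢y gx gy rewrite count-hit {F} {x} {v} x∈F gx =
    s≤s (count-positive {F - x} (Subset.x∈p∧x≢y⇒x∈p-y y∈F (x≢y ∘ sym)) gy)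

  count-unique : ∀ {F x y v} → count F v ≤ 1 → x ∈ˢ F → y ∈ˢ F → g x ≡ v → g y ≡ v → x ≡ y
  count-unique {F} {x} {y} ≤1 x∈F y∈F gx gy with x Fin.≟ y
  ... | yes eq = eq
  ... | no neq = contradiction (ℕ.≤-trans (count-two x∈F y∈F neq gx gy) ≤1) λ { (s≤s ()) }

  count-pair : ∀ {F x y z v} → count F v ≤ 2 → x ∈ˢ F → y ∈ˢ F → z ∈ˢ F → x ≢ y →
    g x ≡ v → g y ≡ v → g z ≡ v → z ≡ x ⊎ z ≡ y
  count-pair {F} {x} {y} {z} {v} ≤2 x∈F y∈F z∈F x≢y gx gy gz with z Fin.≟ x
  ... | yes eq = inj₁ eq
  ... | no neq = inj₂ (count-unique {F - x} (ℕ.≤-pred (subst (_≤ 2) (count-hit {F} {x} {v} x∈F gx) ≤2))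
          (Subset.x∈p∧x≢y⇒x∈p-y z∈F neq) (Subset.x∈p∧x≢y⇒x∈p-y y∈F (x≢y ∘ sym)) gz gy)

  open Sums ℕ.+-0-commutativeMonoid using (sum; sum-cong-≗; sum-syntax; ∑-comm)

  member : Subset m → Fin m → ℕ
  member F e = if Vec.lookup F e then 1 else 0

  count-sum : ∀ F v → count F v ≡ sum λ e → if does (g e ≟ v) then (member F e) else 0
  count-sum F v = go F g
    where
    go : ∀ {m} (F : Subset m) (g : Fin m → V) →
      ∣ F ∩ tabulate (λ e → does (g e ≟ v)) ∣ ≡ sum λ e → if does (g e ≟ v) then (if Vec.lookup F e then 1 else 0) else 0
    go []            g = refl
    go (inside ∷ F)  g with does (g Fin.zero ≟ v)
    ... | true  = cong suc (go F (g ∘ Fin.suc))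
    ... | false = go F (g ∘ Fin.suc)
    go (outside ∷ F) g with does (g Fin.zero ≟ v)
    ... | true  = go F (g ∘ Fin.suc)
    ... | false = go F (g ∘ Fin.suc)

module FibreSums {m n N : ℕ} (_≟_ : DecidableEquality (Fin n ⊎ Fin N)) (g : Fin m → Fin n ⊎ Fin N) where
  open Notation
  open Fibres _≟_ g
  open Sums ℕ.+-0-commutativeMonoid using (sum; sum-cong-≗; ∑-comm; ∑-distrib-+; sum-replicate-zero)

  private
    sum-zero : ∀ {n} (f : Fin n → ℕ) → (∀ i → f i ≡ 0) → sum f ≡ 0
    sum-zero {n} f f≡0 = trans (sum-cong-≗ f≡0) (sum-replicate-zero n)

    sum-pick : ∀ {n} (f : Fin n → ℕ) i → (∀ j → j ≢ i → f j ≡ 0) → sum f ≡ f i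
    sum-pick {suc n} f Fin.zero others =
      trans (cong (_+_ (f Fin.zero)) (sum-zero (f ∘ Fin.suc) (λ j → others (Fin.suc j) λ ()))) (ℕ.+-identityʳ _)
    sum-pick {suc n} f (Fin.suc i) others =
      trans (cong (_+ sum (f ∘ Fin.suc)) (others Fin.zero λ ()))
        (sum-pick (f ∘ Fin.suc) i (λ j j≢i → others (Fin.suc j) (j≢i ∘ Fin.suc-injective)))

    at : Fin n ⊎ Fin N → Fin n ⊎ Fin N → ℕ → ℕ
    at v w x = if does (v ≟ w) then x else 0

    at-self : ∀ v x → at v v x ≡ x
    at-self v x = cong (λ b → if b then x else 0) (dec-true (v ≟ v) refl)

    at-other : ∀ {v w} x → v ≢ w → at v w x ≡ 0
    at-other {v} {w} x v≢w = cong (λ b → if b then x else 0) (dec-false (v ≟ w) v≢w)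

    once : ∀ v x → sum (λ i → at v (inj₁ i) x) + sum (λ i → at v (inj₂ i) x) ≡ x
    once (inj₁ i) x = trans (cong₂ _+_
      (trans (sum-pick (λ j → at (inj₁ i) (inj₁ j) x) i (λ j j≢i → at-other x (λ { refl → j≢i refl }))) (at-self (inj₁ i) x))
      (sum-zero (λ j → at (inj₁ i) (inj₂ j) x) (λ j → at-other x λ ()))) (ℕ.+-identityʳ x)
    once (inj₂ i) x = cong₂ _+_ (sum-zero (λ j → at (inj₂ i) (inj₁ j) x) (λ j → at-other x λ ()))
      (trans (sum-pick (λ j → at (inj₂ i) (inj₂ j) x) i (λ j j≢i → at-other x (λ { refl → j≢i refl }))) (at-self (inj₂ i) x))

  -- Double counting: each edge of F is counted at exactly one vertex. As the right-hand side does
  -- not mention g, arrivals and departures have the same total.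
  total : ∀ F → sum (λ i → count F (inj₁ i)) + sum (λ i → count F (inj₂ i)) ≡ sum (member F)
  total F = trans (cong₂ _+_ (swap inj₁) (swap inj₂))
    (trans (sym (∑-distrib-+ (λ e → sum (λ i → at (g e) (inj₁ i) (member F e))) (λ e → sum (λ i → at (g e) (inj₂ i) (member F e)))))
      (sum-cong-≗ (λ e → once (g e) (member F e))))
    where
    swap : ∀ {k} (ι : Fin k → Fin n ⊎ Fin N) → sum (λ i → count F (ι i)) ≡ sum (λ e → sum (λ i → at (g e) (ι i) (member F e)))
    swap ι = trans (sum-cong-≗ (λ i → count-sum F (ι i))) (∑-comm (λ i e → at (g e) (ι i) (member F e)))

module Flows {c ℓ₁ ℓ₂} {𝕂 : OrderedField c ℓ₁ ℓ₂} {k n : ℕ} (G : PlabicGraph 𝕂 k n) where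
  open Notation
  open PlabicGraph G
  open Planarity G using (Inner)
  open SubsetProperties
  module In  = Fibres _≟ⱽ_ tgt
  module Out = Fibres _≟ⱽ_ src

  inner-or-boundary : ∀ v → Inner v ⊎ ∃ λ i → v ≡ boundary i
  inner-or-boundary (inj₁ i) = inj₂ (i , refl)
  inner-or-boundary (inj₂ u) = inj₁ (u , refl)

  narrow : ∀ u → indegree (inner u) ≡ 1 ⊎ outdegree (inner u) ≡ 1
  narrow u with colour u in eq
  ... | white = inj₁ (white-indegree u eq)
  ... | black = inj₂ (black-outdegree u eq)

  -- The use of the colours: one of the two degrees of u is 1, and balance carries this bound over
  -- to the edges that leave. A flow therefore never branches at a balanced vertex.
  balanced≤1 : ∀ F u → arriving F (inner u) ≡ leaving F (inner u) → leaving F (inner u) ≤ 1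
  balanced≤1 F u balance with narrow u
  ... | inj₁ eq = subst (_≤ 1) balance (subst (arriving F (inner u) ≤_) eq (In.count≤ F (inner u)))
  ... | inj₂ eq = subst (leaving F (inner u) ≤_) eq (Out.count≤ F (inner u))

  boundary-one-way : ∀ {e f i} → tgt e ≡ boundary i → src f ≢ boundary i
  boundary-one-way {e} {f} {i} tgt≡ src≡ = ℕ.<-irrefl refl
    (ℕ.≤-trans (ℕ.+-mono-≤ (In.count-positive {full} {e} Subset.∈⊤ tgt≡) (Out.count-positive {full} {f} Subset.∈⊤ src≡))
      (ℕ.≤-reflexive (boundary-degree i)))

  leaving-boundary⇒source : ∀ {e i} → src e ≡ boundary i → IsSource i
  leaving-boundary⇒source {e} {i} src≡ = ℕ.≤-antisym
    (ℕ.≤-trans (ℕ.m≤n+m (outdegree (boundary i)) (indegree (boundary i))) (ℕ.≤-reflexive (boundary-degree i)))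
    (Out.count-positive {full} {e} Subset.∈⊤ src≡)

  source-not-entered : ∀ {e i} → IsSource i → tgt e ≢ boundary i
  source-not-entered {e} {i} source tgt≡ with Out.count-witness {full} source
  ... | f , _ , src≡ = boundary-one-way {e} {f} tgt≡ src≡

  consecutive-inner : ∀ {e f} → tgt e ≡ src f → Inner (src f)
  consecutive-inner {e} {f} tgt≡ with inner-or-boundary (src f)
  ... | inj₁ inner-src      = inner-src
  ... | inj₂ (i , src≡) = ⊥-elim (boundary-one-way {e} {f} (trans tgt≡ src≡) src≡)

  -- Arrivals and departures have the same total over all vertices.
  balanced⇒no-sink-edge : ∀ C → (∀ v → arriving C (inner v) ≡ leaving C (inner v)) →
    (∀ x → x ∈ˢ C → ∀ i → src x ≢ boundary i) → ∀ x → x ∈ˢ C → ∀ i → tgt x ≢ boundary i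
  balanced⇒no-sink-edge C balance no-source x x∈C i tgt≡ =
    ℕ.<-irrefl (sym (sum≡0 i)) (In.count-positive {C} {x} x∈C tgt≡)
    where
    open Sums ℕ.+-0-commutativeMonoid using (sum; sum-cong-≗; sum-replicate-zero)
    no-departures : sum (λ i → leaving C (boundary i)) ≡ 0
    no-departures = trans (sum-cong-≗ (λ i → Out.count-zero {C} (λ x x∈C → no-source x x∈C i))) (sum-replicate-zero n)
    no-arrivals : sum (λ i → arriving C (boundary i)) ≡ 0
    no-arrivals = ℕ.+-cancelʳ-≡ (sum (λ v → arriving C (inner v))) _ _
      (trans (trans (FibreSums.total _≟ⱽ_ tgt C) (sym (FibreSums.total _≟ⱽ_ src C)))
        (cong₂ _+_ no-departures (sym (sum-cong-≗ balance))))
    vanish : ∀ {n} (f : Fin n → ℕ) → sum f ≡ 0 → ∀ i → f i ≡ 0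
    vanish {suc n} f eq Fin.zero    = ℕ.m+n≡0⇒m≡0 _ eq
    vanish {suc n} f eq (Fin.suc i) = vanish (f ∘ Fin.suc) (ℕ.m+n≡0⇒n≡0 (f Fin.zero) eq) i
    sum≡0 : ∀ i → arriving C (boundary i) ≡ 0
    sum≡0 = vanish _ no-arrivals

  module _ {e : Edge} {F : Subset edges} (e∈F : e ∈ˢ F) where
    leaving-src : leaving F (src e) ≡ suc (leaving (F - e) (src e))
    leaving-src = Out.count-hit {F} {e} e∈F refl

  leaving-other : ∀ {e v} F → src e ≢ v → leaving (F - e) v ≡ leaving F v
  leaving-other {e} F = Out.count-miss F {e}

  arriving-other : ∀ {e v} F → tgt e ≢ v → arriving (F - e) v ≡ arriving F v
  arriving-other {e} F = In.count-miss F {e}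

  balance-remove : ∀ {e j F} → EdgeFlow e j F → ∀ v → tgt e ≢ inner v →
    arriving (F - e) (inner v) ≡ leaving (F - e) (inner v)
  balance-remove {e} {j} {F} (e∈F , balance , unit , _) v tgt≢ with inner v ≟ⱽ src e
  ... | no v≢src = trans (arriving-other F tgt≢) (trans (balance v v≢src) (sym (leaving-other F (v≢src ∘ sym))))
  ... | yes eq rewrite eq = trans (arriving-other F (edge-nondegenerate e ∘ sym))
          (ℕ.suc-injective (trans unit (leaving-src e∈F)))

  -- Shared by `flow-cons` and `flow-last`, which differ only in what happens at the end of e; that
  -- vertex is left to them.
  balance-insert : ∀ {e F} → e ∈ˢ F → (∀ v → tgt e ≢ inner v → arriving (F - e) (inner v) ≡ leaving (F - e) (inner v)) →
    (∀ x → x ∈ˢ F - e → ∀ i → IsSource i → ¬ Incident (boundary i) x) →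
    (∀ v → tgt e ≢ inner v → inner v ≢ src e → arriving F (inner v) ≡ leaving F (inner v))
      × suc (arriving F (src e)) ≡ leaving F (src e)
  balance-insert {e} {F} e∈F balance no-source = away , at-source
    where
    away : ∀ v → tgt e ≢ inner v → inner v ≢ src e → arriving F (inner v) ≡ leaving F (inner v)
    away v tgt≢ v≢src = trans (sym (arriving-other F tgt≢)) (trans (balance v tgt≢) (leaving-other F (v≢src ∘ sym)))
    level : ∀ v → src e ≡ v → arriving (F - e) v ≡ leaving (F - e) v
    level (inj₂ u) src≡ = balance u (λ tgt≡ → edge-nondegenerate e (trans src≡ (sym tgt≡)))
    -- Balance is assumed at inner vertices only. A boundary vertex where e starts is a source, so
    -- nothing arrives there, and no edge other than e leaves it.
    level (inj₁ i) src≡ = trans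
      (In.count-zero {F - e} (λ x _ → source-not-entered (leaving-boundary⇒source {e} src≡)))
      (sym (Out.count-zero {F - e} (λ x x∈ src-x → no-source x x∈ i (leaving-boundary⇒source {e} src≡) (inj₁ src-x))))
    at-source : suc (arriving F (src e)) ≡ leaving F (src e)
    at-source = trans (cong suc (sym (arriving-other F (edge-nondegenerate e ∘ sym))))
      (trans (cong suc (level (src e) refl)) (sym (leaving-src e∈F)))

  -- Deleting e repairs the defect at its start and produces the same defect at its end, where f
  -- starts. The sink edge survives, since f could not start at the sink if e ended there.
  flow-tail : ∀ {e f j F} → EdgeFlow e j F → f ∈ˢ F → tgt e ≡ src f → EdgeFlow f j (F - e)
  flow-tail {e} {f} {j} {F} flow@(e∈F , balance , unit , sources , x , x∈F , tgt-x) f∈F tgt≡ =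
      Subset.x∈p∧x≢y⇒x∈p-y f∈F (λ { refl → edge-nondegenerate e (sym tgt≡) })
    , (λ v v≢src → balance-remove flow v (λ eq → v≢src (trans (sym eq) tgt≡)))
    , level
    , (λ y y∈ i source incident → contradiction (sources y (proj₁ (∈-remove y∈)) i source incident) (proj₂ (∈-remove y∈)))
    , x , Subset.x∈p∧x≢y⇒x∈p-y x∈F (λ { refl → boundary-one-way {e} {f} tgt-x (trans (sym tgt≡) tgt-x) }) , tgt-x
    where
    level : suc (arriving (F - e) (src f)) ≡ leaving (F - e) (src f)
    level with consecutive-inner {e} {f} tgt≡
    ... | u , src≡ rewrite src≡ = trans (sym (In.count-hit {F} {e} e∈F tgt≡))
            (trans (balance u (λ eq → edge-nondegenerate e (sym (trans tgt≡ eq))))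
              (sym (leaving-other F (λ eq → edge-nondegenerate e (trans eq (sym tgt≡))))))

  flow-cons : ∀ {e f j F} → e ∈ˢ F → tgt e ≡ src f → EdgeFlow f j (F - e) → EdgeFlow e j F
  flow-cons {e} {f} {j} {F} e∈F tgt≡ (f∈ , balance , unit , sources , x , x∈ , tgt-x) =
    e∈F , balance′ , proj₂ inserted , sources′ , x , proj₁ (∈-remove x∈) , tgt-x
    where
    u = proj₁ (consecutive-inner {e} {f} tgt≡)
    src≡ = proj₂ (consecutive-inner {e} {f} tgt≡)
    no-source : ∀ y → y ∈ˢ F - e → ∀ i → IsSource i → ¬ Incident (boundary i) y
    no-source y y∈ i source (inj₂ tgt-y) = source-not-entered source tgt-y
    no-source y y∈ i source (inj₁ src-y) with sources y y∈ i source (inj₁ src-y)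
    ... | refl = contradiction (trans (sym src-y) src≡) λ ()
    inserted = balance-insert e∈F (λ v tgt≢ → balance v (λ eq → tgt≢ (trans tgt≡ (sym eq)))) no-source
    balance′ : ∀ v → inner v ≢ src e → arriving F (inner v) ≡ leaving F (inner v)
    balance′ v v≢src with tgt e ≟ⱽ inner v
    ... | no tgt≢ = proj₁ inserted v tgt≢ v≢src
    ... | yes tgt-e = trans (In.count-hit {F} {e} e∈F tgt-e)
            (trans (subst (λ w → suc (arriving (F - e) w) ≡ leaving (F - e) w) (trans (sym tgt≡) tgt-e) unit)
              (leaving-other F (v≢src ∘ sym)))
    sources′ : ∀ y → y ∈ˢ F → ∀ i → IsSource i → Incident (boundary i) y → y ≡ e
    sources′ y y∈F i source incident with y Fin.≟ e
    ... | yes eq = eq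
    ... | no neq = contradiction incident (no-source y (Subset.x∈p∧x≢y⇒x∈p-y y∈F neq) i source)

  -- Once e is deleted every internal vertex is balanced and no source edge is left, so by
  -- `balanced⇒no-sink-edge` no edge at a sink is left either. The edge at b_j must therefore have
  -- been e.
  flow-end : ∀ {e i j F} → EdgeFlow e j F → tgt e ≡ boundary i → i ≡ j × ConservativeFlow (F - e)
  flow-end {e} {i} {j} {F} flow@(e∈F , balance , unit , sources , x , x∈F , tgt-x) tgt≡ = i≡j , conservative
    where
    balance′ : ∀ v → arriving (F - e) (inner v) ≡ leaving (F - e) (inner v)
    balance′ v = balance-remove flow v (λ eq → contradiction (trans (sym tgt≡) eq) λ ())
    no-source : ∀ y → y ∈ˢ F - e → ∀ i → src y ≢ boundary i
    no-source y y∈ i src≡ = contradiction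
      (sources y (proj₁ (∈-remove y∈)) i (leaving-boundary⇒source {y} src≡) (inj₁ src≡)) (proj₂ (∈-remove y∈))
    no-sink = balanced⇒no-sink-edge (F - e) balance′ no-source
    conservative : ConservativeFlow (F - e)
    conservative = (λ { y y∈ i (inj₁ src≡) → no-source y y∈ i src≡ ; y y∈ i (inj₂ tgt≡) → no-sink y y∈ i tgt≡ }) , balance′
    i≡j : i ≡ j
    i≡j with x Fin.≟ e
    ... | yes refl = Sum.inj₁-injective (trans (sym tgt≡) tgt-x)
    ... | no neq   = contradiction tgt-x (no-sink x (Subset.x∈p∧x≢y⇒x∈p-y x∈F neq) j)

  flow-last : ∀ {e j F} → e ∈ˢ F → tgt e ≡ boundary j → ConservativeFlow (F - e) → EdgeFlow e j F
  flow-last {e} {j} {F} e∈F tgt≡ (inside-disk , balance) =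
    e∈F , (λ v → proj₁ inserted v (λ eq → contradiction (trans (sym tgt≡) eq) λ ())) , proj₂ inserted , sources , e , e∈F , tgt≡
    where
    inserted = balance-insert e∈F (λ v _ → balance v) (λ y y∈ i _ → inside-disk y y∈ i)
    sources : ∀ y → y ∈ˢ F → ∀ i → IsSource i → Incident (boundary i) y → y ≡ e
    sources y y∈F i source incident with y Fin.≟ e
    ... | yes eq = eq
    ... | no neq = contradiction incident (inside-disk y (Subset.x∈p∧x≢y⇒x∈p-y y∈F neq) i)

module WordEnumeration where
  open Notation

  ∈-words : ∀ {E} (P : List (Fin E)) → P ∈ words E (length P)
  ∈-words []      = here refl
  ∈-words (e ∷ P) = ∈-concatMap⁺ _ (lose (∈-allFin e) (∈-map⁺ (e ∷_) (∈-words P)))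

  -- Since the list contains a witness, the search does not fall back on the default d.
  head-filter : ∀ {a p} {A : Set a} {P : A → Set p} (P? : Decidable P) (d : A) {x xs} → x ∈ xs → P x →
    P (fromMaybe d (head (filter P? xs)))
  head-filter P? d {x} {y ∷ xs} x∈ px with P? y
  head-filter P? d (here refl)  px | no ¬py = contradiction px ¬py
  head-filter P? d (there x∈xs) px | no _   = head-filter P? d x∈xs px
  ... | yes py = py

module Walks {c ℓ₁ ℓ₂} {𝕂 : OrderedField c ℓ₁ ℓ₂} {k n : ℕ} (G : PlabicGraph 𝕂 k n) where
  open Notation
  open PlabicGraph G
  open Planarity G using (Inner)
  open SubsetProperties
  open WordEnumeration
  open Flows G

  path-∷ : ∀ {e f j P} → tgt e ≡ src f → Path f j (f ∷ P) → Path e j (e ∷ f ∷ P)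
  path-∷ tgt≡ (_ , linked , ends) = refl , tgt≡ ∷ linked , ends

  path-tail : ∀ {e f j P} → Path e j (e ∷ f ∷ P) → Path f j (f ∷ P)
  path-tail (_ , _ ∷ linked , ends) = refl , linked , ends

  remove-conservative : ∀ {F e} P → ConservativeFlow ((F - e) ─ support P) → ConservativeFlow (F ─ support (e ∷ P))
  remove-conservative {F} {e} P = subst ConservativeFlow (Subset.p─q─r≡p─q∪r F ⁅ e ⁆ (support P))

  leaving-edge : ∀ {e j F u} → EdgeFlow e j F → tgt e ≡ inner u → ∃ λ f → f ∈ˢ F × tgt e ≡ src f
  leaving-edge {e} {j} {F} {u} (e∈F , balance , _) tgt≡ =
    let f , f∈F , src≡ = Out.count-witness {F} (trans
          (sym (balance u (λ eq → edge-nondegenerate e (sym (trans tgt≡ eq))))) (In.count-hit {F} {e} e∈F tgt≡))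
    in f , f∈F , trans tgt≡ (sym src≡)

  -- Follow the flow and delete each edge after passing it; the size of F decreases, and the walk
  -- can stop only at b_j, where `flow-end` leaves a conservative remainder. The bound on the length
  -- places the walk among the words that `walkOf` searches.
  exists-walk : ∀ m {e j} F → ∣ F ∣ ≤ m → EdgeFlow e j F → ∃ λ P → length P ≤ ∣ F ∣ × Decomposes e j F P
  exists-walk zero {e} F ∣F∣≤0 (e∈F , _) =
    contradiction (ℕ.<-≤-trans (Subset.x∈p⇒∣p-x∣<∣p∣ e∈F) ∣F∣≤0) λ ()
  exists-walk (suc m) {e} {j} F ∣F∣≤1+m flow@(e∈F , balance , _) with inner-or-boundary (tgt e)
  ... | inj₂ (i , tgt≡) with flow-end flow tgt≡
  ...   | refl , conservative = e ∷ [] , ℕ.≤-trans (s≤s z≤n) (Subset.x∈p⇒∣p-x∣<∣p∣ e∈F)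
        , ((refl , [-] , cong just tgt≡) , [] ∷ [])
        , All⇒⊆ (e ∷ []) (e∈F ∷ [])
        , remove-conservative [] (subst ConservativeFlow (sym (Subset.p─⊥≡p (F - e))) conservative)
  exists-walk (suc m) {e} {j} F ∣F∣≤1+m flow@(e∈F , balance , _) | inj₁ (u , tgt≡)
    with leaving-edge flow tgt≡
  ... | f , f∈F , tgt≡f with flow-tail flow f∈F tgt≡f
  ...   | flow′ with exists-walk m (F - e) (ℕ.≤-pred (ℕ.≤-trans (Subset.x∈p⇒∣p-x∣<∣p∣ e∈F) ∣F∣≤1+m)) flow′
  ...     | [] , _ , ((() , _) , _) , _
  ...     | f′ ∷ P , ∣P∣≤ , (path@(refl , _) , unique) , P⊆ , conservative =
        e ∷ f ∷ P , ℕ.≤-trans (s≤s ∣P∣≤) (Subset.x∈p⇒∣p-x∣<∣p∣ e∈F)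
        , (path-∷ tgt≡f path , All.map (λ y∈ e≡y → proj₂ (∈-remove y∈) (sym e≡y)) P⊆′ ∷ unique)
        , All⇒⊆ (e ∷ f ∷ P) (e∈F ∷ All.map (proj₁ ∘ ∈-remove) P⊆′)
        , remove-conservative (f ∷ P) conservative
    where
    P⊆′ : All (_∈ˢ F - e) (f ∷ P)
    P⊆′ = ⊆⇒All (f ∷ P) P⊆

  walkOf-decomposes : ∀ {e j F} → EdgeFlow e j F → Decomposes e j F (walkOf e j F)
  walkOf-decomposes {e} {j} {F} flow = found (exists-walk ∣ F ∣ F ℕ.≤-refl flow)
    where
    found : (∃ λ P → length P ≤ ∣ F ∣ × Decomposes e j F P) → Decomposes e j F (walkOf e j F)
    found (P , ∣P∣≤∣F∣ , decomposes) = head-filter (decomposes? e j F) []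
      (∈-concatMap⁺ (words edges) (lose (∈-upTo⁺ (s≤s (ℕ.≤-trans ∣P∣≤∣F∣ (Subset.∣p∣≤n F)))) (∈-words P))) decomposes

  last-boundary : ∀ {e j} → Path e j (e ∷ []) → tgt e ≡ boundary j
  last-boundary (_ , _ , ends) = Maybe.just-injective ends

  next-≡ : ∀ {e f g j F} → EdgeFlow e j F → tgt e ≡ src f → tgt e ≡ src g → f ∈ˢ F → g ∈ˢ F → f ≡ g
  next-≡ {e} {f} {g} {j} {F} (_ , balance , _) tgt≡f tgt≡g f∈F g∈F with consecutive-inner {e} {f} tgt≡f
  ... | u , src≡ = Out.count-unique {F}
    (balanced≤1 F u (balance u (λ eq → edge-nondegenerate e (sym (trans tgt≡f (trans src≡ eq))))))
    f∈F g∈F src≡ (trans (sym tgt≡g) (trans tgt≡f src≡))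

  -- By `next-≡` the continuation is forced at every step. Deleting the edge just passed gives a
  -- flow at the next one, and distinctness of the edges keeps the two tails inside it.
  unique-walk : ∀ {e j F} P Q → EdgeFlow e j F → LoopErasedWalk e j P → LoopErasedWalk e j Q →
    All (_∈ˢ F) P → All (_∈ˢ F) Q → P ≡ Q
  unique-walk [] _ _ ((() , _) , _) _ _ _
  unique-walk (_ ∷ _) [] _ _ ((() , _) , _) _ _
  unique-walk (e ∷ []) (_ ∷ []) _ ((refl , _) , _) ((refl , _) , _) _ _ = refl
  unique-walk (e ∷ []) (_ ∷ g ∷ Q) _ (p@(refl , _) , _) ((refl , tgt≡ ∷ _ , _) , _) _ _ =
    ⊥-elim (boundary-one-way {e} {g} (last-boundary p) (trans (sym tgt≡) (last-boundary p)))
  unique-walk (e ∷ f ∷ P) (_ ∷ []) _ ((refl , tgt≡ ∷ _ , _) , _) (q@(refl , _) , _) _ _ =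
    ⊥-elim (boundary-one-way {e} {f} (last-boundary q) (trans (sym tgt≡) (last-boundary q)))
  unique-walk {F = F} (e ∷ f ∷ P) (_ ∷ g ∷ Q) flow (p@(refl , tgt≡f ∷ _ , _) , e∉P ∷ uniqueP) ((refl , tgt≡g ∷ linked , ends) , e∉Q ∷ uniqueQ)
    (_ ∷ P⊆F@(f∈F ∷ _)) (_ ∷ Q⊆F@(g∈F ∷ _)) =
    cong (e ∷_) (unique-walk (f ∷ P) (g ∷ Q) (flow-tail flow f∈F tgt≡f) (path-tail p , uniqueP)
      ((cong just (next-≡ flow tgt≡g tgt≡f g∈F f∈F) , linked , ends) , uniqueQ) (shrink P⊆F e∉P) (shrink Q⊆F e∉Q))
    where
    shrink : ∀ {xs} → All (_∈ˢ F) xs → All (e ≢_) xs → All (_∈ˢ F - e) xs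
    shrink xs⊆F e∉xs = All.zipWith (λ (x∈F , e≢x) → Subset.x∈p∧x≢y⇒x∈p-y x∈F (e≢x ∘ sym)) (xs⊆F , e∉xs)

  decomposition-unique : ∀ {e j F P Q} → EdgeFlow e j F → LoopErasedWalk e j P → All (_∈ˢ F) P →
    Decomposes e j F Q → Q ≡ P
  decomposition-unique {P = P} {Q} flow walk P⊆F (walk′ , ⊆F , _) = unique-walk Q P flow walk′ walk (⊆⇒All Q ⊆F) P⊆F

  walkOf-unique : ∀ {e j F P} → EdgeFlow e j F → LoopErasedWalk e j P → All (_∈ˢ F) P → walkOf e j F ≡ P
  walkOf-unique flow walk P⊆F = decomposition-unique flow walk P⊆F (walkOf-decomposes flow)

  decomposes-∷ : ∀ {e f j F} Q → EdgeFlow e j F → tgt e ≡ src f → Decomposes f j (F - e) Q →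
    LoopErasedWalk e j (e ∷ Q) × All (_∈ˢ F) (e ∷ Q)
  decomposes-∷ []      _ _ (((() , _) , _) , _)
  decomposes-∷ {e} {f} {j} {F} (_ ∷ P) flow@(e∈F , _) tgt≡ ((path@(refl , _) , unique) , ⊆F-e , _) =
    (path-∷ tgt≡ path , All.map (λ y∈ e≡y → proj₂ (∈-remove y∈) (sym e≡y)) P⊆ ∷ unique) ,
    e∈F ∷ All.map (proj₁ ∘ ∈-remove) P⊆
    where
    P⊆ : All (_∈ˢ F - e) (f ∷ P)
    P⊆ = ⊆⇒All (f ∷ P) ⊆F-e

  -- The walk found in `F - e` extends by e to a walk with distinct edges in F, and the search in F
  -- can find no other.
  walkOf-∷ : ∀ {e f j F} → EdgeFlow e j F → f ∈ˢ F → tgt e ≡ src f → walkOf e j F ≡ e ∷ walkOf f j (F - e)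
  walkOf-∷ {e} {f} {j} {F} flow f∈F tgt≡ =
    let walk , ⊆F = decomposes-∷ (walkOf f j (F - e)) flow tgt≡ (walkOf-decomposes (flow-tail flow f∈F tgt≡))
    in walkOf-unique flow walk ⊆F

  walkOf-last : ∀ {e j F} → EdgeFlow e j F → tgt e ≡ boundary j → walkOf e j F ≡ e ∷ []
  walkOf-last flow@(e∈F , _) tgt≡ = walkOf-unique flow ((refl , [-] , cong just tgt≡) , [] ∷ []) (e∈F ∷ [])

  -- At the white vertex where e arrives the flow leaves along both f and g.
  record Fork (j : Fin n) (F : Subset edges) (e f g : Edge) : Set where
    field
      e∈F    : e ∈ˢ F
      f∈F    : f ∈ˢ F
      g∈F    : g ∈ˢ F
      f≢g    : f ≢ g
      tgt≡f  : tgt e ≡ src f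
      tgt≡g  : tgt e ≡ src g
      flow-f : EdgeFlow f j F
      only-e : ∀ {x} → x ∈ˢ F → tgt x ≡ tgt e → x ≡ e
      only-f-g : ∀ {x} → x ∈ˢ F → src x ≡ tgt e → x ≡ f ⊎ x ≡ g

    -- As f and g start at the same vertex, the balance conditions coincide. The exception made for
    -- f at boundary sources is void, because f starts where e ends.
    flow-g : EdgeFlow g j F
    flow-g = let _ , balance , unit , sources , sink = flow-f in
        g∈F
      , (λ v v≢src → balance v (λ eq → v≢src (trans eq (trans (sym tgt≡f) tgt≡g))))
      , subst (λ v → suc (arriving F v) ≡ leaving F v) (trans (sym tgt≡f) tgt≡g) unit
      , (λ x x∈F i source incident → contradiction incident (not-incident x x∈F i source))
      , sink
      where
      not-incident : ∀ x → x ∈ˢ F → ∀ i → IsSource i → ¬ Incident (boundary i) x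
      not-incident x x∈F i source (inj₂ tgt-x) = source-not-entered source tgt-x
      not-incident x x∈F i source (inj₁ src-x) with proj₁ (proj₂ (proj₂ (proj₂ flow-f))) x x∈F i source (inj₁ src-x)
      ... | refl = boundary-one-way {e} {f} (trans tgt≡f src-x) src-x

    one-out : ∀ {x y} → x ∈ˢ F → y ∈ˢ F → Inner (src x) → src x ≢ tgt e → src x ≡ src y → x ≡ y
    one-out {x} {y} x∈F y∈F (u , src≡) src≢ x≡y = Out.count-unique {F}
      (balanced≤1 F u (proj₁ (proj₂ flow-f) u (λ eq → src≢ (trans src≡ (trans eq (sym tgt≡f))))))
      x∈F y∈F src≡ (trans (sym x≡y) src≡)

  swap-fork : ∀ {j F e f g} → Fork j F e f g → Fork j F e g f
  swap-fork fork = record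
    { e∈F = e∈F ; f∈F = g∈F ; g∈F = f∈F ; f≢g = f≢g ∘ sym ; tgt≡f = tgt≡g ; tgt≡g = tgt≡f ; flow-f = flow-g
    ; only-e = only-e ; only-f-g = λ x∈F src≡ → Sum.swap (only-f-g x∈F src≡) }
    where open Fork fork

  -- At the start of f one more edge leaves than arrives, and e arrives; so at least two leave and
  -- the outdegree is not 1. By `narrow` the indegree is 1, which fixes the numbers of arriving and
  -- leaving edges to one and two.
  make-fork : ∀ {j F e f} → EdgeFlow f j F → e ∈ˢ F → tgt e ≡ src f → ∃ λ g → Fork j F e f g
  make-fork {j} {F} {e} {f} flow@(f∈F , balance , unit , _) e∈F tgt≡f with consecutive-inner {e} {f} tgt≡f
  ... | u , src≡ = g , record
    { e∈F = e∈F ; f∈F = f∈F ; g∈F = proj₁ (∈-remove g∈) ; f≢g = proj₂ (∈-remove g∈) ∘ sym ; tgt≡f = tgt≡f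
    ; tgt≡g = trans tgt≡f (trans src≡ (sym src-g)) ; flow-f = flow
    ; only-e = λ x∈F eq → In.count-unique {F} arriving≤1 x∈F e∈F (trans eq tgt-e) tgt-e
    ; only-f-g = λ x∈F eq → Out.count-pair {F} leaving≤2 f∈F (proj₁ (∈-remove g∈)) x∈F (proj₂ (∈-remove g∈) ∘ sym)
        src≡ src-g (trans eq tgt-e) }
    where
    tgt-e : tgt e ≡ inner u
    tgt-e = trans tgt≡f src≡
    unit′ : suc (arriving F (inner u)) ≡ leaving F (inner u)
    unit′ = subst (λ v → suc (arriving F v) ≡ leaving F v) src≡ unit
    arrives : 1 ≤ arriving F (inner u)
    arrives = In.count-positive {F} e∈F tgt-e
    arriving≤1 : arriving F (inner u) ≤ 1
    arriving≤1 with narrow u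
    ... | inj₁ eq = subst (arriving F (inner u) ≤_) eq (In.count≤ F (inner u))
    ... | inj₂ eq = contradiction
      (ℕ.≤-trans (s≤s arrives) (ℕ.≤-trans (ℕ.≤-reflexive unit′) (ℕ.≤-trans (Out.count≤ F (inner u)) (ℕ.≤-reflexive eq))))
      λ { (s≤s ()) }
    leaving≤2 : leaving F (inner u) ≤ 2
    leaving≤2 = subst (_≤ 2) unit′ (s≤s arriving≤1)
    leaving≡2 : leaving F (inner u) ≡ 2
    leaving≡2 = trans (sym unit′) (cong suc (ℕ.≤-antisym arriving≤1 arrives))
    other : ∃ λ g → g ∈ˢ F - f × src g ≡ inner u
    other = Out.count-witness {F - f} (ℕ.suc-injective (trans (sym (Out.count-hit {F} {f} f∈F src≡)) leaving≡2))
    g = proj₁ other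
    g∈ = proj₁ (proj₂ other)
    src-g = proj₂ (proj₂ other)

module UniqueLists where
  open Notation

  unique-++⁻ : ∀ {a} {A : Set a} (xs : List A) {ys} → Unique (xs ++ ys) →
    Unique xs × Unique ys × All (λ x → All (x ≢_) ys) xs
  unique-++⁻ []       unique = [] , unique , []
  unique-++⁻ (x ∷ xs) (x∉ ∷ unique) with unique-++⁻ xs unique
  ... | unique₁ , unique₂ , disjoint = All.++⁻ˡ xs x∉ ∷ unique₁ , unique₂ , All.++⁻ʳ xs x∉ ∷ disjoint

  unique-map : ∀ {a b} {A : Set a} {B : Set b} (f : A → B) {xs} →
    (∀ {x y} → x ∈ xs → y ∈ xs → f x ≡ f y → x ≡ y) → Unique xs → Unique (map f xs)
  unique-map f inj []               = []
  unique-map f inj (x∉xs ∷ unique) =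
    All.map⁺ (All.tabulate (λ y∈ fx≡fy → All.lookup x∉xs y∈ (inj (here refl) (there y∈) fx≡fy)))
    ∷ unique-map f (λ x∈ y∈ → inj (there x∈) (there y∈)) unique

module ForkSigns {c ℓ₁ ℓ₂} {𝕂 : OrderedField c ℓ₁ ℓ₂} {k n : ℕ} (G : PlabicGraph 𝕂 k n) (𝔩 : GaugeRayDirection G) where
  open Notation
  open PlabicGraph G
  open Planarity G using (Inner)
  open GaugeRayDirection 𝔩
  open SubsetProperties
  open UniqueLists
  open Flows G
  open Walks G
  open CycleSigns G 𝔩 using (τ; ι; pathSign-++; cycle-sign)

  predecessor : ∀ x X {y} → Linked Consecutive (x ∷ X) → y ∈ X → ∃ λ z → z ∈ x ∷ X × tgt z ≡ src y
  predecessor x (y ∷ X) (tgt≡ ∷ _)   (here refl) = x , here refl , tgt≡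
  predecessor x (_ ∷ X) (_ ∷ linked) (there y∈)  with predecessor _ X linked y∈
  ... | z , z∈ , tgt≡ = z , there z∈ , tgt≡

  inner-sources : ∀ x X → Linked Consecutive (x ∷ X) → All (Inner ∘ src) X
  inner-sources x []      _               = []
  inner-sources x (y ∷ X) (tgt≡ ∷ linked) = consecutive-inner {x} {y} tgt≡ ∷ inner-sources y X linked

  -- A cut of the walk just after e. For x = g the part before the cut closes up to the cycle
  -- through e.
  record SplitAt (e : Edge) (j : Fin n) (x : Edge) (X : List Edge) : Set where
    field
      {loop rest} : List Edge
      {next}      : Edge
      parts       : X ≡ loop ++ next ∷ rest
      ends-at-e   : final x loop ≡ e
      loop-linked : Linked Consecutive (x ∷ loop)
      junction    : tgt e ≡ src next
      rest-path   : Path next j (next ∷ rest)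

  split-at : ∀ {e j} x X → Inner (tgt e) → Linked Consecutive (x ∷ X) → EndsAt (boundary j) (x ∷ X) → e ∈ x ∷ X → SplitAt e j x X
  split-at x []      (u , tgt≡) linked ends (here refl) = contradiction (trans (sym tgt≡) (Maybe.just-injective ends)) λ ()
  split-at x (y ∷ X) _ (tgt≡ ∷ linked) ends (here refl) = record
    { parts = refl ; ends-at-e = refl ; loop-linked = [-] ; junction = tgt≡ ; rest-path = refl , linked , ends }
  split-at x (y ∷ X) inner-tgt (tgt≡ ∷ linked) ends (there e∈) = record
    { parts = cong (y ∷_) parts ; ends-at-e = ends-at-e ; loop-linked = tgt≡ ∷ loop-linked
    ; junction = junction ; rest-path = rest-path }
    where open SplitAt (split-at y X inner-tgt linked ends e∈)

  module _ {j F e f g} (fork : Fork j F e f g) where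
    open Fork fork

    inner-tgt : Inner (tgt e)
    inner-tgt = let u , eq = consecutive-inner {e} {f} tgt≡f in u , trans tgt≡f eq

    cancel-split : ∀ P X → LoopErasedWalk f j P → All (_∈ˢ F) P → Unique (g ∷ X) → All (_∈ˢ F) (g ∷ X) → SplitAt e j g X →
      τ e f ℤ.* pathSign P ℤ.+ τ e g ℤ.* pathSign (g ∷ X) ≡ ℤ.0ℤ
    cancel-split P _ walkP P⊆F unique Q⊆F
      record { loop = loop ; rest = rest ; next = next ; parts = refl ; ends-at-e = ends-at-e
             ; loop-linked = loop-linked ; junction = junction ; rest-path = rest-path } =
      conclude (only-f-g (All.head rest⊆F) (sym junction))
      where
      unique-loop = proj₁ (unique-++⁻ (g ∷ loop) unique)
      unique-rest = proj₁ (proj₂ (unique-++⁻ (g ∷ loop) unique))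
      disjoint = proj₂ (proj₂ (unique-++⁻ (g ∷ loop) unique))
      loop⊆F : All (_∈ˢ F) (g ∷ loop)
      loop⊆F = All.++⁻ˡ (g ∷ loop) Q⊆F
      rest⊆F : All (_∈ˢ F) (next ∷ rest)
      rest⊆F = All.++⁻ʳ (g ∷ loop) Q⊆F
      conclude : next ≡ f ⊎ next ≡ g → τ e f ℤ.* pathSign P ℤ.+ τ e g ℤ.* pathSign (g ∷ loop ++ next ∷ rest) ≡ ℤ.0ℤ
      -- Here g would occur twice in a walk with distinct edges.
      conclude (inj₂ refl) = contradiction refl (All.head (All.head disjoint))
      conclude (inj₁ refl) = trans (cong (λ z → τ e f ℤ.* pathSign P ℤ.+ τ e g ℤ.* z) sign-Q)
        (cancelled (τ e f) (pathSign P) (τ e g) (pathSign (g ∷ loop)) loop-sign)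
        where
        -- After the loop the walk goes on along f inside F, so uniqueness identifies the remainder
        -- with the walk P from f.
        P≡ : f ∷ rest ≡ P
        P≡ = unique-walk (f ∷ rest) P flow-f (rest-path , unique-rest) walkP rest⊆F P⊆F
        -- Away from the fork at most one edge of F leaves each vertex. At the fork only g belongs
        -- to the loop, since f comes after it and the edges are distinct.
        injective : ∀ {x y} → x ∈ g ∷ loop → y ∈ g ∷ loop → src x ≡ src y → x ≡ y
        injective {x} {y} x∈ y∈ eq with src x ≟ⱽ tgt e
        ... | no src≢ = one-out (All.lookup loop⊆F x∈) (All.lookup loop⊆F y∈) (All.lookup inner-loop x∈) src≢ eq
          where
          inner-loop : All (Inner ∘ src) (g ∷ loop)
          inner-loop = consecutive-inner {e} {g} tgt≡g ∷ inner-sources g loop loop-linked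
        ... | yes src≡ with only-f-g (All.lookup loop⊆F x∈) src≡ | only-f-g (All.lookup loop⊆F y∈) (trans (sym eq) src≡)
        ...   | inj₂ refl | inj₂ refl = refl
        ...   | inj₁ refl | _         = contradiction refl (All.head (All.lookup disjoint x∈))
        ...   | inj₂ refl | inj₁ refl = contradiction refl (All.head (All.lookup disjoint y∈))
        -- The coefficient `τ e g` of the second term is just the turn that closes the loop.
        loop-sign : pathSign (g ∷ loop) ℤ.* τ e g ≡ ℤ.-1ℤ
        loop-sign = trans (cong (λ z → pathSign (g ∷ loop) ℤ.* τ z g) (sym ends-at-e))
          (cycle-sign g loop loop-linked (trans (cong tgt ends-at-e) tgt≡g) (unique-map src injective unique-loop)
            (consecutive-inner {e} {g} tgt≡g ∷ inner-sources g loop loop-linked))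
        sign-Q : pathSign (g ∷ loop ++ f ∷ rest) ≡ pathSign (g ∷ loop) ℤ.* τ e f ℤ.* pathSign P
        sign-Q = trans (pathSign-++ g loop f rest)
          (cong₂ (λ z P → pathSign (g ∷ loop) ℤ.* τ z f ℤ.* pathSign P) ends-at-e P≡)
        cancelled : ∀ t p s a → a ℤ.* s ≡ ℤ.-1ℤ → t ℤ.* p ℤ.+ s ℤ.* (a ℤ.* t ℤ.* p) ≡ ℤ.0ℤ
        cancelled t p s a as≡-1 = trans (solve 4 (λ t p s a → t :* p :+ s :* (a :* t :* p) := t :* p :+ (a :* s) :* (t :* p)) refl t p s a)
          (trans (cong (λ z → t ℤ.* p ℤ.+ z ℤ.* (t ℤ.* p)) as≡-1) (solve 2 (λ t p → t :* p :+ con ℤ.-1ℤ :* (t :* p) := con ℤ.0ℤ) refl t p))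
          where
            open +-*-Solver

    cancel-through : ∀ P Q → LoopErasedWalk f j P → All (_∈ˢ F) P → LoopErasedWalk g j Q → All (_∈ˢ F) Q → e ∈ Q →
      τ e f ℤ.* pathSign P ℤ.+ τ e g ℤ.* pathSign Q ≡ ℤ.0ℤ
    cancel-through P [] _ _ _ _ ()
    cancel-through P (_ ∷ X) walkP P⊆F ((refl , linked , ends) , unique) Q⊆F e∈Q =
      cancel-split P X walkP P⊆F unique Q⊆F (split-at g X inner-tgt linked ends e∈Q)

    -- On P the edge g could be preceded only by e, so g lies in the conservative remainder of P.
    -- From there the continuation along Q is forced and stays in the remainder, but Q ends at the
    -- boundary, which a conservative flow does not reach.
    avoiding-impossible : ∀ P Q → Decomposes f j F P → LoopErasedWalk g j Q → All (_∈ˢ F) Q → ¬ e ∈ P → ¬ e ∈ Q → ⊥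
    avoiding-impossible [] _ (((() , _) , _) , _) _ _ _ _
    avoiding-impossible _ [] _ ((() , _) , _) _ _ _
    avoiding-impossible P@(_ ∷ T) Q@(_ ∷ X) (((refl , linkedP , _) , _) , P⊆ , outside-disk , balance)
      ((refl , linked , ends) , _) Q⊆F e∉P e∉Q = follow g X linked g∈C Q⊆F (All.tabulate λ {x} x∈ x≡e → e∉Q (subst (_∈ Q) x≡e x∈)) ends
      where
      C = F ─ support P
      g∉P : ¬ g ∈ P
      g∉P (here refl) = f≢g refl
      g∉P (there g∈T) with predecessor f T linkedP g∈T
      ... | z , z∈P , tgt-z = e∉P (subst (_∈ P) (only-e (All.lookup (⊆⇒All P P⊆) z∈P) (trans tgt-z (sym tgt≡g))) z∈P)
      g∈C : g ∈ˢ C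
      g∈C = Subset.x∈p∧x∉q⇒x∈p─q g∈F (g∉P ∘ support-∈ P)
      follow : ∀ x X → Linked Consecutive (x ∷ X) → x ∈ˢ C → All (_∈ˢ F) (x ∷ X) → All (_≢ e) (x ∷ X) →
        EndsAt (boundary j) (x ∷ X) → ⊥
      follow x []      _               x∈C _         _            ends = outside-disk x x∈C j (inj₂ (Maybe.just-injective ends))
      follow x (y ∷ X) (tgt≡ ∷ linked) x∈C (x∈F ∷ X⊆F) (x≢e ∷ X≢e) ends with consecutive-inner {x} {y} tgt≡
      ... | v , src≡ with In.count-hit {C} {x} x∈C (trans tgt≡ src≡)
      ...   | arrivals with Out.count-witness {C} (trans (sym (balance v)) arrivals)
      ...     | y′ , y′∈C , src-y′ = follow y X linked (subst (_∈ˢ C) y′≡y y′∈C) X⊆F X≢e ends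
        where
        y′≡y : y′ ≡ y
        y′≡y = one-out (Subset.p─q⊆p F (support P) y′∈C) (All.head X⊆F) (v , src-y′)
          (λ eq → x≢e (only-e x∈F (trans tgt≡ (trans src≡ (trans (sym src-y′) eq))))) (trans src-y′ (sym src≡))

  fork-cancel : ∀ {j F e f g} → Fork j F e f g →
    τ e f ℤ.* pathSign (walkOf f j F) ℤ.+ τ e g ℤ.* pathSign (walkOf g j F) ≡ ℤ.0ℤ
  fork-cancel {j} {F} {e} {f} {g} fork =
    go (walkOf f j F) (walkOf g j F) (walkOf-decomposes flow-f) (walkOf-decomposes flow-g)
    where
    open Fork fork
    go : ∀ P Q → Decomposes f j F P → Decomposes g j F Q → τ e f ℤ.* pathSign P ℤ.+ τ e g ℤ.* pathSign Q ≡ ℤ.0ℤ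
    go P Q dP@(walkP , P⊆ , _) dQ@(walkQ , Q⊆ , _) with memberOf Fin._≟_ e P | memberOf Fin._≟_ e Q
    ... | _       | yes e∈Q = cancel-through fork P Q walkP (⊆⇒All P P⊆) walkQ (⊆⇒All Q Q⊆) e∈Q
    ... | yes e∈P | no _    = trans (ℤ.+-comm (τ e f ℤ.* pathSign P) (τ e g ℤ.* pathSign Q))
            (cancel-through (swap-fork fork) Q P walkQ (⊆⇒All Q Q⊆) walkP (⊆⇒All P P⊆) e∈P)
    ... | no e∉P  | no e∉Q  = ⊥-elim (avoiding-impossible fork P Q dP walkQ (⊆⇒All Q Q⊆) e∉P e∉Q)

-- The recursion in the first edge

module Exponents where
  open Notation
  open PowerSeries
  open SubsetProperties
  open Summation

  zeros : ∀ {E} → Exponent E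
  zeros = replicate _ 0

  δ : ∀ {E} → Fin E → Exponent E
  δ e = indicator ⁅ e ⁆

  zeros-⊞ : ∀ {E} (ν : Exponent E) → zeros ⊞ ν ≡ ν
  zeros-⊞ = Vec.zipWith-identityˡ ℕ.+-identityˡ

  ⊞-zeros : ∀ {E} (ν : Exponent E) → ν ⊞ zeros ≡ ν
  ⊞-zeros = Vec.zipWith-identityʳ ℕ.+-identityʳ

  indicator-empty : ∀ {E} → indicator (empty {E}) ≡ zeros
  indicator-empty {zero}  = refl
  indicator-empty {suc E} = cong (0 ∷_) indicator-empty

  indicator-injective : ∀ {E} {F F′ : Subset E} → indicator F ≡ indicator F′ → F ≡ F′
  indicator-injective {F = []}          {[]}           _  = refl
  indicator-injective {F = inside  ∷ F} {inside  ∷ F′} eq = cong (inside ∷_) (indicator-injective (Vec.∷-injectiveʳ eq))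
  indicator-injective {F = outside ∷ F} {outside ∷ F′} eq = cong (outside ∷_) (indicator-injective (Vec.∷-injectiveʳ eq))
  indicator-injective {F = inside  ∷ F} {outside ∷ F′} eq = contradiction (Vec.∷-injectiveˡ eq) λ ()
  indicator-injective {F = outside ∷ F} {inside  ∷ F′} eq = contradiction (Vec.∷-injectiveˡ eq) λ ()

  indicator-remove : ∀ {E} {F : Subset E} {e} → e ∈ˢ F → δ e ⊞ indicator (F - e) ≡ indicator F
  indicator-remove {F = inside  ∷ F} here        = cong (1 ∷_) (trans (cong (_⊞ indicator (F ─ empty)) indicator-empty)
    (trans (zeros-⊞ (indicator (F ─ empty))) (cong indicator (Subset.p─⊥≡p F))))
  indicator-remove {F = inside  ∷ F} (there e∈F) = cong (1 ∷_) (indicator-remove e∈F)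
  indicator-remove {F = outside ∷ F} (there e∈F) = cong (0 ∷_) (indicator-remove e∈F)

  -- The exponent at e is 2. Edge flows thus contribute nothing at such monomials, and there the
  -- recursion has to produce 0 by cancellation.
  not-indicator : ∀ {E} {F F′ : Subset E} {e} → e ∈ˢ F → indicator F′ ≢ δ e ⊞ indicator F
  not-indicator {F = inside ∷ F} {inside  ∷ F′} here        eq = contradiction (Vec.∷-injectiveˡ eq) λ ()
  not-indicator {F = inside ∷ F} {outside ∷ F′} here        eq = contradiction (Vec.∷-injectiveˡ eq) λ ()
  not-indicator {F = _ ∷ F}      {_ ∷ F′}       (there e∈F) eq = not-indicator e∈F (Vec.∷-injectiveʳ eq)

  sum-⊞ : ∀ {E} (α β : Exponent E) → Vec.sum (α ⊞ β) ≡ Vec.sum α + Vec.sum β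
  sum-⊞ []      []      = refl
  sum-⊞ (a ∷ α) (b ∷ β) = trans (cong (_+_ (a + b)) (sum-⊞ α β))
    (solve 4 (λ a b x y → a :+ b :+ (x :+ y) := a :+ x :+ (b :+ y)) refl a b (Vec.sum α) (Vec.sum β))
    where
    open NatSolver.+-*-Solver

  sum-zeros : ∀ E → Vec.sum (zeros {E}) ≡ 0
  sum-zeros zero    = refl
  sum-zeros (suc E) = sum-zeros E

  sum-δ : ∀ {E} (e : Fin E) → Vec.sum (δ e) ≡ 1
  sum-δ {suc E} Fin.zero    = cong suc (trans (cong Vec.sum (indicator-empty {E})) (sum-zeros E))
  sum-δ {suc E} (Fin.suc e) = sum-δ e

  sum≡0⇒zeros : ∀ {E} (ν : Exponent E) → Vec.sum ν ≡ 0 → ν ≡ zeros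
  sum≡0⇒zeros []      _  = refl
  sum≡0⇒zeros (a ∷ ν) eq = cong₂ _∷_ (ℕ.m+n≡0⇒m≡0 a eq) (sum≡0⇒zeros ν (ℕ.m+n≡0⇒n≡0 a eq))

  multiplicity-[] : ∀ E → multiplicity {E} [] ≡ zeros
  multiplicity-[] zero    = refl
  multiplicity-[] (suc E) = cong (0 ∷_) (multiplicity-[] E)

  lookup-ext : ∀ {E} {α β : Exponent E} → (∀ i → Vec.lookup α i ≡ Vec.lookup β i) → α ≡ β
  lookup-ext {α = α} {β} eq = trans (sym (Vec.tabulate∘lookup α)) (trans (Vec.tabulate-cong eq) (Vec.tabulate∘lookup β))

  lookup-δ : ∀ {E} (e i : Fin E) → Vec.lookup (δ e) i ≡ (if does (i Fin.≟ e) then 1 else 0)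
  lookup-δ e i = trans (Vec.lookup-map i _ ⁅ e ⁆) (cong (if_then 1 else 0) (member (i Fin.≟ e)))
    where
    member : ∀ (d : Dec (i ≡ e)) → Vec.lookup ⁅ e ⁆ i ≡ does d
    member (yes refl) = Vec.[]=⇒lookup (Subset.x∈⁅x⁆ i)
    member (no i≢e) with Vec.lookup ⁅ e ⁆ i in eq
    ... | outside = refl
    ... | inside  = contradiction (Subset.x∈⁅y⁆⇒x≡y e (Vec.lookup⇒[]= i ⁅ e ⁆ eq)) i≢e

  multiplicity-∷ : ∀ {E} (e : Fin E) P → multiplicity (e ∷ P) ≡ δ e ⊞ multiplicity P
  multiplicity-∷ e P = lookup-ext λ i → begin
    Vec.lookup (multiplicity (e ∷ P)) i ≡⟨ Vec.lookup∘tabulate _ i ⟩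
    length (filter (i Fin.≟_) (e ∷ P)) ≡⟨ filter-∷ i ⟩
    (if does (i Fin.≟ e) then 1 else 0) + length (filter (i Fin.≟_) P)
      ≡⟨ cong₂ _+_ (lookup-δ e i) (Vec.lookup∘tabulate (λ i → length (filter (i Fin.≟_) P)) i) ⟨
    Vec.lookup (δ e) i + Vec.lookup (multiplicity P) i
      ≡⟨ Vec.lookup-zipWith _+_ i (δ e) (multiplicity P) ⟨
    Vec.lookup (δ e ⊞ multiplicity P) i ∎
    where
    open ≡-Reasoning
    filter-∷ : ∀ i → length (filter (i Fin.≟_) (e ∷ P)) ≡ (if does (i Fin.≟ e) then 1 else 0) + length (filter (i Fin.≟_) P)
    filter-∷ i with does (i Fin.≟ e)
    ... | true  = refl
    ... | false = refl

  𝟙 : ∀ {E} → Series E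
  𝟙 ν = guard (zeros ≟ᵉ ν) 1ℤ

  act-𝟙 : ∀ {E} (q : Polynomial E) → act q 𝟙 ≗ toSeries q
  act-𝟙 q μ = trans (∑-cong q (λ (a , α) → term a α (divides? α μ))) (sym (toSeries-∑ q μ))
    where
    term : ∀ a α → Dec (Divides α μ) → a ℤ.* shift α 𝟙 μ ≡ guard (α ≟ᵉ μ) a
    term a α (no ¬α) = trans (cong (ℤ._*_ a) (shift-no α 𝟙 ¬α)) (trans (ℤ.*-zeroʳ a)
      (sym (guard-no (α ≟ᵉ μ) (λ eq → ¬α (zeros , trans (⊞-zeros α) eq)))))
    term a α (yes (ν , refl)) = trans (cong (ℤ._*_ a) (shift-yes α 𝟙 ν)) (trans (sym (guard-1 (zeros ≟ᵉ ν) a))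
      (guard-⇔ (zeros ≟ᵉ ν) (α ≟ᵉ (α ⊞ ν)) (λ { refl → sym (⊞-zeros α) })
        (λ eq → ⊞-cancel α (trans (⊞-zeros α) eq))))

  subsets-unique : ∀ m → Unique (subsets m)
  subsets-unique zero    = [] ∷ []
  subsets-unique (suc m) = Unique.++⁺ (Unique.map⁺ Vec.∷-injectiveʳ (subsets-unique m)) (Unique.map⁺ Vec.∷-injectiveʳ (subsets-unique m))
    λ (v∈ , v∈′) → disjoint (∈-map⁻ (outside ∷_) v∈) (∈-map⁻ (inside ∷_) v∈′)
    where
    disjoint : ∀ {m} {v : Subset (suc m)} {xs ys : List (Subset m)} →
      (∃ λ x → x ∈ xs × v ≡ outside ∷ x) → (∃ λ y → y ∈ ys × v ≡ inside ∷ y) → ⊥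
    disjoint (_ , _ , refl) (_ , _ , ())

  ∈-subsets : ∀ {m} (F : Subset m) → F ∈ subsets m
  ∈-subsets []            = here refl
  ∈-subsets (outside ∷ F) = ∈-++⁺ˡ (∈-map⁺ (outside ∷_) (∈-subsets F))
  ∈-subsets (inside ∷ F)  = ∈-++⁺ʳ _ (∈-map⁺ (inside ∷_) (∈-subsets F))

  module _ {m p} {Q : Subset m → Set p} (Q? : Decidable Q) (c : Subset m → ℤ) where
    -- The common form of `conservativeFlowPolynomial` and `edgeFlowPolynomial`. Distinct subsets
    -- have distinct indicators, so no two terms merge and the coefficients can be read off.
    subsetPolynomial : Polynomial m
    subsetPolynomial = map (λ F → c F , indicator F) (filter Q? (subsets m))

    private
      coefficients : ∀ μ → toSeries subsetPolynomial μ ≡ ∑ (subsets m) (λ F → guard (Q? F) (guard (indicator F ≟ᵉ μ) (c F)))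
      coefficients μ = trans (toSeries-∑ subsetPolynomial μ)
        (trans (∑-map (λ F → c F , indicator F) (λ (a , α) → guard (α ≟ᵉ μ) a) (filter Q? (subsets m)))
          (∑-filter Q? (λ F → guard (indicator F ≟ᵉ μ) (c F)) (subsets m)))

    coefficient-at : ∀ F → toSeries subsetPolynomial (indicator F) ≡ guard (Q? F) (c F)
    coefficient-at F = trans (coefficients (indicator F)) (trans
      (∑-single (subsets-unique m) (∈-subsets F) (λ {F′} _ F′≢F → guard-zero (Q? F′)
        (guard-no (indicator F′ ≟ᵉ indicator F) (F′≢F ∘ indicator-injective))))
      (cong (guard (Q? F)) (guard-yes (indicator F ≟ᵉ indicator F) refl)))

    coefficient-zero : ∀ {μ} → (∀ F → indicator F ≡ μ → ¬ Q F) → toSeries subsetPolynomial μ ≡ 0ℤ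
    coefficient-zero {μ} none = trans (coefficients μ) (∑-zero (All.universal (λ F → zero-term F (indicator F ≟ᵉ μ)) (subsets m)))
      where
      zero-term : ∀ F (d : Dec (indicator F ≡ μ)) → guard (Q? F) (guard (indicator F ≟ᵉ μ) (c F)) ≡ 0ℤ
      zero-term F (yes eq) = guard-no (Q? F) (none F eq)
      zero-term F (no neq) = guard-zero (Q? F) (guard-no (indicator F ≟ᵉ μ) neq)

module Recurrences {c ℓ₁ ℓ₂} {𝕂 : OrderedField c ℓ₁ ℓ₂} {k n : ℕ} (G : PlabicGraph 𝕂 k n) (𝔩 : GaugeRayDirection G) (j : Fin n) where
  open Notation
  open PlabicGraph G
  open Planarity G using (Inner)
  open GaugeRayDirection 𝔩
  open Flows G
  open Walks G
  open ForkSigns G 𝔩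
  open CycleSigns G 𝔩 using (τ; ι; pathSign-∷∷; pathSign-[-])
  open SubsetProperties
  open Summation
  open PowerSeries
  open Exponents

  -- The recursion for the series at e without its factor x_e. The argument s is the contribution of
  -- stopping after e: the constant 1 for paths, and C for flows.
  expand : Edge → Series edges → (Edge → Series edges) → Series edges
  expand e s t ν = ι e ℤ.* (guard (tgt e ≟ⱽ boundary j) (s ν)
    ℤ.+ ∑ (allFin edges) (λ f → guard (tgt e ≟ⱽ src f) (τ e f ℤ.* t f ν)))

  act-guard : ∀ {p} {P : Set p} (d : Dec P) (q : Polynomial edges) (f : Series edges) ν →
    act q (λ ν → guard d (f ν)) ν ≡ guard d (act q f ν)
  act-guard (yes _) q f ν = refl
  act-guard (no _)  q f ν = ∑-zero (All.universal (λ (a , α) → trans (cong (ℤ._*_ a) (guard-0 (divides? α ν))) (ℤ.*-zeroʳ a)) q)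

  act-expand : ∀ q e s t ν → act q (expand e s t) ν ≡ expand e (act q s) (λ f → act q (t f)) ν
  act-expand q e s t ν = begin
    act q (expand e s t) ν ≡⟨ act-* q (ι e) (λ ν → A ν ℤ.+ B ν) ν ⟩
    ι e ℤ.* act q (λ ν → A ν ℤ.+ B ν) ν ≡⟨ cong (ℤ._*_ (ι e)) (act-+ q A B ν) ⟩
    ι e ℤ.* (act q A ν ℤ.+ act q B ν) ≡⟨ cong (ℤ._*_ (ι e)) (cong₂ ℤ._+_ (act-guard (tgt e ≟ⱽ boundary j) q s ν)
          (trans (act-∑ q (λ f ν → guard (tgt e ≟ⱽ src f) (τ e f ℤ.* t f ν)) (allFin edges) ν)
          (∑-cong (allFin edges) (λ f → trans (act-guard (tgt e ≟ⱽ src f) q (λ ν → τ e f ℤ.* t f ν) ν)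
          (cong (guard (tgt e ≟ⱽ src f)) (act-* q (τ e f) (t f) ν)))))) ⟩
    expand e (act q s) (λ f → act q (t f)) ν ∎
    where
    open ≡-Reasoning
    A B : Series edges
    A ν = guard (tgt e ≟ⱽ boundary j) (s ν)
    B ν = ∑ (allFin edges) (λ f → guard (tgt e ≟ⱽ src f) (τ e f ℤ.* t f ν))

  module PathExpansion where
    PathOf : Edge → Exponent edges → List Edge → Set
    PathOf e μ P = Path e j P × multiplicity P ≡ μ

    pathOf? : ∀ e μ → Decidable (PathOf e μ)
    pathOf? e μ P = path? e j P ×-dec Vec.≡-dec ℕ._≟_ (multiplicity P) μ

    term : Edge → Exponent edges → List Edge → ℤ
    term e μ P = guard (pathOf? e μ P) (pathSign P)

    -- The path that stops after e has an empty tail and the exponent 0 left over; nonempty tails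
    -- are accounted for by the sum over f.
    end : Exponent edges → List Edge → ℤ
    end ν []      = 𝟙 ν
    end ν (_ ∷ _) = 0ℤ

    pathSeries-∑ : ∀ e μ → pathSeries e j μ ≡ ∑ (words edges (Vec.sum μ)) (term e μ)
    pathSeries-∑ e μ = ∑-filter (pathOf? e μ) pathSign (words edges (Vec.sum μ))

    words-head : ∀ m (f : List Edge → ℤ) e → (∀ e′ P → e′ ≢ e → f (e′ ∷ P) ≡ 0ℤ) →
      ∑ (words edges (suc m)) f ≡ ∑ (words edges m) (f ∘ (e ∷_))
    words-head m f e others = begin
      ∑ (words edges (suc m)) f
        ≡⟨ ∑-concatMap (λ e′ → map (e′ ∷_) (words edges m)) f (allFin edges) ⟩
      ∑ (allFin edges) (λ e′ → ∑ (map (e′ ∷_) (words edges m)) f)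
        ≡⟨ ∑-cong (allFin edges) (λ e′ → ∑-map (e′ ∷_) f (words edges m)) ⟩
      ∑ (allFin edges) (λ e′ → ∑ (words edges m) (f ∘ (e′ ∷_)))
        ≡⟨ ∑-single (Unique.allFin⁺ edges) (∈-allFin e)
            (λ {e′} _ e′≢e → ∑-zero (All.universal (λ P → others e′ P e′≢e) (words edges m))) ⟩
      ∑ (words edges m) (f ∘ (e ∷_)) ∎
      where open ≡-Reasoning

    term-other : ∀ e μ e′ P → e′ ≢ e → term e μ (e′ ∷ P) ≡ 0ℤ
    term-other e μ e′ P e′≢e = guard-no (pathOf? e μ (e′ ∷ P)) (λ ((head≡ , _) , _) → e′≢e (Maybe.just-injective head≡))

    term-[] : ∀ f ν → term f ν [] ≡ 0ℤ
    term-[] f ν = guard-no (pathOf? f ν []) {pathSign []} λ { ((() , _) , _) }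

    term-expand : ∀ e ν P → term e (δ e ⊞ ν) (e ∷ P) ≡ ι e ℤ.* (guard (tgt e ≟ⱽ boundary j) (end ν P)
      ℤ.+ ∑ (allFin edges) (λ f → guard (tgt e ≟ⱽ src f) (τ e f ℤ.* term f ν P)))
    term-expand e ν [] = begin
      guard (pathOf? e (δ e ⊞ ν) (e ∷ [])) (pathSign (e ∷ []))
        ≡⟨ guard-⇔ (pathOf? e (δ e ⊞ ν) (e ∷ [])) ((tgt e ≟ⱽ boundary j) ×-dec (zeros ≟ᵉ ν)) to from ⟩
      guard ((tgt e ≟ⱽ boundary j) ×-dec (zeros ≟ᵉ ν)) (pathSign (e ∷ []))
        ≡⟨ guard-× (tgt e ≟ⱽ boundary j) (zeros ≟ᵉ ν) _ ⟩
      guard (tgt e ≟ⱽ boundary j) (guard (zeros ≟ᵉ ν) (pathSign (e ∷ [])))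
        ≡⟨ cong (guard (tgt e ≟ⱽ boundary j)) (trans
            (cong (guard (zeros ≟ᵉ ν)) (trans (pathSign-[-] e) (sym (ℤ.*-identityʳ (ι e)))))
            (guard-* (zeros ≟ᵉ ν) (ι e) 1ℤ)) ⟩
      guard (tgt e ≟ⱽ boundary j) (ι e ℤ.* 𝟙 ν) ≡⟨ guard-* (tgt e ≟ⱽ boundary j) (ι e) (𝟙 ν) ⟩
      ι e ℤ.* guard (tgt e ≟ⱽ boundary j) (𝟙 ν) ≡⟨ cong (ℤ._*_ (ι e)) (ℤ.+-identityʳ _) ⟨
      ι e ℤ.* (guard (tgt e ≟ⱽ boundary j) (𝟙 ν) ℤ.+ 0ℤ)
        ≡⟨ cong (λ z → ι e ℤ.* (guard (tgt e ≟ⱽ boundary j) (𝟙 ν) ℤ.+ z))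
            (∑-zero (All.universal (λ f → trans (cong (guard (tgt e ≟ⱽ src f))
            (trans (cong (ℤ._*_ (τ e f)) (term-[] f ν)) (ℤ.*-zeroʳ (τ e f)))) (guard-0 (tgt e ≟ⱽ src f))) (allFin edges))) ⟨
      _ ∎
      where
      open ≡-Reasoning
      m≡ : multiplicity (e ∷ []) ≡ δ e ⊞ zeros
      m≡ = trans (multiplicity-∷ e []) (cong (δ e ⊞_) (multiplicity-[] edges))
      to : PathOf e (δ e ⊞ ν) (e ∷ []) → tgt e ≡ boundary j × zeros ≡ ν
      to ((_ , _ , ends) , eq) = Maybe.just-injective ends , ⊞-cancel (δ e) (trans (sym m≡) eq)
      from : tgt e ≡ boundary j × zeros ≡ ν → PathOf e (δ e ⊞ ν) (e ∷ [])
      from (tgt≡ , refl) = (refl , [-] , cong just tgt≡) , m≡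
    term-expand e ν (g ∷ P) = begin
      guard (pathOf? e (δ e ⊞ ν) (e ∷ g ∷ P)) (pathSign (e ∷ g ∷ P))
        ≡⟨ guard-⇔ (pathOf? e (δ e ⊞ ν) (e ∷ g ∷ P)) ((tgt e ≟ⱽ src g) ×-dec pathOf? g ν (g ∷ P)) to from ⟩
      guard ((tgt e ≟ⱽ src g) ×-dec pathOf? g ν (g ∷ P)) (pathSign (e ∷ g ∷ P))
        ≡⟨ guard-× (tgt e ≟ⱽ src g) (pathOf? g ν (g ∷ P)) _ ⟩
      guard (tgt e ≟ⱽ src g) (guard (pathOf? g ν (g ∷ P)) (pathSign (e ∷ g ∷ P)))
        ≡⟨ cong (guard (tgt e ≟ⱽ src g)) (trans
            (cong (guard (pathOf? g ν (g ∷ P))) (trans (pathSign-∷∷ e g P) (ℤ.*-assoc (ι e) (τ e g) _)))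
            (trans (guard-* (pathOf? g ν (g ∷ P)) (ι e) _)
            (cong (ℤ._*_ (ι e)) (guard-* (pathOf? g ν (g ∷ P)) (τ e g) _)))) ⟩
      guard (tgt e ≟ⱽ src g) (ι e ℤ.* (τ e g ℤ.* term g ν (g ∷ P))) ≡⟨ guard-* (tgt e ≟ⱽ src g) (ι e) _ ⟩
      ι e ℤ.* guard (tgt e ≟ⱽ src g) (τ e g ℤ.* term g ν (g ∷ P))
        ≡⟨ cong (ℤ._*_ (ι e)) (∑-single (Unique.allFin⁺ edges) (∈-allFin g) (λ {f} _ → others f)) ⟨
      ι e ℤ.* ∑ (allFin edges) summand
        ≡⟨ cong (ℤ._*_ (ι e)) (trans (cong (ℤ._+ ∑ (allFin edges) summand) (guard-0 (tgt e ≟ⱽ boundary j))) (ℤ.+-identityˡ _)) ⟨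
      _ ∎
      where
      open ≡-Reasoning
      summand = λ f → guard (tgt e ≟ⱽ src f) (τ e f ℤ.* term f ν (g ∷ P))
      others : ∀ f → f ≢ g → summand f ≡ 0ℤ
      others f f≢g = trans (cong (guard (tgt e ≟ⱽ src f)) (trans (cong (ℤ._*_ (τ e f)) (term-other f ν g P (f≢g ∘ sym))) (ℤ.*-zeroʳ (τ e f))))
        (guard-0 (tgt e ≟ⱽ src f))
      to : PathOf e (δ e ⊞ ν) (e ∷ g ∷ P) → tgt e ≡ src g × PathOf g ν (g ∷ P)
      to (path@(_ , tgt≡ ∷ _ , _) , eq) = tgt≡ , path-tail path , ⊞-cancel (δ e) (trans (sym (multiplicity-∷ e (g ∷ P))) eq)
      from : tgt e ≡ src g × PathOf g ν (g ∷ P) → PathOf e (δ e ⊞ ν) (e ∷ g ∷ P)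
      from (tgt≡ , path , refl) = path-∷ tgt≡ path , multiplicity-∷ e (g ∷ P)

    ∑-end : ∀ m ν → Vec.sum ν ≡ m → ∑ (words edges m) (end ν) ≡ 𝟙 ν
    ∑-end zero    ν _  = ℤ.+-identityʳ (𝟙 ν)
    ∑-end (suc m) ν eq = trans
      (trans (∑-concatMap (λ e → map (e ∷_) (words edges m)) (end ν) (allFin edges))
        (∑-zero (All.universal (λ e → trans (∑-map (e ∷_) (end ν) (words edges m)) (∑-zero (All.universal (λ _ → refl) (words edges m)))) (allFin edges))))
      (sym (guard-no (zeros ≟ᵉ ν) λ { refl → contradiction (trans (sym (sum-zeros edges)) eq) λ () }))

    -- Removing the first letter e maps the words of length one more than the degree of ν to those
    -- of length equal to it, and the tails are sorted by whether they are empty or begin with some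
    -- f.
    path-expand : ∀ e → pathSeries e j ≗ shift (δ e) (expand e 𝟙 (λ f → pathSeries f j))
    path-expand e μ with divides? (δ e) μ
    ... | no ¬δ = trans (pathSeries-∑ e μ) (trans
        (∑-zero (All.universal (λ P → guard-no (pathOf? e μ P) (λ (path , eq) → ¬δ (divisible P path eq))) (words edges (Vec.sum μ))))
        (sym (shift-no (δ e) (expand e 𝟙 (λ f → pathSeries f j)) ¬δ)))
      where
      divisible : ∀ P → Path e j P → multiplicity P ≡ μ → Divides (δ e) μ
      divisible (_ ∷ P) (refl , _) eq = multiplicity P , trans (sym (multiplicity-∷ e P)) eq
    ... | yes (ν , refl) = begin
      pathSeries e j (δ e ⊞ ν) ≡⟨ pathSeries-∑ e (δ e ⊞ ν) ⟩
      ∑ (words edges (Vec.sum (δ e ⊞ ν))) (term e (δ e ⊞ ν))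
        ≡⟨ cong (λ m → ∑ (words edges m) (term e (δ e ⊞ ν))) (trans (sum-⊞ (δ e) ν) (cong (_+ Vec.sum ν) (sum-δ e))) ⟩
      ∑ (words edges (suc (Vec.sum ν))) (term e (δ e ⊞ ν))
        ≡⟨ words-head (Vec.sum ν) (term e (δ e ⊞ ν)) e (term-other e (δ e ⊞ ν)) ⟩
      ∑ W (λ P → term e (δ e ⊞ ν) (e ∷ P)) ≡⟨ ∑-cong W (term-expand e ν) ⟩
      ∑ W (λ P → ι e ℤ.* (A P ℤ.+ ∑ (allFin edges) (λ f → guard (tgt e ≟ⱽ src f) (τ e f ℤ.* term f ν P))))
        ≡⟨ ∑-* (ι e) _ W ⟩
      ι e ℤ.* ∑ W (λ P → A P ℤ.+ ∑ (allFin edges) (λ f → guard (tgt e ≟ⱽ src f) (τ e f ℤ.* term f ν P)))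
        ≡⟨ cong (ℤ._*_ (ι e)) (∑-+ A (λ P → ∑ (allFin edges) (λ f → guard (tgt e ≟ⱽ src f) (τ e f ℤ.* term f ν P))) W) ⟩
      ι e ℤ.* (∑ W A ℤ.+ ∑ W (λ P → ∑ (allFin edges) (λ f → guard (tgt e ≟ⱽ src f) (τ e f ℤ.* term f ν P))))
        ≡⟨ cong (ℤ._*_ (ι e)) (cong₂ ℤ._+_
             (trans (∑-guard (tgt e ≟ⱽ boundary j) (end ν) W) (cong (guard (tgt e ≟ⱽ boundary j)) (∑-end (Vec.sum ν) ν refl)))
             (trans (∑-swap (λ P f → guard (tgt e ≟ⱽ src f) (τ e f ℤ.* term f ν P)) W (allFin edges))
               (∑-cong (allFin edges) (λ f → trans (∑-guard (tgt e ≟ⱽ src f) (λ P → τ e f ℤ.* term f ν P) W)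
                 (cong (guard (tgt e ≟ⱽ src f)) (trans (∑-* (τ e f) (term f ν) W) (cong (ℤ._*_ (τ e f)) (sym (pathSeries-∑ f ν))))))))) ⟩
      expand e 𝟙 (λ f → pathSeries f j) ν
        ≡⟨ shift-yes (δ e) (expand e 𝟙 (λ f → pathSeries f j)) ν ⟨
      shift (δ e) (expand e 𝟙 (λ f → pathSeries f j)) (δ e ⊞ ν) ∎
      where
      open ≡-Reasoning
      W = words edges (Vec.sum ν)
      A : List Edge → ℤ
      A P = guard (tgt e ≟ⱽ boundary j) (end ν P)

  module FlowExpansion where
    C : Series edges
    C = toSeries conservativeFlowPolynomial

    Φ : Edge → Series edges
    Φ e = toSeries (edgeFlowPolynomial e j)

    flowSign : Edge → Subset edges → ℤ
    flowSign e F = pathSign (walkOf e j F)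

    C-at : ∀ F → C (indicator F) ≡ guard (conservativeFlow? F) 1ℤ
    C-at = coefficient-at conservativeFlow? (λ _ → 1ℤ)

    Φ-at : ∀ e F → Φ e (indicator F) ≡ guard (edgeFlow? e j F) (flowSign e F)
    Φ-at e = coefficient-at (edgeFlow? e j) (flowSign e)

    Φ-zero : ∀ e {μ} → (∀ F → indicator F ≡ μ → ¬ EdgeFlow e j F) → Φ e μ ≡ 0ℤ
    Φ-zero e = coefficient-zero (edgeFlow? e j) (flowSign e)

    Body : Edge → Exponent edges → ℤ
    Body e = expand e C Φ

    private
      zero-summand : ∀ e f {x} → x ≡ 0ℤ → guard (tgt e ≟ⱽ src f) (τ e f ℤ.* x) ≡ 0ℤ
      zero-summand e f refl = trans (cong (guard (tgt e ≟ⱽ src f)) (ℤ.*-zeroʳ (τ e f))) (guard-0 (tgt e ≟ⱽ src f))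

      body-≡ : ∀ e ν {x y} → guard (tgt e ≟ⱽ boundary j) (C ν) ≡ x →
        ∑ (allFin edges) (λ f → guard (tgt e ≟ⱽ src f) (τ e f ℤ.* Φ f ν)) ≡ y → Body e ν ≡ ι e ℤ.* (x ℤ.+ y)
      body-≡ e ν eq₁ eq₂ = cong (ℤ._*_ (ι e)) (cong₂ ℤ._+_ eq₁ eq₂)

      body-zero : ∀ e ν → guard (tgt e ≟ⱽ boundary j) (C ν) ≡ 0ℤ →
        ∑ (allFin edges) (λ f → guard (tgt e ≟ⱽ src f) (τ e f ℤ.* Φ f ν)) ≡ 0ℤ → Body e ν ≡ 0ℤ
      body-zero e ν eq₁ eq₂ = trans (body-≡ e ν eq₁ eq₂) (ℤ.*-zeroʳ (ι e))

      inner≢boundary : ∀ {e i} → Inner (tgt e) → tgt e ≢ boundary i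
      inner≢boundary (u , eq) tgt≡ = contradiction (trans (sym eq) tgt≡) λ ()

      Continues : Edge → Subset edges → Edge → Set
      Continues e F f = tgt e ≡ src f × EdgeFlow f j F

      continues? : ∀ e F → Decidable (Continues e F)
      continues? e F f = (tgt e ≟ⱽ src f) ×-dec edgeFlow? f j F

      summand-zero : ∀ e F f → ¬ Continues e F f → guard (tgt e ≟ⱽ src f) (τ e f ℤ.* Φ f (indicator F)) ≡ 0ℤ
      summand-zero e F f ¬continues = trans
        (guard-cong (tgt e ≟ⱽ src f) {y = 0ℤ} (λ tgt≡ → trans (cong (ℤ._*_ (τ e f))
          (trans (Φ-at f F) (guard-no (edgeFlow? f j F) (λ flow → ¬continues (tgt≡ , flow))))) (ℤ.*-zeroʳ (τ e f))))
        (guard-0 (tgt e ≟ⱽ src f))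

      summand-yes : ∀ e F f → Continues e F f →
        guard (tgt e ≟ⱽ src f) (τ e f ℤ.* Φ f (indicator F)) ≡ τ e f ℤ.* flowSign f F
      summand-yes e F f (tgt≡ , flow) = trans (guard-yes (tgt e ≟ⱽ src f) tgt≡)
        (cong (ℤ._*_ (τ e f)) (trans (Φ-at f F) (guard-yes (edgeFlow? f j F) flow)))

    module RemoveFlow (e : Edge) (F : Subset edges) (e∈F : e ∈ˢ F) where
      open ≡-Reasoning

      Goal : Set
      Goal = guard (edgeFlow? e j F) (flowSign e F) ≡ Body e (indicator (F - e))

      ends : ∀ {i} → tgt e ≡ boundary i → Goal
      ends {i} tgt≡ = trans at-end (sym (body-≡ e (indicator (F - e)) refl (∑-zero (All.universal (λ f →
        summand-zero e (F - e) f (λ (eq , _) → boundary-one-way {e} {f} tgt≡ (trans (sym eq) tgt≡))) (allFin edges)))))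
        where
        at-end : guard (edgeFlow? e j F) (flowSign e F) ≡ ι e ℤ.* (guard (tgt e ≟ⱽ boundary j) (C (indicator (F - e))) ℤ.+ 0ℤ)
        at-end = begin
          guard (edgeFlow? e j F) (flowSign e F)
            ≡⟨ guard-cong (edgeFlow? e j F) (λ flow →
                trans (cong pathSign (walkOf-last flow (trans tgt≡ (cong boundary (proj₁ (flow-end flow tgt≡)))))) (pathSign-[-] e)) ⟩
          guard (edgeFlow? e j F) (ι e)
            ≡⟨ guard-⇔ (edgeFlow? e j F) ((tgt e ≟ⱽ boundary j) ×-dec conservativeFlow? (F - e))
                (λ flow → trans tgt≡ (cong boundary (proj₁ (flow-end flow tgt≡))) , proj₂ (flow-end flow tgt≡))
                (λ (eq , conservative) → flow-last e∈F eq conservative) ⟩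
          guard ((tgt e ≟ⱽ boundary j) ×-dec conservativeFlow? (F - e)) (ι e)
            ≡⟨ guard-× (tgt e ≟ⱽ boundary j) (conservativeFlow? (F - e)) (ι e) ⟩
          guard (tgt e ≟ⱽ boundary j) (guard (conservativeFlow? (F - e)) (ι e))
            ≡⟨ cong (guard (tgt e ≟ⱽ boundary j)) (trans
                (cong (guard (conservativeFlow? (F - e))) (sym (ℤ.*-identityʳ (ι e))))
                (trans (guard-* (conservativeFlow? (F - e)) (ι e) 1ℤ) (cong (ℤ._*_ (ι e)) (sym (C-at (F - e)))))) ⟩
          guard (tgt e ≟ⱽ boundary j) (ι e ℤ.* C (indicator (F - e)))
            ≡⟨ guard-* (tgt e ≟ⱽ boundary j) (ι e) _ ⟩
          ι e ℤ.* guard (tgt e ≟ⱽ boundary j) (C (indicator (F - e)))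
            ≡⟨ cong (ℤ._*_ (ι e)) (ℤ.+-identityʳ _) ⟨
          ι e ℤ.* (guard (tgt e ≟ⱽ boundary j) (C (indicator (F - e))) ℤ.+ 0ℤ) ∎

      stuck : Inner (tgt e) → ¬ ∃ (Continues e (F - e)) → Goal
      stuck inner-tgt none = trans (guard-no (edgeFlow? e j F) ends-nowhere) (sym (body-zero e (indicator (F - e))
        (guard-no (tgt e ≟ⱽ boundary j) (inner≢boundary {e} inner-tgt))
        (∑-zero (All.universal (λ f → summand-zero e (F - e) f (λ continues → none (f , continues))) (allFin edges)))))
        where
        ends-nowhere : ¬ EdgeFlow e j F
        ends-nowhere flow = let f , f∈F , tgt≡ = leaving-edge flow (proj₂ inner-tgt) in none (f , tgt≡ , flow-tail flow f∈F tgt≡)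

      -- At most one summand survives: two edges continuing e in `F - e` would both leave, within
      -- the flow F, the inner vertex where e ends, against `next-≡`.
      continued : Inner (tgt e) → ∃ (Continues e (F - e)) → Goal
      continued inner-tgt (f , tgt≡ , flow-f) = begin
        guard (edgeFlow? e j F) (flowSign e F) ≡⟨ guard-yes (edgeFlow? e j F) flow-e ⟩
        flowSign e F ≡⟨ cong pathSign (walkOf-∷ flow-e f∈F tgt≡) ⟩
        pathSign (e ∷ walkOf f j (F - e))
          ≡⟨ sign-∷ (walkOf f j (F - e)) (proj₁ (proj₁ (walkOf-decomposes flow-f))) ⟩
        ι e ℤ.* (τ e f ℤ.* flowSign f (F - e))
          ≡⟨ cong (ℤ._*_ (ι e)) (trans (∑-single (Unique.allFin⁺ edges) (∈-allFin f) (λ {g} _ → others g))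
              (summand-yes e (F - e) f (tgt≡ , flow-f))) ⟨
        ι e ℤ.* ∑ (allFin edges) (λ f → guard (tgt e ≟ⱽ src f) (τ e f ℤ.* Φ f (indicator (F - e))))
          ≡⟨ cong (ℤ._*_ (ι e)) (ℤ.+-identityˡ _) ⟨
        ι e ℤ.* (0ℤ ℤ.+ ∑ (allFin edges) (λ f → guard (tgt e ≟ⱽ src f) (τ e f ℤ.* Φ f (indicator (F - e)))))
          ≡⟨ body-≡ e (indicator (F - e)) (guard-no (tgt e ≟ⱽ boundary j) (inner≢boundary {e} inner-tgt)) refl ⟨
        Body e (indicator (F - e)) ∎
        where
        flow-e : EdgeFlow e j F
        flow-e = flow-cons e∈F tgt≡ flow-f
        f∈F : f ∈ˢ F
        f∈F = proj₁ (∈-remove (proj₁ flow-f))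
        sign-∷ : ∀ P → Path f j P → pathSign (e ∷ P) ≡ ι e ℤ.* (τ e f ℤ.* pathSign P)
        sign-∷ (_ ∷ P) (refl , _) = trans (pathSign-∷∷ e f P) (ℤ.*-assoc (ι e) (τ e f) (pathSign (f ∷ P)))
        others : ∀ g → g ≢ f → guard (tgt e ≟ⱽ src g) (τ e g ℤ.* Φ g (indicator (F - e))) ≡ 0ℤ
        others g g≢f = summand-zero e (F - e) g (λ (tgt≡g , flow-g) →
          g≢f (next-≡ flow-e tgt≡g tgt≡ (proj₁ (∈-remove (proj₁ flow-g))) f∈F))

    remove-flow : ∀ e F → e ∈ˢ F → guard (edgeFlow? e j F) (flowSign e F) ≡ Body e (indicator (F - e))
    remove-flow e F e∈F = cases (inner-or-boundary (tgt e)) (any? (continues? e (F - e)))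
      where
      open RemoveFlow e F e∈F
      cases : Inner (tgt e) ⊎ (∃ λ i → tgt e ≡ boundary i) → Dec (∃ (Continues e (F - e))) → Goal
      cases (inj₂ (i , tgt≡))  _               = ends tgt≡
      cases (inj₁ inner-tgt) (no none)       = stuck inner-tgt none
      cases (inj₁ inner-tgt) (yes continues) = continued inner-tgt continues

    -- The two ways of continuing e inside a flow that already contains e cancel.
    repeated-edge : ∀ e F → e ∈ˢ F → Body e (indicator F) ≡ 0ℤ
    repeated-edge e F e∈F = body-zero e (indicator F)
      (trans (guard-cong (tgt e ≟ⱽ boundary j) (λ tgt≡ → trans (C-at F)
        (guard-no (conservativeFlow? F) (λ (inside-disk , _) → inside-disk e e∈F j (inj₂ tgt≡))))) (guard-0 (tgt e ≟ⱽ boundary j)))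
      (cancel (any? (continues? e F)))
      where
      summand = λ f → guard (tgt e ≟ⱽ src f) (τ e f ℤ.* Φ f (indicator F))
      pair : ∀ {f g} → Continues e F f → Fork j F e f g → ∑ (allFin edges) summand ≡ 0ℤ
      pair {f} {g} continues fork = trans (∑-pair (Unique.allFin⁺ edges) (∈-allFin f) (∈-allFin g) f≢g others)
        (trans (cong₂ ℤ._+_ (summand-yes e F f continues) (summand-yes e F g (tgt≡g , flow-g))) (fork-cancel fork))
        where
        open Fork fork using (f≢g; tgt≡g; flow-g; only-f-g)
        others : ∀ h → h ≢ f → h ≢ g → summand h ≡ 0ℤ
        others h h≢f h≢g = summand-zero e F h λ (tgt≡h , h∈F , _) →
          Sum.[ h≢f , h≢g ] (only-f-g h∈F (sym tgt≡h))
      cancel : Dec (∃ (Continues e F)) → ∑ (allFin edges) summand ≡ 0ℤ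
      cancel (no none) = ∑-zero (All.universal (λ f → summand-zero e F f (λ continues → none (f , continues))) (allFin edges))
      cancel (yes (f , continues@(tgt≡ , flow-f))) = pair continues (proj₂ (make-fork flow-f e∈F tgt≡))

    -- Write a monomial divisible by x_e as x_e times x^ν. If ν is no indicator, both sides vanish.
    -- If it belongs to a set without e, adding e is the correspondence of `remove-flow`. If the set
    -- contains e, the left side has no such term and the right side cancels by `repeated-edge`.
    flow-expand : ∀ e → Φ e ≗ shift (δ e) (Body e)
    flow-expand e μ = cases μ (divides? (δ e) μ)
      where
      open ≡-Reasoning
      insert : ∀ F′ → e ∉ˢ F′ → Φ e (δ e ⊞ indicator F′) ≡ Body e (indicator F′)
      insert F′ e∉F′ = begin
        Φ e (δ e ⊞ indicator F′) ≡⟨ cong (λ G → Φ e (δ e ⊞ indicator G)) (insert-remove F′ e∉F′) ⟨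
        Φ e (δ e ⊞ indicator (F - e)) ≡⟨ cong (Φ e) (indicator-remove e∈F) ⟩
        Φ e (indicator F) ≡⟨ Φ-at e F ⟩
        guard (edgeFlow? e j F) (flowSign e F) ≡⟨ remove-flow e F e∈F ⟩
        Body e (indicator (F - e)) ≡⟨ cong (Body e ∘ indicator) (insert-remove F′ e∉F′) ⟩
        Body e (indicator F′) ∎
        where
        F = F′ ∪ ⁅ e ⁆
        e∈F : e ∈ˢ F
        e∈F = ∈-insert F′ e
      at-subset : ∀ F′ → Dec (e ∈ˢ F′) → Φ e (δ e ⊞ indicator F′) ≡ Body e (indicator F′)
      at-subset F′ (yes e∈F′) = trans (Φ-zero e (λ F eq _ → not-indicator e∈F′ eq)) (sym (repeated-edge e F′ e∈F′))
      at-subset F′ (no e∉F′)  = insert F′ e∉F′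
      at-multiple : ∀ ν → Dec (∃ λ F → indicator F ≡ ν) → Φ e (δ e ⊞ ν) ≡ Body e ν
      at-multiple ν (no not-subset) = trans
        (Φ-zero e (λ F eq (e∈F , _) → not-subset (F - e , ⊞-cancel (δ e) (trans (indicator-remove e∈F) eq))))
        (sym (body-zero e ν
          (trans (cong (guard (tgt e ≟ⱽ boundary j)) (coefficient-zero conservativeFlow? (λ _ → 1ℤ) (λ F eq _ → not-subset (F , eq)))) (guard-0 (tgt e ≟ⱽ boundary j)))
          (∑-zero (All.universal (λ f → zero-summand e f (Φ-zero f (λ F eq _ → not-subset (F , eq)))) (allFin edges)))))
      at-multiple _ (yes (F′ , refl)) = at-subset F′ (e ∈? F′)
      cases : ∀ μ → Dec (Divides (δ e) μ) → Φ e μ ≡ shift (δ e) (Body e) μ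
      cases μ (no ¬δ) = trans
        (Φ-zero e (λ F eq (e∈F , _) → ¬δ (indicator (F - e) , trans (indicator-remove e∈F) eq)))
        (sym (shift-no (δ e) (Body e) ¬δ))
      cases _ (yes (ν , refl)) = trans (at-multiple ν (Subset.anySubset? (λ F → indicator F ≟ᵉ ν))) (sym (shift-yes (δ e) (Body e) ν))

  open PathExpansion using (path-expand)
  open FlowExpansion using (flow-expand; C; Φ)

  -- Multiplication by C passes through the linear `expand`, so both families satisfy the same
  -- recursion. Its factor x_e makes a coefficient depend only on coefficients of total degree one
  -- less, whence the induction on the bound m.
  flow-series : ∀ m e μ → Vec.sum μ ≤ m → act conservativeFlowPolynomial (pathSeries e j) μ ≡ Φ e μ
  flow-series m e μ ∣μ∣≤m = trans
    (act-cong q (path-expand e) μ)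
    (trans (sym (shift-act (δ e) q (expand e 𝟙 (λ f → pathSeries f j)) μ))
      (trans (agree m (divides? (δ e) μ) ∣μ∣≤m) (sym (flow-expand e μ))))
    where
    q = conservativeFlowPolynomial
    s = expand e 𝟙 (λ f → pathSeries f j)
    agree : ∀ m → Dec (Divides (δ e) μ) → Vec.sum μ ≤ m → shift (δ e) (act q s) μ ≡ shift (δ e) (expand e C Φ) μ
    agree m (no ¬δ) _ = trans (shift-no (δ e) (act q s) ¬δ) (sym (shift-no (δ e) (expand e C Φ) ¬δ))
    agree zero (yes (ν , refl)) ∣μ∣≤0 = contradiction (subst (_≤ 0) (trans (sum-⊞ (δ e) ν) (cong (_+ Vec.sum ν) (sum-δ e))) ∣μ∣≤0) λ ()
    agree (suc m) (yes (ν , refl)) ∣μ∣≤1+m = begin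
      shift (δ e) (act q s) (δ e ⊞ ν) ≡⟨ shift-yes (δ e) (act q s) ν ⟩
      act q s ν ≡⟨ act-expand q e 𝟙 (λ f → pathSeries f j) ν ⟩
      expand e (act q 𝟙) (λ f → act q (pathSeries f j)) ν ≡⟨ cong (ℤ._*_ (ι e)) (cong₂ ℤ._+_
            (cong (guard (tgt e ≟ⱽ boundary j)) (act-𝟙 q ν))
            (∑-cong (allFin edges) (λ f → cong (λ z → guard (tgt e ≟ⱽ src f) (τ e f ℤ.* z))
            (flow-series m f ν (ℕ.≤-pred (subst (_≤ suc m) (trans (sum-⊞ (δ e) ν) (cong (_+ Vec.sum ν) (sum-δ e))) ∣μ∣≤1+m)))))) ⟩
      expand e C Φ ν ≡⟨ shift-yes (δ e) (expand e C Φ) ν ⟨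
      shift (δ e) (expand e C Φ) (δ e ⊞ ν) ∎
      where open ≡-Reasoning

  conservative⊛path≗flow : ∀ e → toSeries conservativeFlowPolynomial ⊛ pathSeries e j ≗ toSeries (edgeFlowPolynomial e j)
  conservative⊛path≗flow e μ = trans (⊛-act conservativeFlowPolynomial (pathSeries e j) μ) (flow-series (Vec.sum μ) e μ ℕ.≤-refl)

-- Positivity of the denominator and the values of the edge vectors

module Positivity {c ℓ₁ ℓ₂} (𝕂 : OrderedField c ℓ₁ ℓ₂) where
  open OrderedField 𝕂
  open OrderedFieldProperties 𝕂
  open Evaluation 𝕂

  ^-positive : ∀ {x} m → 0# < x → 0# < x ^ m
  ^-positive zero    0<x = 0<1
  ^-positive (suc m) 0<x = *-positive 0<x (^-positive m 0<x)

  product-positive : ∀ {m} (f : Fin m → Carrier) → (∀ i → 0# < f i) → 0# < product f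
  product-positive {zero}  f 0<f = 0<1
  product-positive {suc m} f 0<f = *-positive (0<f Fin.zero) (product-positive (f ∘ Fin.suc) (0<f ∘ Fin.suc))

  module _ {E} (w : Fin E → Carrier) (0<w : ∀ e → 0# < w e) where
    term-positive : ∀ μ → 0# < fromℤ 1ℤ * monomial w μ
    -- `fromℤ 1ℤ` unfolds to `1# + 0#`.
    term-positive μ = *-positive (pos-resp (sym (+-identityʳ 1#)) 0<1)
      (product-positive (λ e → w e ^ Vec.lookup μ e) (λ e → ^-positive (Vec.lookup μ e) (0<w e)))

    -- A sum of monomials with coefficient 1 at positive weights; the member t excludes the empty
    -- sum. For conservative flows it is supplied by the empty flow.
    evaluate-positive : ∀ (p : Polynomial E) {t} → All ((_≡ 1ℤ) ∘ proj₁) p → t ∈ p → 0# < evaluate w p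
    evaluate-positive ((_ , μ) ∷ p) (≡.refl ∷ ones) (here _)   = +-pos-nonneg (term-positive μ) (nonneg p ones)
      where
      nonneg : ∀ p → All ((_≡ 1ℤ) ∘ proj₁) p → 0# ≤ evaluate w p
      nonneg []            []              = inj₂ refl
      nonneg ((_ , μ) ∷ p) (≡.refl ∷ ones) = inj₁ (+-pos-nonneg (term-positive μ) (nonneg p ones))
    evaluate-positive ((_ , μ) ∷ p) (≡.refl ∷ ones) (there t∈) = +-pos (term-positive μ) (evaluate-positive p ones t∈)

  ⁻¹-inverse : ∀ x → ¬ x ≈ 0# → x * x ⁻¹ ≈ 1#
  ⁻¹-inverse x x≉0 with x ≟ 0#
  ... | yes x≈0 = ⊥-elim (x≉0 x≈0)
  ... | no x≉0′ = proj₂ (proj₂ (invertible x x≉0′))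

  *-quotient : ∀ d y → ¬ d ≈ 0# → d * (y * d ⁻¹) ≈ y
  *-quotient d y d≉0 = trans (*-congˡ (*-comm y (d ⁻¹))) (trans (sym (*-assoc d (d ⁻¹) y))
    (trans (*-congʳ (⁻¹-inverse d d≉0)) (*-identityˡ y)))

  cancelˡ : ∀ {x y z} → ¬ x ≈ 0# → x * y ≈ x * z → y ≈ z
  cancelˡ {x} {y} {z} x≉0 eq = trans (sym (quotient y)) (trans (*-congˡ eq) (quotient z))
    where
    quotient : ∀ y → x ⁻¹ * (x * y) ≈ y
    quotient y = trans (sym (*-assoc (x ⁻¹) x y)) (trans (*-congʳ (trans (*-comm (x ⁻¹) x) (⁻¹-inverse x x≉0))) (*-identityˡ y))

module EdgeVectorValues {c ℓ₁ ℓ₂} (𝕂 : OrderedField c ℓ₁ ℓ₂) {k n : ℕ}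
  (N : PlabicNetwork 𝕂 k n) (𝔩 : GaugeRayDirection (PlabicNetwork.graph N)) where
  open OrderedField 𝕂
  open OrderedFieldProperties 𝕂
  open Positivity 𝕂
  open Evaluation 𝕂
  open EvaluationProperties 𝕂
  open PlabicNetwork N
  open GaugeRayDirection 𝔩
  open Flows graph using (module In; module Out)

  d : Carrier
  d = evaluate weight conservativeFlowPolynomial

  empty-conservative : ConservativeFlow Subset.⊥
  empty-conservative = (λ f f∈ → ⊥-elim (Subset.∉⊥ f∈)) , λ v →
    ≡.trans (In.count-zero {Subset.⊥} {inner v} (λ x x∈ _ → Subset.∉⊥ x∈)) (≡.sym (Out.count-zero {Subset.⊥} {inner v} (λ x x∈ _ → Subset.∉⊥ x∈)))

  0<d : 0# < d
  0<d = evaluate-positive weight weight-positive conservativeFlowPolynomial (All.map⁺ (All.universal (λ _ → ≡.refl) _))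
    (∈-map⁺ (λ C → 1ℤ , indicator C) (∈-filter⁺ conservativeFlow? (Exponents.∈-subsets Subset.⊥) empty-conservative))

  flow-identity : ∀ e j → toSeries conservativeFlowPolynomial ⊛ pathSeries e j ≗ toSeries (edgeFlowPolynomial e j)
  flow-identity e j = Recurrences.conservative⊛path≗flow graph 𝔩 j e

  quotient-value : ∀ e j → HasValue (pathSeries e j) weight (evaluate weight (edgeFlowPolynomial e j) * d ⁻¹)
  quotient-value e j = edgeFlowPolynomial e j , conservativeFlowPolynomial , flow-identity e j
    , pos⇒≉0 0<d , *-quotient d (evaluate weight (edgeFlowPolynomial e j)) (pos⇒≉0 0<d)

  -- The quotient p/q behind x is arbitrary. Cross-multiplying it with the identity for d gives q (d
  -- x) = q φ at the weights, φ being the flow polynomial, and the nonzero factors q and d can be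
  -- cancelled in turn.
  value-unique : ∀ e j {x} → HasValue (pathSeries e j) weight x → x ≈ evaluate weight (edgeFlowPolynomial e j) * d ⁻¹
  value-unique e j {x} (p , q , qf≗p , q≉0 , qx≈p) = cancelˡ (pos⇒≉0 0<d) (trans (cancelˡ q≉0 (begin
    evaluate weight q * (d * x)
      ≈⟨ trans (sym (*-assoc _ d x)) (trans (*-congʳ (*-comm _ d)) (*-assoc d _ x)) ⟩
    d * (evaluate weight q * x) ≈⟨ *-congˡ qx≈p ⟩
    d * evaluate weight p
      ≈⟨ cross-multiply weight (pathSeries e j) q p conservativeFlowPolynomial
          (edgeFlowPolynomial e j) qf≗p (flow-identity e j) ⟨
    evaluate weight q * evaluate weight (edgeFlowPolynomial e j)   ∎))
    (sym (*-quotient d (evaluate weight (edgeFlowPolynomial e j)) (pos⇒≉0 0<d))))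
    where open SetoidReasoning setoid

  module _ {m ℓm} (V : Module commutativeRing m ℓm) where
    open EdgeVectors N 𝔩 V
    open Module V

    sinkCombination-cong : ∀ {a b : Fin n → Carrier} B → (∀ j → IsSink j → a j ≈ b j) → sinkCombination a B ≈ᴹ sinkCombination b B
    sinkCombination-cong {a} {b} B a≈b = go sinks (All.all-filter isSink? (List.allFin n))
      where
      go : ∀ js → All IsSink js →
        List.foldr (λ j x → a j *ₗ B j +ᴹ x) 0ᴹ js ≈ᴹ List.foldr (λ j x → b j *ₗ B j +ᴹ x) 0ᴹ js
      go []       []               = ≈ᴹ-refl
      go (j ∷ js) (sink ∷ areSinks) = +ᴹ-cong (*ₗ-cong (a≈b j sink) ≈ᴹ-refl) (go js areSinks)

    edgeVector⇔ : ∀ B e E → IsEdgeVector B e E ⇔ E ≈ᴹ sinkCombination (flowQuotient e) B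
    edgeVector⇔ B e E = mk⇔
      (λ (a , values , E≈) → ≈ᴹ-trans E≈ (sinkCombination-cong B (λ j sink → value-unique e j (values j sink))))
      -- Conversely the quotients themselves serve as the values of the path series.
      (λ E≈ → flowQuotient e , (λ j _ → quotient-value e j) , E≈)

theorem4p1 :
    ∀ {c ℓ₁ ℓ₂ m ℓm} (𝕂 : OrderedField c ℓ₁ ℓ₂) {k n : ℕ} → 0 ℕ.< k → k ℕ.< n →
    let open OrderedField 𝕂
        open Grassmannian 𝕂
        open Evaluation 𝕂 in
    (N : PlabicNetwork 𝕂 k n) (𝔩 : GaugeRayDirection (PlabicNetwork.graph N))
    (M : Matroid k n) (A : Matrix k n) →
    InCell M A →
    BoundaryMeasurement.Represents N A →
    Matroid.Basis M (image (PlabicNetwork.base N)) →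
    (V : Module commutativeRing m ℓm) →
    let open PlabicNetwork N
        open GaugeRayDirection 𝔩
        open EdgeVectors N 𝔩 V
        open Module V in
    (B : Fin n → Carrierᴹ) (e : Edge) →
      (∀ j → IsSink j →
        toSeries conservativeFlowPolynomial ⊛ pathSeries e j
          ≗ toSeries (edgeFlowPolynomial e j))
      × 0# < evaluate weight conservativeFlowPolynomial
      × (∀ E → IsEdgeVector B e E ⇔ E ≈ᴹ sinkCombination (flowQuotient e) B)
theorem4p1 𝕂 _ _ N 𝔩 _ _ _ _ _ V B e = (λ j _ → flow-identity e j) , 0<d , edgeVector⇔ V B e
  where open EdgeVectorValues 𝕂 N 𝔩
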